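{- Let $n\geq 1$ be an integer, $p>1$ real, $q=pe^{2\pi i/n}$, and let $A\subset\mathbb R$ be a finite nonempty alphabet. Let $\Lambda_{n,p,A}=\{\sum_{j=1}^\infty x_jq^{ -j}\mid x_j\in A\}$. For $h=1,\dots,n$ define $$\underline K(h)=\{k\in\{0,\dots,n-1\}\mid (k-h+1)\bmod n\leq \lfloor n/2\rfloor-1\},\qquad \overline K(h)=\{k\in\{0,\dots,n-1\}\mid (k-h+1)\bmod n\leq \lceil n/2\rceil-1\},$$ where $(k-h+1)\bmod n$ denotes the representative in $\{0,\dots,n-1\}$, and set $$\mathbf v_{2h-1}=\sum_{k\in\underline K(h)}q^k,\qquad \mathbf v_{2h}=\sum_{k\in\overline K(h)}q^k .$$ Then $$\mathrm{conv}(\Lambda_{n,p,A})=\frac{\max A-\min A}{p^n-1}\,\mathrm{conv}\{\mathbf v_h\mid h=1,\dots,2n\}+\frac{1}{p^n-1}\sum_{k=0}^{n-1}(\min A)\,q^k .$$ Moreover, if $n$ is even, then $$\mathrm{conv}(\Lambda_{n,p,A})=\frac{\max A-\min A}{p^n-1}\,\mathrm{conv}\{\mathbf v_{2h}\mid h=1,\dots,n\}+\frac{1}{p^n-1}\sum_{k=0}^{n-1}(\min A)\,q^k .$$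
   Context: For a set $Y\subset\mathbb C$, $c\in\mathbb R$ and $d\in\mathbb C$, $cY+d=\{cy+d\mid y\in Y\}$. $\mathrm{conv}$ denotes convex hull in $\mathbb C\cong\mathbb R^2$. -}

module Defs where

open import Level using (0ℓ; suc)
open import Algebra.Bundles using (CommutativeRing; RawRing; Semiring)
open import Data.Bool.Base using (if_then_else_)
open import Data.Fin.Base using (Fin; toℕ)
open import Data.Integer.Base using (+_; 1ℤ)
import Data.Integer.Base as ℤ
import Data.Integer.Properties as ℤ
open import Data.List.Base using (List; foldr; filter; map; upTo)
import Data.List.Extrema
open import Data.List.NonEmpty.Base using (List⁺; head; tail; toList)
import Data.List.Membership.Setoid
open import Data.Nat.Base as ℕ using (ℕ; ⌊_/2⌋; ⌈_/2⌉; _!)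
open import Data.Nat.Divisibility using (_∣?_)
open import Data.Product.Base using (Σ-syntax; ∃-syntax; _×_; _,_)
open import Relation.Binary.Bundles using (TotalOrder)
open import Relation.Binary.Core using (Rel)
open import Relation.Binary.Structures using (IsDecTotalOrder)
import Relation.Binary.Construct.NonStrictToStrict as NonStrictToStrict
open import Relation.Nullary using (¬_; does)
open import Relation.Unary using (Pred; Satisfiable; _∈_)

-- The real numbers, given by the axioms that determine them up to a unique
-- isomorphism.  Decidability of the order reflects that ℝ is read classically
-- (excluded middle for Set follows from it and `complete`).
record CompleteOrderedField : Set₁ where
  infix  8 _⁻¹
  infix  4 _≤_
  field
    commutativeRing : CommutativeRing 0ℓ 0ℓ

  open CommutativeRing commutativeRing public

  field
    _≤_             : Rel Carrier 0ℓ
    isDecTotalOrder : IsDecTotalOrder _≈_ _≤_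
    0≉1             : ¬ (0# ≈ 1#)
    +-monoˡ-≤       : ∀ {x y} z → x ≤ y → x + z ≤ y + z
    *-nonNeg        : ∀ {x y} → 0# ≤ x → 0# ≤ y → 0# ≤ x * y
    -- Total for convenience; nothing is assumed about the value of 0# ⁻¹.
    _⁻¹             : Carrier → Carrier
    ⁻¹-cong         : ∀ {x y} → x ≈ y → x ⁻¹ ≈ y ⁻¹
    ⁻¹-inverseʳ     : ∀ {x} → ¬ (x ≈ 0#) → x * x ⁻¹ ≈ 1#

  open NonStrictToStrict _≈_ _≤_ public using (_<_)

  UpperBound : Pred Carrier 0ℓ → Carrier → Set
  UpperBound S u = ∀ {x} → x ∈ S → x ≤ u

  Supremum : Pred Carrier 0ℓ → Carrier → Set
  Supremum S s = UpperBound S s × (∀ {y} → y < s → ∃[ x ] (x ∈ S × y < x))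

  field
    complete : ∀ S → Satisfiable S → (∃[ u ] UpperBound S u) → ∃[ s ] Supremum S s

  totalOrder : TotalOrder 0ℓ 0ℓ 0ℓ
  totalOrder = record { isTotalOrder = IsDecTotalOrder.isTotalOrder isDecTotalOrder }

-- k ∈ {0,…,n-1} with (k - h + 1) mod n ≤ b - 1, computed in ℤ.
residues : ∀ n .{{_ : ℕ.NonZero n}} → (b h : ℕ) → List ℕ
residues n b h =
  filter (λ k → + ((+ k ℤ.- + h ℤ.+ 1ℤ) ℤ.%ℕ n) ℤ.≤? + b ℤ.- 1ℤ) (upTo n)

K̲ : ∀ n .{{_ : ℕ.NonZero n}} → ℕ → List ℕ
K̲ n h = residues n ⌊ n /2⌋ h

K̄ : ∀ n .{{_ : ℕ.NonZero n}} → ℕ → List ℕ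
K̄ n h = residues n ⌈ n /2⌉ h

module Analysis (ℝ : CompleteOrderedField) where

  module ℝ where
    open CompleteOrderedField ℝ public
    open import Algebra.Definitions.RawSemiring (Semiring.rawSemiring semiring) public
      using (_^_; sum) renaming (_×_ to _·_)

  infix  4 _≈_
  infixl 6 _+_ _-_
  infixl 7 _*_
  infixr 7 _•_
  infix  8 -_ _⁻¹

  record ℂ : Set where
    constructor _+i_
    field
      re im : ℝ.Carrier
  open ℂ public

  _≈_ : Rel ℂ 0ℓ
  z ≈ w = re z ℝ.≈ re w × im z ℝ.≈ im w

  0ℂ 1ℂ : ℂ
  0ℂ = ℝ.0# +i ℝ.0#
  1ℂ = ℝ.1# +i ℝ.0#

  _+_ _-_ _*_ : ℂ → ℂ → ℂ
  z + w = (re z ℝ.+ re w) +i (im z ℝ.+ im w)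
  z - w = (re z ℝ.- re w) +i (im z ℝ.- im w)
  z * w = (re z ℝ.* re w ℝ.- im z ℝ.* im w) +i (re z ℝ.* im w ℝ.+ im z ℝ.* re w)

  -_ : ℂ → ℂ
  - z = (ℝ.- re z) +i (ℝ.- im z)

  _•_ : ℝ.Carrier → ℂ → ℂ
  c • z = (c ℝ.* re z) +i (c ℝ.* im z)

  ∣_∣² : ℂ → ℝ.Carrier
  ∣ z ∣² = re z ℝ.* re z ℝ.+ im z ℝ.* im z

  _⁻¹ : ℂ → ℂ
  z ⁻¹ = (∣ z ∣² ℝ.⁻¹) • (re z +i (ℝ.- im z))

  ℂ-rawRing : RawRing 0ℓ 0ℓ
  ℂ-rawRing = record
    { Carrier = ℂ ; _≈_ = _≈_ ; _+_ = _+_ ; _*_ = _*_ ; -_ = -_ ; 0# = 0ℂ ; 1# = 1ℂ }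

  open import Algebra.Definitions.RawSemiring (RawRing.rawSemiring ℂ-rawRing) public
    using (_^_; sum)

  -- The series a 0 + a 1 + … converges to z; ∣ s - z ∣ < ε is stated squared,
  -- which avoids square roots.
  HasSum : (ℕ → ℂ) → ℂ → Set
  HasSum a z = ∀ ε → ℝ.0# ℝ.< ε →
    ∃[ N ] (∀ m → N ℕ.≤ m → ∣ sum {m} (λ j → a (toℕ j)) - z ∣² ℝ.< ε ℝ.* ε)

  fromℕ : ℕ → ℝ.Carrier
  fromℕ k = k ℝ.· ℝ.1#

  -- w = e^z
  IsExp : ℂ → ℂ → Set
  IsExp z w = HasSum (λ k → (fromℕ (k !) ℝ.⁻¹) • z ^ k) w

  -- π is the least positive zero of sin, where sin x = Im e^{ix}.
  IsPi : ℝ.Carrier → Set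
  IsPi π = ℝ.0# ℝ.< π
         × (∃[ w ] (IsExp (ℝ.0# +i π) w × im w ℝ.≈ ℝ.0#))
         × (∀ x w → ℝ.0# ℝ.< x → x ℝ.< π → IsExp (ℝ.0# +i x) w → ¬ (im w ℝ.≈ ℝ.0#))

  -- ζ = e^{2πi/n}
  IsExp2πi/ : ℕ → ℂ → Set
  IsExp2πi/ n ζ =
    ∃[ π ] (IsPi π × IsExp (ℝ.0# +i (fromℕ 2 ℝ.* π ℝ.* fromℕ n ℝ.⁻¹)) ζ)

  conv : Pred ℂ 0ℓ → Pred ℂ 0ℓ
  conv Y z = ∃[ m ] Σ[ t ∈ (Fin m → ℝ.Carrier) ] Σ[ y ∈ (Fin m → ℂ) ]
      (∀ i → ℝ.0# ℝ.≤ t i)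
    × ℝ.sum t ℝ.≈ ℝ.1#
    × (∀ i → y i ∈ Y)
    × z ≈ sum (λ i → t i • y i)

  _·_⊕_ : ℝ.Carrier → Pred ℂ 0ℓ → ℂ → Pred ℂ 0ℓ
  (c · Y ⊕ d) z = ∃[ y ] (y ∈ Y × z ≈ c • y + d)

  -- Finite nonempty subsets of ℝ are given by nonempty lists of elements.
  open Data.List.Membership.Setoid ℝ.setoid using () renaming (_∈_ to _∈ˡ_)
  private module Extrema = Data.List.Extrema ℝ.totalOrder

  max min : List⁺ ℝ.Carrier → ℝ.Carrier
  max A = Extrema.max (head A) (tail A)
  min A = Extrema.min (head A) (tail A)

  -- Digits are indexed from 0, so x j is the coefficient of q^{-(j+1)}.
  Λ : ℂ → List⁺ ℝ.Carrier → Pred ℂ 0ℓ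
  Λ q A z = Σ[ x ∈ (ℕ → ℝ.Carrier) ]
    (∀ j → x j ∈ˡ toList A) × HasSum (λ j → x j • (q ⁻¹) ^ ℕ.suc j) z

  sumPowers : ℂ → List ℕ → ℂ
  sumPowers q ks = foldr _+_ 0ℂ (map (q ^_) ks)

  -- For m = 2h - 1 and for m = 2h alike, ⌈ m /2⌉ = h.
  v : ∀ n .{{_ : ℕ.NonZero n}} → ℂ → ℕ → ℂ
  v n q m = sumPowers q (if does (2 ∣? m) then K̄ n ⌈ m /2⌉ else K̲ n ⌈ m /2⌉)

{-# OPTIONS --safe #-}

-- Write q = p ζ.  Since qⁿ = pⁿ, collecting the digits of ∑ xⱼ q⁻ʲ by the residue of j modulo n shows that
-- Λ lies in the zonotope (pⁿ - 1)⁻¹ ∑ₖ [min A, max A] qᵏ, and n-periodic digit sequences realise all points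
-- of it with coefficients in {min A, max A}.  It remains to see that ∑ₖ [0, 1] qᵏ is the convex hull of the vₕ.
-- After replacing some generators by their negatives (and, for even n, merging the antiparallel pairs), they are
-- positive multiples of ωʲ, 0 ≤ j < N, where ω = e^{iπ/N} and N = n for odd n, N = n/2 for even n; the walk with
-- these steps, followed by their negatives, passes exactly through the vₕ.  That the zonotope lies in the hull of
-- the walk is proved by adding one generator at a time.  The angular order of the ωʲ amounts to sin > 0 on (0, π),
-- which follows from the power series of exp: sin is positive near 0 and Lipschitz, and π is its least positive zero.

module Submission where

open import Defs
open import Level using (0ℓ)
open import Algebra.Bundles using (CommutativeRing; Semiring)
import Algebra.Solver.Ring
open import Algebra.Solver.Ring.AlmostCommutativeRing using (fromCommutativeRing; _-Raw-AlmostCommutative⟶_)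
open import Data.Bool.Base using (Bool; true; false; if_then_else_)
open import Data.Empty using (⊥; ⊥-elim)
open import Data.Fin.Base using (Fin; zero; suc; toℕ)
open import Data.Integer.Base as ℤ using (ℤ; +_; -[1+_]; 1ℤ; +≤+)
open import Data.Integer.DivMod using (_/ℕ_; _%ℕ_; a≡a%ℕn+[a/ℕn]*n; n%ℕd<d)
import Data.Integer.Properties as ℤ
open import Data.List.Base using (List; filter; applyUpTo; upTo)
import Data.List.Extrema
import Data.List.Membership.Setoid
open import Data.List.NonEmpty.Base using (List⁺; head; tail; toList)
open import Data.List.Relation.Unary.All using (All; []; _∷_)
open import Data.List.Relation.Unary.Any as Any using (here; there)
open import Data.Maybe.Base using (just; nothing)
open import Data.Nat.Base as ℕ using (ℕ; zero; suc; z≤n; s≤s; z<s; s<s; s<s⁻¹; _!; ⌊_/2⌋; ⌈_/2⌉)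
open import Data.Nat.Divisibility using (_∣_; _∣?_; m∣m*n; ∣m+n∣m⇒∣n; ∣1⇒≡1)
open import Data.Nat.DivMod using (_%_; _/_; [m+n]%n≡m%n; [m+kn]%n≡m%n; m<n⇒m%n≡m; m≡m%n+[m/n]*n; m%n<n; %-distribˡ-+; m%n%n≡m%n)
import Data.Nat.Properties as ℕ
open import Data.Nat.Solver using (module +-*-Solver)
open import Data.Product.Base using (Σ-syntax; ∃-syntax; _×_; _,_; proj₁; proj₂)
open import Data.Sum.Base using (_⊎_; inj₁; inj₂; [_,_]′)
open import Function.Base using (_∘_; id)
open import Relation.Binary.Bundles using (Poset)
open import Relation.Binary.PropositionalEquality as ≡ using (_≡_)
import Relation.Binary.Reasoning.PartialOrder
import Relation.Binary.Reasoning.Setoid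
open import Relation.Binary.Structures using (IsDecTotalOrder)
open import Relation.Nullary using (¬_; yes; no; Dec; does; contradiction)
open import Relation.Nullary.Decidable using (dec-true; dec-false)
open import Relation.Unary using (Pred; Decidable; _∈_; _≐_)

-- The difficulty is one-sided: each vₕ is a subset sum of the powers of q, so periodic digits carry
-- it into Λ at once, and the geometric content is that the vₕ are enough. Enlarging a zonotope by a
-- generator g amounts to placing y and y + g in the new hull for every old vertex y. Half of these
-- points are again positions of the walk. Each of the others is the corner of a parallelogram
-- spanned by a partial sum and g (or by their negatives); the remaining steps add up to a vector
-- inside the angle of that parallelogram, which leads from the corner to a known vertex. Only signs
-- of determinants enter, so positive multiples of the ωʲ behave like the ωʲ. Collecting digits by
-- residue is encoded by the recurrence R Xᵢ = xᵢ + Xₙ₊ᵢ with R = pⁿ: multiplication by q then moves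
-- a window of n consecutive X by one digit, and m such moves give the m-th partial sum with an
-- explicit remainder. Limits are suprema in ℝ, reached through nested intervals, and the 1-norm on
-- ℂ keeps the estimates free of square roots.

-- The stdlib ring solver with integer coefficients, so that terms can cancel.
module IntegerRingSolver (R : CommutativeRing 0ℓ 0ℓ) where
  open CommutativeRing R
  open import Algebra.Properties.Semiring.Mult.TCOptimised semiring renaming (_×_ to _·_)
  -- These multiples send 1 and 2 to `1#` and `1# + 1#` definitionally, so that `con (+ 1)` and
  -- `con (+ 2)` stand for `1#` and `2#` in the solver calls.
  open import Algebra.Properties.Ring ring
  open import Algebra.Properties.AbelianGroup +-abelianGroup using (⁻¹-∙-comm; ε⁻¹≈ε; ⁻¹-involutive)
  open Relation.Binary.Reasoning.Setoid setoid

  private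
    ⟦_⟧ : ℤ → Carrier
    ⟦ + n ⟧      = n · 1#
    ⟦ -[1+ n ] ⟧ = - (suc n · 1#)

    neg-homo : ∀ i → ⟦ ℤ.- i ⟧ ≈ - ⟦ i ⟧
    neg-homo (+ zero)  = sym ε⁻¹≈ε
    neg-homo (+ suc n) = refl
    neg-homo -[1+ n ]  = sym (⁻¹-involutive _)

    cancel-suc : ∀ m n → suc m · 1# - suc n · 1# ≈ m · 1# - n · 1#
    cancel-suc m n = begin
      suc m · 1# - suc n · 1#
        ≈⟨ +-cong (1+× m 1#) (-‿cong (1+× n 1#)) ⟩
      (1# + m · 1#) - (1# + n · 1#)
        ≈⟨ +-cong (+-comm _ _) (sym (⁻¹-∙-comm _ _)) ⟩
      (m · 1# + 1#) + (- 1# - n · 1#)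
        ≈⟨ +-assoc _ _ _ ⟩
      m · 1# + (1# + (- 1# - n · 1#))
        ≈⟨ +-congˡ (sym (+-assoc _ _ _)) ⟩
      m · 1# + ((1# - 1#) - n · 1#)
        ≈⟨ +-congˡ (+-congʳ (-‿inverseʳ _)) ⟩
      m · 1# + (0# - n · 1#)
        ≈⟨ +-congˡ (+-identityˡ _) ⟩
      m · 1# - n · 1# ∎

    ⊖-homo : ∀ m n → ⟦ m ℤ.⊖ n ⟧ ≈ m · 1# - n · 1#
    ⊖-homo m       zero    = sym (trans (+-congˡ ε⁻¹≈ε) (+-identityʳ _))
    ⊖-homo zero    (suc n) = sym (+-identityˡ _)
    ⊖-homo (suc m) (suc n) = begin
      ⟦ suc m ℤ.⊖ suc n ⟧ ≡⟨ ≡.cong ⟦_⟧ (ℤ.[1+m]⊖[1+n]≡m⊖n m n) ⟩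
      ⟦ m ℤ.⊖ n ⟧ ≈⟨ ⊖-homo m n ⟩
      m · 1# - n · 1# ≈⟨ cancel-suc m n ⟨
      suc m · 1# - suc n · 1# ∎

    +-homo : ∀ i j → ⟦ i ℤ.+ j ⟧ ≈ ⟦ i ⟧ + ⟦ j ⟧
    +-homo (+ m)    (+ n)    = ×-homo-+ 1# m n
    +-homo (+ m)    -[1+ n ] = ⊖-homo m (suc n)
    +-homo -[1+ m ] (+ n)    = trans (⊖-homo n (suc m)) (+-comm _ _)
    +-homo -[1+ m ] -[1+ n ] = begin
      - (suc (suc (m ℕ.+ n)) · 1#) ≡⟨ ≡.cong (λ k → - (suc k · 1#)) (≡.sym (ℕ.+-suc m n)) ⟩
      - ((suc m ℕ.+ suc n) · 1#) ≈⟨ -‿cong (×-homo-+ 1# (suc m) (suc n)) ⟩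
      - (suc m · 1# + suc n · 1#) ≈⟨ ⁻¹-∙-comm _ _ ⟨
      - (suc m · 1#) - suc n · 1# ∎
      where import Data.Nat.Properties as ℕ

    +-scale : ∀ m i → ⟦ + m ℤ.* i ⟧ ≈ m · 1# * ⟦ i ⟧
    +-scale m (+ n) = begin
      ⟦ + m ℤ.* + n ⟧ ≡⟨ ≡.cong ⟦_⟧ (≡.sym (ℤ.pos-* m n)) ⟩
      (m ℕ.* n) · 1# ≈⟨ ×1-homo-* m n ⟩
      m · 1# * n · 1# ∎
    +-scale m -[1+ n ] = begin
      ⟦ + m ℤ.* -[1+ n ] ⟧ ≡⟨ ≡.cong ⟦_⟧ (≡.sym (ℤ.neg-distribʳ-* (+ m) (+ suc n))) ⟩
      ⟦ ℤ.- (+ m ℤ.* + suc n) ⟧ ≈⟨ neg-homo (+ m ℤ.* + suc n) ⟩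
      - ⟦ + m ℤ.* + suc n ⟧ ≈⟨ -‿cong (+-scale m (+ suc n)) ⟩
      - (m · 1# * suc n · 1#) ≈⟨ -‿distribʳ-* _ _ ⟩
      m · 1# * - (suc n · 1#) ∎

    *-homo : ∀ i j → ⟦ i ℤ.* j ⟧ ≈ ⟦ i ⟧ * ⟦ j ⟧
    *-homo (+ m)    j = +-scale m j
    *-homo -[1+ m ] j = begin
      ⟦ -[1+ m ] ℤ.* j ⟧ ≡⟨ ≡.cong ⟦_⟧ (≡.sym (ℤ.neg-distribˡ-* (+ suc m) j)) ⟩
      ⟦ ℤ.- (+ suc m ℤ.* j) ⟧ ≈⟨ neg-homo (+ suc m ℤ.* j) ⟩
      - ⟦ + suc m ℤ.* j ⟧ ≈⟨ -‿cong (+-scale (suc m) j) ⟩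
      - (suc m · 1# * ⟦ j ⟧) ≈⟨ -‿distribˡ-* _ _ ⟩
      - (suc m · 1#) * ⟦ j ⟧ ∎

    ℤ⟶R : ℤ.+-*-rawRing -Raw-AlmostCommutative⟶ fromCommutativeRing R
    ℤ⟶R = record
      { ⟦_⟧ = ⟦_⟧ ; +-homo = +-homo ; *-homo = *-homo ; -‿homo = neg-homo
      ; 0-homo = refl ; 1-homo = refl }

    coeff≟ : ∀ i j → _
    coeff≟ i j with i ℤ.≟ j
    ... | yes i≡j = just (reflexive (≡.cong ⟦_⟧ i≡j))
    ... | no  _   = nothing

  open Algebra.Solver.Ring ℤ.+-*-rawRing (fromCommutativeRing R) ℤ⟶R coeff≟ public
    using (solve; con; _:+_; _:*_; _:-_; :-_; _:=_)

-- Ordered field: order, absolute value, suprema, null sequences.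

module OrderedField (F : CompleteOrderedField) where
  open CompleteOrderedField F
  open IntegerRingSolver commutativeRing
  open IsDecTotalOrder isDecTotalOrder public
    using (total; antisym; _≟_)
    renaming (refl to ≤-refl; trans to ≤-trans; reflexive to ≤-reflexive)
  open import Algebra.Properties.Semiring.Exp semiring public using (^-congˡ)
  open import Algebra.Properties.Semiring.Mult semiring public using (×1-homo-*)
  open import Algebra.Definitions.RawSemiring (Algebra.Bundles.Semiring.rawSemiring semiring)
      using (_^_) renaming (_×_ to _·_)

  poset : Poset 0ℓ 0ℓ 0ℓ
  poset = record { isPartialOrder = IsDecTotalOrder.isPartialOrder isDecTotalOrder }

  module ≤-Reasoning = Relation.Binary.Reasoning.PartialOrder poset

  <⇒≤ : ∀ {x y} → x < y → x ≤ y
  <⇒≤ = proj₁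

  <-≤-trans : ∀ {x y z} → x < y → y ≤ z → x < z
  <-≤-trans (x≤y , x≉y) y≤z =
    ≤-trans x≤y y≤z , λ x≈z → x≉y (antisym x≤y (≤-trans y≤z (≤-reflexive (sym x≈z))))

  ≤-<-trans : ∀ {x y z} → x ≤ y → y < z → x < z
  ≤-<-trans x≤y (y≤z , y≉z) =
    ≤-trans x≤y y≤z , λ x≈z → y≉z (antisym y≤z (≤-trans (≤-reflexive (sym x≈z)) x≤y))

  <⇒≱ : ∀ {x y} → x < y → ¬ (y ≤ x)
  <⇒≱ (x≤y , x≉y) y≤x = x≉y (antisym x≤y y≤x)

  <-irrefl : ∀ {x} → ¬ (x < x)
  <-irrefl (_ , x≉x) = x≉x refl

  ≤-or-> : ∀ x y → x ≤ y ⊎ y < x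
  ≤-or-> x y with total x y
  ... | inj₁ x≤y = inj₁ x≤y
  ... | inj₂ y≤x with y ≟ x
  ...   | yes y≈x = inj₁ (≤-reflexive (sym y≈x))
  ...   | no  y≉x = inj₂ (y≤x , y≉x)

  <-respʳ : ∀ {x y z} → y ≈ z → x < y → x < z
  <-respʳ y≈z x<y = <-≤-trans x<y (≤-reflexive y≈z)

  ≤-respʳ : ∀ {x y z} → y ≈ z → x ≤ y → x ≤ z
  ≤-respʳ y≈z x≤y = ≤-trans x≤y (≤-reflexive y≈z)

  diff-nonneg : ∀ {x y} → x ≤ y → 0# ≤ y - x
  diff-nonneg {x} {y} x≤y =
    ≤-trans (≤-reflexive (sym (-‿inverseʳ x))) (+-monoˡ-≤ (- x) x≤y)

  ≤-by : ∀ {x y d} → 0# ≤ d → y ≈ x + d → x ≤ y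
  ≤-by {x} {y} {d} 0≤d y≈x+d = begin
    x ≈⟨ +-identityˡ x ⟨
    0# + x ≤⟨ +-monoˡ-≤ x 0≤d ⟩
    d + x ≈⟨ +-comm d x ⟩
    x + d ≈⟨ y≈x+d ⟨
    y ∎
    where open ≤-Reasoning

  diff-pos : ∀ {x y} → x < y → 0# < y - x
  diff-pos {x} {y} (x≤y , x≉y) = diff-nonneg x≤y , λ 0≈y-x → x≉y (begin-equality
    x ≈⟨ +-identityʳ x ⟨
    x + 0# ≈⟨ +-congˡ 0≈y-x ⟩
    x + (y - x) ≈⟨ solve 2 (λ x y → x :+ (y :- x) := y) refl _ _ ⟩
    y ∎)
    where open ≤-Reasoning

  <-by : ∀ {x y d} → 0# < d → y ≈ x + d → x < y
  <-by {x} {y} {d} (0≤d , 0≉d) y≈x+d = ≤-by 0≤d y≈x+d , λ x≈y → 0≉d (begin-equality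
    0# ≈⟨ -‿inverseʳ x ⟨
    x - x ≈⟨ +-congʳ x≈y ⟩
    y - x ≈⟨ +-congʳ y≈x+d ⟩
    x + d - x ≈⟨ solve 2 (λ x d → x :+ d :- x := d) refl _ _ ⟩
    d ∎)
    where open ≤-Reasoning

  +-nonneg : ∀ {x y} → 0# ≤ x → 0# ≤ y → 0# ≤ x + y
  +-nonneg {x} {y} 0≤x 0≤y =
    ≤-trans 0≤x (≤-by 0≤y refl)

  +-pos-nonneg : ∀ {x y} → 0# < x → 0# ≤ y → 0# < x + y
  +-pos-nonneg 0<x 0≤y = <-≤-trans 0<x (≤-by 0≤y refl)

  +-mono-≤ : ∀ {x y u v} → x ≤ y → u ≤ v → x + u ≤ y + v
  +-mono-≤ {x} {y} {u} {v} x≤y u≤v = ≤-by (+-nonneg (diff-nonneg x≤y) (diff-nonneg u≤v))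
    (solve 4 (λ x y u v → y :+ v := x :+ u :+ ((y :- x) :+ (v :- u))) refl _ _ _ _)

  *-monoˡ-≤ : ∀ {x y z} → 0# ≤ z → x ≤ y → z * x ≤ z * y
  *-monoˡ-≤ {x} {y} {z} 0≤z x≤y = ≤-by (*-nonNeg 0≤z (diff-nonneg x≤y))
    (solve 3 (λ x y z → z :* y := z :* x :+ z :* (y :- x)) refl _ _ _)

  *-monoʳ-≤ : ∀ {x y z} → 0# ≤ z → x ≤ y → x * z ≤ y * z
  *-monoʳ-≤ 0≤z x≤y = ≤-trans (≤-reflexive (*-comm _ _)) (≤-trans (*-monoˡ-≤ 0≤z x≤y) (≤-reflexive (*-comm _ _)))

  *-mono-≤ : ∀ {x y u v} → 0# ≤ x → 0# ≤ v → x ≤ y → u ≤ v → x * u ≤ y * v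
  *-mono-≤ 0≤x 0≤v x≤y u≤v = ≤-trans (*-monoˡ-≤ 0≤x u≤v) (*-monoʳ-≤ 0≤v x≤y)

  neg-mono-≤ : ∀ {x y} → x ≤ y → - y ≤ - x
  neg-mono-≤ x≤y = ≤-by (diff-nonneg x≤y) (solve 2 (λ x y → :- x := :- y :+ (y :- x)) refl _ _)

  neg-nonneg : ∀ {x} → x ≤ 0# → 0# ≤ - x
  neg-nonneg {x} x≤0 = ≤-by (diff-nonneg x≤0) (solve 1 (λ x → :- x := con (+ 0) :+ (con (+ 0) :- x)) refl _)

  neg-pos : ∀ {x} → x < 0# → 0# < - x
  neg-pos {x} x<0 = <-by (diff-pos x<0) (solve 1 (λ x → :- x := con (+ 0) :+ (con (+ 0) :- x)) refl _)

  square-nonneg : ∀ x → 0# ≤ x * x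
  square-nonneg x with total 0# x
  ... | inj₁ 0≤x = *-nonNeg 0≤x 0≤x
  ... | inj₂ x≤0 = ≤-respʳ (solve 1 (λ x → :- x :* :- x := x :* x) refl _)
                     (*-nonNeg (neg-nonneg x≤0) (neg-nonneg x≤0))

  0<1 : 0# < 1#
  0<1 = ≤-respʳ (*-identityʳ 1#) (square-nonneg 1#) , 0≉1

  0≤1 : 0# ≤ 1#
  0≤1 = proj₁ 0<1

  *-cancel-0 : ∀ {x y} → ¬ (x ≈ 0#) → x * y ≈ 0# → y ≈ 0#
  *-cancel-0 {x} {y} x≉0 xy≈0 = begin-equality
    y ≈⟨ *-identityˡ y ⟨
    1# * y ≈⟨ *-congʳ (⁻¹-inverseʳ x≉0) ⟨
    x * x ⁻¹ * y ≈⟨ solve 3 (λ x i y → x :* i :* y := i :* (x :* y)) refl _ _ _ ⟩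
    x ⁻¹ * (x * y) ≈⟨ *-congˡ xy≈0 ⟩
    x ⁻¹ * 0# ≈⟨ zeroʳ _ ⟩
    0# ∎
    where open ≤-Reasoning

  *-cancelˡ : ∀ {x y z} → ¬ (x ≈ 0#) → x * y ≈ x * z → y ≈ z
  *-cancelˡ {x} {y} {z} x≉0 xy≈xz = begin-equality
    y ≈⟨ solve 2 (λ y z → y := z :+ (y :- z)) refl _ _ ⟩
    z + (y - z) ≈⟨ +-congˡ (*-cancel-0 x≉0 (begin-equality
      x * (y - z) ≈⟨ solve 3 (λ x y z → x :* (y :- z) := x :* y :- x :* z) refl _ _ _ ⟩
      x * y - x * z ≈⟨ +-congʳ xy≈xz ⟩
      x * z - x * z ≈⟨ -‿inverseʳ _ ⟩
      0# ∎)) ⟩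
    z + 0# ≈⟨ +-identityʳ z ⟩
    z ∎
    where open ≤-Reasoning

  *-pos : ∀ {x y} → 0# < x → 0# < y → 0# < x * y
  *-pos (0≤x , 0≉x) (0≤y , 0≉y) =
    *-nonNeg 0≤x 0≤y , λ 0≈xy → 0≉y (sym (*-cancel-0 (λ x≈0 → 0≉x (sym x≈0)) (sym 0≈xy)))

  pos⇒≉0 : ∀ {x} → 0# < x → ¬ (x ≈ 0#)
  pos⇒≉0 (_ , 0≉x) x≈0 = 0≉x (sym x≈0)

  ⁻¹-inverse : ∀ {x} → 0# < x → x * x ⁻¹ ≈ 1#
  ⁻¹-inverse 0<x = ⁻¹-inverseʳ (pos⇒≉0 0<x)

  *-cancel-nonneg : ∀ {x y} → 0# < x → 0# ≤ x * y → 0# ≤ y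
  *-cancel-nonneg {x} {y} 0<x 0≤xy with ≤-or-> 0# y
  ... | inj₁ 0≤y = 0≤y
  ... | inj₂ y<0 = contradiction 0≤xy (<⇒≱ (<-by (*-pos 0<x (neg-pos y<0))
          (solve 2 (λ x y → con (+ 0) := x :* y :+ x :* (:- y)) refl _ _)))

  *-cancel-pos : ∀ {x y} → 0# < x → 0# < x * y → 0# < y
  *-cancel-pos {x} {y} 0<x 0<xy = *-cancel-nonneg 0<x (<⇒≤ 0<xy) ,
    λ 0≈y → proj₂ 0<xy (trans (sym (zeroʳ x)) (*-congˡ 0≈y))

  ⁻¹-pos : ∀ {x} → 0# < x → 0# < x ⁻¹
  ⁻¹-pos 0<x = *-cancel-pos 0<x (<-respʳ (sym (⁻¹-inverse 0<x)) 0<1)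

  *-cancel-≤ : ∀ {x y z} → 0# < z → z * x ≤ z * y → x ≤ y
  *-cancel-≤ {x} {y} {z} 0<z zx≤zy =
    ≤-by (*-cancel-nonneg 0<z (≤-respʳ (solve 3 (λ x y z → z :* y :- z :* x := z :* (y :- x)) refl _ _ _) (diff-nonneg zx≤zy)))
      (solve 2 (λ x y → y := x :+ (y :- x)) refl _ _)

  2# : Carrier
  2# = 1# + 1#

  0<2 : 0# < 2#
  0<2 = +-pos-nonneg 0<1 0≤1

  ½ : Carrier
  ½ = 2# ⁻¹

  0<½ : 0# < ½
  0<½ = ⁻¹-pos 0<2

  ½+½ : ∀ x → ½ * x + ½ * x ≈ x
  ½+½ x = trans (solve 2 (λ h x → h :* x :+ h :* x := (con (+ 2) :* h) :* x) refl _ _)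
            (trans (*-congʳ (⁻¹-inverse 0<2)) (*-identityˡ x))

  ∣_∣ : Carrier → Carrier
  ∣ x ∣ with total 0# x
  ... | inj₁ _ = x
  ... | inj₂ _ = - x

  x≤∣x∣ : ∀ x → x ≤ ∣ x ∣
  x≤∣x∣ x with total 0# x
  ... | inj₁ _   = ≤-refl
  ... | inj₂ x≤0 = ≤-trans x≤0 (neg-nonneg x≤0)

  -x≤∣x∣ : ∀ x → - x ≤ ∣ x ∣
  -x≤∣x∣ x with total 0# x
  ... | inj₁ 0≤x = ≤-by (+-nonneg 0≤x 0≤x) (solve 1 (λ x → x := :- x :+ (x :+ x)) refl _)
  ... | inj₂ x≤0 = ≤-refl

  ∣∣-least : ∀ {x b} → x ≤ b → - x ≤ b → ∣ x ∣ ≤ b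
  ∣∣-least {x} x≤b -x≤b with total 0# x
  ... | inj₁ _ = x≤b
  ... | inj₂ _ = -x≤b

  0≤∣x∣ : ∀ x → 0# ≤ ∣ x ∣
  0≤∣x∣ x with total 0# x
  ... | inj₁ 0≤x = 0≤x
  ... | inj₂ x≤0 = neg-nonneg x≤0

  ∣∣-cong : ∀ {x y} → x ≈ y → ∣ x ∣ ≈ ∣ y ∣
  ∣∣-cong {x} {y} x≈y = antisym (mono x≈y) (mono (sym x≈y))
    where
    mono : ∀ {x y} → x ≈ y → ∣ x ∣ ≤ ∣ y ∣
    mono x≈y = ∣∣-least (≤-trans (≤-reflexive x≈y) (x≤∣x∣ _))
                        (≤-trans (≤-reflexive (-‿cong x≈y)) (-x≤∣x∣ _))

  ∣0∣ : ∣ 0# ∣ ≈ 0#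
  ∣0∣ = antisym (∣∣-least ≤-refl (≤-reflexive (solve 0 (:- con (+ 0) := con (+ 0)) refl))) (0≤∣x∣ 0#)

  ∣-x∣ : ∀ x → ∣ - x ∣ ≈ ∣ x ∣
  ∣-x∣ x = antisym (∣∣-least (-x≤∣x∣ x) (≤-trans (≤-reflexive neg-neg) (x≤∣x∣ x)))
                   (∣∣-least (≤-trans (≤-reflexive (sym neg-neg)) (-x≤∣x∣ (- x))) (x≤∣x∣ (- x)))
    where
    neg-neg : - - x ≈ x
    neg-neg = solve 1 (λ x → :- (:- x) := x) refl _

  nonneg⇒∣x∣≈x : ∀ {x} → 0# ≤ x → ∣ x ∣ ≈ x
  nonneg⇒∣x∣≈x {x} 0≤x = antisym
    (∣∣-least ≤-refl (≤-by (+-nonneg 0≤x 0≤x) (solve 1 (λ x → x := :- x :+ (x :+ x)) refl _)))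
    (x≤∣x∣ x)

  ∣x+y∣≤∣x∣+∣y∣ : ∀ x y → ∣ x + y ∣ ≤ ∣ x ∣ + ∣ y ∣
  ∣x+y∣≤∣x∣+∣y∣ x y = ∣∣-least (+-mono-≤ (x≤∣x∣ x) (x≤∣x∣ y))
    (≤-trans (≤-reflexive (solve 2 (λ x y → :- (x :+ y) := :- x :+ :- y) refl _ _))
      (+-mono-≤ (-x≤∣x∣ x) (-x≤∣x∣ y)))

  ∣∣-cases : ∀ x → ∣ x ∣ ≈ x ⊎ ∣ x ∣ ≈ - x
  ∣∣-cases x with total 0# x
  ... | inj₁ _ = inj₁ refl
  ... | inj₂ _ = inj₂ refl

  ∣xy∣≈∣x∣∣y∣ : ∀ x y → ∣ x * y ∣ ≈ ∣ x ∣ * ∣ y ∣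
  ∣xy∣≈∣x∣∣y∣ x y = trans (from-cases (∣∣-cases x) (∣∣-cases y)) (nonneg⇒∣x∣≈x (*-nonNeg (0≤∣x∣ x) (0≤∣x∣ y)))
    where
    from-cases : ∣ x ∣ ≈ x ⊎ ∣ x ∣ ≈ - x → ∣ y ∣ ≈ y ⊎ ∣ y ∣ ≈ - y → ∣ x * y ∣ ≈ ∣ ∣ x ∣ * ∣ y ∣ ∣
    from-cases (inj₁ p) (inj₁ q) = ∣∣-cong (sym (*-cong p q))
    from-cases (inj₁ p) (inj₂ q) = trans (sym (∣-x∣ _)) (∣∣-cong (trans
      (solve 2 (λ x y → :- (x :* y) := x :* :- y) refl _ _) (sym (*-cong p q))))
    from-cases (inj₂ p) (inj₁ q) = trans (sym (∣-x∣ _)) (∣∣-cong (trans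
      (solve 2 (λ x y → :- (x :* y) := :- x :* y) refl _ _) (sym (*-cong p q))))
    from-cases (inj₂ p) (inj₂ q) = ∣∣-cong (trans
      (solve 2 (λ x y → x :* y := :- x :* :- y) refl _ _) (sym (*-cong p q)))

  ∣x∣²≈x² : ∀ x → ∣ x ∣ * ∣ x ∣ ≈ x * x
  ∣x∣²≈x² x = trans (sym (∣xy∣≈∣x∣∣y∣ x x)) (nonneg⇒∣x∣≈x (square-nonneg x))

  square-<⇒< : ∀ {x y} → 0# ≤ y → x * x < y * y → x < y
  square-<⇒< {x} {y} 0≤y xx<yy with ≤-or-> y x
  ... | inj₁ y≤x = contradiction (*-mono-≤ 0≤y (≤-trans 0≤y y≤x) y≤x y≤x) (<⇒≱ xx<yy)
  ... | inj₂ x<y = x<y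

  fromℕ : ℕ → Carrier
  fromℕ k = k · 1#

  fromℕ-nonneg : ∀ k → 0# ≤ fromℕ k
  fromℕ-nonneg zero    = ≤-refl
  fromℕ-nonneg (suc k) = +-nonneg 0≤1 (fromℕ-nonneg k)

  fromℕ-suc-pos : ∀ k → 0# < fromℕ (suc k)
  fromℕ-suc-pos k = +-pos-nonneg 0<1 (fromℕ-nonneg k)

  -- Let s be the supremum of the naturals that are at most x; some such k exceeds s - 1, so k + 1 is not among them.
  archimedean : ∀ x → 0# ≤ x → ∃[ k ] x < fromℕ k
  archimedean x 0≤x with complete (λ y → ∃[ k ] (y ≈ fromℕ k × y ≤ x)) (0# , 0 , refl , 0≤x)
                               (x , λ (_ , _ , y≤x) → y≤x)
  ... | s , upper , approx with approx {s - 1#} (<-by 0<1 (solve 1 (λ s → s := s :- con (+ 1) :+ con (+ 1)) refl _))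
  ...   | y , (k , y≈k , _) , s-1<y with ≤-or-> (fromℕ (suc k)) x
  ...     | inj₂ x<k+1 = suc k , x<k+1
  ...     | inj₁ k+1≤x = contradiction (upper (suc k , refl , k+1≤x)) (<⇒≱ (<-by (diff-pos s-1<y) (begin-equality
    1# + fromℕ k ≈⟨ +-congˡ y≈k ⟨
    1# + y ≈⟨ solve 2 (λ s y → con (+ 1) :+ y := s :+ (y :- (s :- con (+ 1)))) refl _ _ ⟩
    s + (y - (s - 1#)) ∎)))
    where open ≤-Reasoning

  module _ (a b : ℕ → Carrier) (a≤b : ∀ i j → a i ≤ b j) where
    -- The supremum of the left endpoints works: if it exceeded some `b i`, a left endpoint would
    -- exceed `b i` as well.
    interval-intersection : ∃[ s ] (∀ i → a i ≤ s × s ≤ b i)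
    interval-intersection with complete (λ y → ∃[ i ] y ≈ a i) (a 0 , 0 , refl)
                                 (b 0 , λ (i , y≈a) → ≤-trans (≤-reflexive y≈a) (a≤b i 0))
    ... | s , upper , approx = s , λ i → upper (i , refl) , s≤b i
      where
      s≤b : ∀ i → s ≤ b i
      s≤b i with ≤-or-> s (b i)
      ... | inj₁ s≤b = s≤b
      ... | inj₂ b<s with approx b<s
      ...   | y , (j , y≈a) , b<y = contradiction (≤-trans (≤-reflexive y≈a) (a≤b j i)) (<⇒≱ b<y)

  -- Monotonicity compares `a i` with `b j` through the common index `i + j`.
  nested-intervals : (a b : ℕ → Carrier) → (∀ i → a i ≤ a (suc i)) → (∀ i → b (suc i) ≤ b i) →
                     (∀ i → a i ≤ b i) → ∃[ s ] (∀ i → a i ≤ s × s ≤ b i)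
  nested-intervals a b a↑ b↓ a≤b = interval-intersection a b λ i j →
    ≤-trans (a-mono (ℕ.m≤m+n i j)) (≤-trans (a≤b (i ℕ.+ j)) (b-anti (ℕ.m≤n+m j i)))
    where
    a-mono′ : ∀ i k → a i ≤ a (k ℕ.+ i)
    a-mono′ i zero    = ≤-refl
    a-mono′ i (suc k) = ≤-trans (a-mono′ i k) (a↑ _)

    a-mono : ∀ {i j} → i ℕ.≤ j → a i ≤ a j
    a-mono {i} {j} i≤j with a-mono′ i (j ℕ.∸ i)
    ... | p rewrite ℕ.m∸n+n≡m i≤j = p

    b-anti′ : ∀ i k → b (k ℕ.+ i) ≤ b i
    b-anti′ i zero    = ≤-refl
    b-anti′ i (suc k) = ≤-trans (b↓ _) (b-anti′ i k)

    b-anti : ∀ {i j} → i ℕ.≤ j → b j ≤ b i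
    b-anti {i} {j} i≤j with b-anti′ i (j ℕ.∸ i)
    ... | p rewrite ℕ.m∸n+n≡m i≤j = p

  -- One-sided: only upper bounds are demanded, since the notion is applied to error bounds. This is
  -- why a constant null sequence is merely shown to be at most 0.
  Null : (ℕ → Carrier) → Set
  Null b = ∀ ε → 0# < ε → ∃[ N ] (∀ m → N ℕ.≤ m → b m < ε)

  Null-≤ : ∀ {a b} M → (∀ m → M ℕ.≤ m → a m ≤ b m) → Null b → Null a
  Null-≤ M a≤b b→0 ε 0<ε with b→0 ε 0<ε
  ... | N , b<ε = M ℕ.+ N , λ m M+N≤m →
    ≤-<-trans (a≤b m (ℕ.m+n≤o⇒m≤o M M+N≤m)) (b<ε m (ℕ.m+n≤o⇒n≤o M M+N≤m))

  Null-+ : ∀ {a b} → Null a → Null b → Null (λ m → a m + b m)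
  Null-+ {a} {b} a→0 b→0 ε 0<ε with a→0 (½ * ε) (*-pos 0<½ 0<ε) | b→0 (½ * ε) (*-pos 0<½ 0<ε)
  ... | M , a<ε | N , b<ε = M ℕ.+ N , λ m M+N≤m →
    let a<ε/2 = a<ε m (ℕ.m+n≤o⇒m≤o M M+N≤m)
        b<ε/2 = b<ε m (ℕ.m+n≤o⇒n≤o M M+N≤m)
    in <-by (+-pos-nonneg (diff-pos a<ε/2) (<⇒≤ (diff-pos b<ε/2)))
            (trans (sym (½+½ ε)) (solve 3 (λ h a b → h :+ h := a :+ b :+ ((h :- a) :+ (h :- b))) refl _ _ _))

  -- The tolerance is divided by `1 + c`, because `c` itself may be 0.
  Null-*ˡ : ∀ {a} c → 0# ≤ c → Null a → Null (λ m → c * a m)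
  Null-*ˡ {a} c 0≤c a→0 ε 0<ε with a→0 (ε * (1# + c) ⁻¹) (*-pos 0<ε (⁻¹-pos 0<1+c))
    where 0<1+c = +-pos-nonneg 0<1 0≤c
  ... | N , a<ε = N , λ m N≤m → bound (a<ε m N≤m)
    where
    0<1+c : 0# < 1# + c
    0<1+c = +-pos-nonneg 0<1 0≤c

    [1+c]r≈ε : (1# + c) * (ε * (1# + c) ⁻¹) ≈ ε
    [1+c]r≈ε = trans (solve 3 (λ d e i → d :* (e :* i) := (d :* i) :* e) refl _ _ _)
                 (trans (*-congʳ (⁻¹-inverse 0<1+c)) (*-identityˡ ε))

    bound : ∀ {x} → x < ε * (1# + c) ⁻¹ → c * x < ε
    bound {x} x<r = ≤-<-trans (*-monoˡ-≤ 0≤c (<⇒≤ x<r))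
      (<-by (*-pos 0<ε (⁻¹-pos 0<1+c))
        (trans (sym [1+c]r≈ε) (solve 2 (λ c r → (con (+ 1) :+ c) :* r := c :* r :+ r) refl _ _)))

  Null-shift : ∀ {a} k → Null (λ m → a (m ℕ.+ k)) → Null a
  Null-shift {a} k a→0 ε 0<ε with a→0 ε 0<ε
  ... | N , a<ε = N ℕ.+ k , λ m N+k≤m →
    ≡.subst (λ i → a i < ε) (ℕ.m∸n+n≡m (ℕ.m+n≤o⇒n≤o N N+k≤m))
      (a<ε (m ℕ.∸ k) (ℕ.m+n≤o⇒m≤o∸n N N+k≤m))

  Null-const : ∀ {x} → Null (λ _ → x) → x ≤ 0#
  Null-const {x} x→0 with ≤-or-> x 0#
  ... | inj₁ x≤0 = x≤0
  ... | inj₂ 0<x with x→0 x 0<x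
  ...   | N , x<x = contradiction (x<x N ℕ.≤-refl) <-irrefl

  ≤-limit : ∀ {x y b} M → Null b → (∀ m → M ℕ.≤ m → x ≤ y + b m) → x ≤ y
  ≤-limit {x} {y} {b} M b→0 x≤y+b =
    ≤-by (neg-nonneg (Null-const (Null-≤ M (λ m M≤m → ≤-by (diff-nonneg (x≤y+b m M≤m))
        (solve 3 (λ x y b → b := x :- y :+ (y :+ b :- x)) refl _ _ _)) b→0)))
      (solve 2 (λ x y → y := x :+ :- (x :- y)) refl _ _)

  ^-nonneg : ∀ {x} k → 0# ≤ x → 0# ≤ x ^ k
  ^-nonneg zero    0≤x = 0≤1
  ^-nonneg (suc k) 0≤x = *-nonNeg 0≤x (^-nonneg k 0≤x)

  ^-pos : ∀ {x} k → 0# < x → 0# < x ^ k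
  ^-pos zero    0<x = 0<1
  ^-pos (suc k) 0<x = *-pos 0<x (^-pos k 0<x)

  bernoulli : ∀ {x} → 0# ≤ x → ∀ k → 1# + fromℕ k * x ≤ (1# + x) ^ k
  bernoulli {x} 0≤x zero    = ≤-reflexive (solve 1 (λ x → con (+ 1) :+ con (+ 0) :* x := con (+ 1)) refl _)
  bernoulli {x} 0≤x (suc k) = ≤-trans
    (≤-by (*-nonNeg (fromℕ-nonneg k) (*-nonNeg 0≤x 0≤x))
      (solve 2 (λ x k → (con (+ 1) :+ x) :* (con (+ 1) :+ k :* x)
                        := con (+ 1) :+ (con (+ 1) :+ k) :* x :+ k :* (x :* x)) refl _ _))
    (*-monoˡ-≤ (+-nonneg 0≤1 0≤x) (bernoulli 0≤x k))

  ^-inverse : ∀ {x y} → x * y ≈ 1# → ∀ k → x ^ k * y ^ k ≈ 1#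
  ^-inverse xy≈1 zero = *-identityˡ 1#
  ^-inverse {x} {y} xy≈1 (suc k) = trans
    (solve 4 (λ x y u v → x :* u :* (y :* v) := (x :* y) :* (u :* v)) refl _ _ _ _)
    (trans (*-cong xy≈1 (^-inverse xy≈1 k)) (*-identityˡ 1#))

  1≤^ : ∀ {x} → 1# ≤ x → ∀ k → 1# ≤ x ^ k
  1≤^ 1≤x zero    = ≤-refl
  1≤^ 1≤x (suc k) = ≤-trans (≤-reflexive (sym (*-identityˡ 1#)))
    (*-mono-≤ 0≤1 (≤-trans 0≤1 (1≤^ 1≤x k)) 1≤x (1≤^ 1≤x k))

  1<^suc : ∀ {x} → 1# < x → ∀ k → 1# < x ^ suc k
  1<^suc {x} 1<x k = <-≤-trans 1<x (≤-trans (≤-reflexive (sym (*-identityʳ x)))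
    (*-monoˡ-≤ (≤-trans 0≤1 (<⇒≤ 1<x)) (1≤^ (<⇒≤ 1<x) k)))

  fromℕ-mono : ∀ {i j} → i ℕ.≤ j → fromℕ i ≤ fromℕ j
  fromℕ-mono {j = j} ℕ.z≤n = fromℕ-nonneg j
  fromℕ-mono (ℕ.s≤s i≤j) = +-mono-≤ ≤-refl (fromℕ-mono i≤j)

  -- Here y = 1/(1 + d), and Bernoulli gives (1 + m d) ε ≤ (1 + d)^m y^m = 1. By the Archimedean
  -- property `y ^ m` therefore drops below ε.
  ε≤y^m⇒mdε≤1 : ∀ {d ε y} m → 0# < d → 0# < ε → (1# + d) * y ≈ 1# → ε ≤ y ^ m → d * ε * fromℕ m ≤ 1#
  ε≤y^m⇒mdε≤1 {d} {ε} {y} m 0<d 0<ε xy≈1 ε≤y^m = begin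
      d * ε * fromℕ m ≤⟨ ≤-by (<⇒≤ 0<ε) (solve 3 (λ d e k → (con (+ 1) :+ k :* d) :* e := d :* e :* k :+ e) refl d ε (fromℕ m)) ⟩
      (1# + fromℕ m * d) * ε ≤⟨ *-monoʳ-≤ (<⇒≤ 0<ε) (bernoulli (<⇒≤ 0<d) m) ⟩
      (1# + d) ^ m * ε ≤⟨ *-monoˡ-≤ (^-nonneg m (+-nonneg 0≤1 (<⇒≤ 0<d))) ε≤y^m ⟩
      (1# + d) ^ m * y ^ m ≈⟨ ^-inverse xy≈1 m ⟩
      1# ∎
    where open ≤-Reasoning

  ⁻¹<⇒1<* : ∀ {x k} → 0# < x → x ⁻¹ < k → 1# < x * k
  ⁻¹<⇒1<* {x} {k} 0<x r<k = <-by (*-pos 0<x (diff-pos r<k))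
      (trans (solve 3 (λ e n i → e :* n := e :* i :+ e :* (n :- i)) refl x k (x ⁻¹))
             (+-congʳ (⁻¹-inverse 0<x)))

  Null-geometric : ∀ {d y} → 0# < d → (1# + d) * y ≈ 1# → Null (λ m → y ^ m)
  Null-geometric {d} {y} 0<d xy≈1 ε 0<ε =
    let N , r<N = archimedean ((d * ε) ⁻¹) (<⇒≤ (⁻¹-pos (*-pos 0<d 0<ε))) in
    N , λ m N≤m → [ (λ ε≤y^m → contradiction (ε≤y^m⇒mdε≤1 m 0<d 0<ε xy≈1 ε≤y^m)
                      (<⇒≱ (⁻¹<⇒1<* {d * ε} {fromℕ m} (*-pos 0<d 0<ε) (<-≤-trans r<N (fromℕ-mono N≤m)))))
                  , (λ y^m<ε → y^m<ε) ]′ (≤-or-> ε (y ^ m))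

-- Partial sums and Cauchy products in a commutative ring.

module SequenceSums (R : CommutativeRing 0ℓ 0ℓ) where
  open CommutativeRing R
  open IntegerRingSolver R
  open import Algebra.Definitions.RawSemiring (Algebra.Bundles.Semiring.rawSemiring semiring)
    using (sum) renaming (_×_ to _·_)
  open import Algebra.Properties.CommutativeMonoid.Mult +-commutativeMonoid using (×-distrib-+)
  open import Algebra.Properties.Semiring.Mult semiring using (×-comm-*)
  open Relation.Binary.Reasoning.Setoid setoid

  ∑ : (ℕ → Carrier) → ℕ → Carrier
  ∑ a m = sum {m} (λ j → a (toℕ j))

  ∑-cong : ∀ {a b} m → (∀ k → k ℕ.< m → a k ≈ b k) → ∑ a m ≈ ∑ b m
  ∑-cong zero    a≈b = refl
  ∑-cong (suc m) a≈b = +-cong (a≈b 0 z<s) (∑-cong m (λ k k<m → a≈b (suc k) (s<s k<m)))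

  ∑-last : ∀ a m → ∑ a (suc m) ≈ ∑ a m + a m
  ∑-last a zero    = +-comm _ _
  ∑-last a (suc m) = trans (+-congˡ (∑-last (a ∘ suc) m)) (sym (+-assoc _ _ _))

  ∑-+ : ∀ a b m → ∑ (λ k → a k + b k) m ≈ ∑ a m + ∑ b m
  ∑-+ a b zero    = sym (+-identityˡ 0#)
  ∑-+ a b (suc m) = trans (+-congˡ (∑-+ (a ∘ suc) (b ∘ suc) m))
    (solve 4 (λ x y u v → x :+ y :+ (u :+ v) := x :+ u :+ (y :+ v)) refl _ _ _ _)

  ∑-*ˡ : ∀ c a m → ∑ (λ k → c * a k) m ≈ c * ∑ a m
  ∑-*ˡ c a zero    = sym (zeroʳ c)
  ∑-*ˡ c a (suc m) = trans (+-congˡ (∑-*ˡ c (a ∘ suc) m)) (sym (distribˡ c _ _))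

  ∑-split : ∀ a k m → ∑ a (k ℕ.+ m) ≈ ∑ a k + ∑ (λ i → a (k ℕ.+ i)) m
  ∑-split a zero    m = sym (+-identityˡ _)
  ∑-split a (suc k) m = trans (+-congˡ (∑-split (a ∘ suc) k m)) (sym (+-assoc _ _ _))

  infixl 7 _⋆_
  -- The Cauchy product, by recursion on the first factor: the series of `a` is `a 0` plus t times
  -- the series of its shift. No index has to be subtracted.
  _⋆_ : (ℕ → Carrier) → (ℕ → Carrier) → ℕ → Carrier
  (a ⋆ b) zero    = a 0 * b 0
  (a ⋆ b) (suc k) = a 0 * b (suc k) + ((a ∘ suc) ⋆ b) k

  ⋆-cong : ∀ {a a′ b b′} → (∀ k → a k ≈ a′ k) → (∀ k → b k ≈ b′ k) → ∀ k → (a ⋆ b) k ≈ (a′ ⋆ b′) k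
  ⋆-cong a≈ b≈ zero    = *-cong (a≈ 0) (b≈ 0)
  ⋆-cong a≈ b≈ (suc k) = +-cong (*-cong (a≈ 0) (b≈ (suc k))) (⋆-cong (a≈ ∘ suc) b≈ k)

  ⋆-+ˡ : ∀ a a′ b k → ((λ i → a i + a′ i) ⋆ b) k ≈ (a ⋆ b) k + (a′ ⋆ b) k
  ⋆-+ˡ a a′ b zero    = distribʳ _ _ _
  ⋆-+ˡ a a′ b (suc k) = trans (+-congˡ (⋆-+ˡ (a ∘ suc) (a′ ∘ suc) b k))
    (solve 5 (λ x y z u v → (x :+ y) :* z :+ (u :+ v) := x :* z :+ u :+ (y :* z :+ v)) refl _ _ _ _ _)

  ⋆-*ˡ : ∀ c a b k → ((λ i → c * a i) ⋆ b) k ≈ c * (a ⋆ b) k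
  ⋆-*ˡ c a b zero    = *-assoc _ _ _
  ⋆-*ˡ c a b (suc k) = trans (+-congˡ (⋆-*ˡ c (a ∘ suc) b k))
    (solve 4 (λ c x y z → c :* x :* y :+ c :* z := c :* (x :* y :+ z)) refl _ _ _ _)

  ⋆-*ʳ : ∀ c a b k → (a ⋆ (λ i → c * b i)) k ≈ c * (a ⋆ b) k
  ⋆-*ʳ c a b zero    = solve 3 (λ c x y → x :* (c :* y) := c :* (x :* y)) refl _ _ _
  ⋆-*ʳ c a b (suc k) = trans (+-congˡ (⋆-*ʳ c (a ∘ suc) b k))
    (solve 4 (λ c x y z → x :* (c :* y) :+ c :* z := c :* (x :* y :+ z)) refl _ _ _ _)

  -- The triangle of index pairs splits into its first row and a smaller triangle.
  ∑-⋆ : ∀ a b m → ∑ (a ⋆ b) (suc m) ≈ a 0 * ∑ b (suc m) + ∑ ((a ∘ suc) ⋆ b) m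
  ∑-⋆ a b m = begin
    a 0 * b 0 + ∑ (λ k → a 0 * b (suc k) + ((a ∘ suc) ⋆ b) k) m
      ≈⟨ +-congˡ (∑-+ (λ k → a 0 * b (suc k)) ((a ∘ suc) ⋆ b) m) ⟩
    a 0 * b 0 + (∑ (λ k → a 0 * b (suc k)) m + ∑ ((a ∘ suc) ⋆ b) m)
      ≈⟨ +-congˡ (+-congʳ (∑-*ˡ (a 0) (b ∘ suc) m)) ⟩
    a 0 * b 0 + (a 0 * ∑ (b ∘ suc) m + ∑ ((a ∘ suc) ⋆ b) m)
      ≈⟨ solve 4 (λ x y z w → x :* y :+ (x :* z :+ w) := x :* (y :+ z) :+ w) refl _ _ _ _ ⟩
    a 0 * ∑ b (suc m) + ∑ ((a ∘ suc) ⋆ b) m ∎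

  -- Coefficients of the derivative of the power series with coefficients a.
  δ : (ℕ → Carrier) → ℕ → Carrier
  δ a k = suc k · a (suc k)

  -- The product rule for formal power series. It shows that the Cauchy product of the series of
  -- e^{tz} and e^{tw} solves f′ = (z + w) f.
  leibniz : ∀ a b k → δ (a ⋆ b) k ≈ (δ a ⋆ b) k + (a ⋆ δ b) k
  leibniz a b zero = solve 4 (λ x y u v → x :* y :+ u :* v :+ con ℤ.0ℤ := (u :+ con ℤ.0ℤ) :* v :+ x :* (y :+ con ℤ.0ℤ)) refl _ _ _ _
    where import Data.Integer.Base as ℤ
  leibniz a b (suc k) = begin
    suc (suc k) · (a 0 * b (suc (suc k)) + (a′ ⋆ b) (suc k))
      ≈⟨ ×-distrib-+ (a 0 * b (suc (suc k))) ((a′ ⋆ b) (suc k)) (suc (suc k)) ⟩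
    suc (suc k) · (a 0 * b (suc (suc k))) + ((a′ ⋆ b) (suc k) + δ (a′ ⋆ b) k)
      ≈⟨ +-cong (sym (×-comm-* (suc (suc k)) (a 0) (b (suc (suc k))))) (+-congˡ (leibniz a′ b k)) ⟩
    a 0 * δ b (suc k) + (a′ 0 * b (suc k) + (a″ ⋆ b) k + ((δ a′ ⋆ b) k + (a′ ⋆ δ b) k))
      ≈⟨ solve 6 (λ p u v q r s → p :+ (u :* v :+ q :+ (r :+ s)) := (u :+ con ℤ.0ℤ) :* v :+ (q :+ r) :+ (p :+ s)) refl _ _ _ _ _ _ ⟩
    δ a 0 * b (suc k) + ((a″ ⋆ b) k + (δ a′ ⋆ b) k) + (a ⋆ δ b) (suc k)
      ≈⟨ +-congʳ (+-congˡ (⋆-+ˡ a″ (δ a′) b k)) ⟨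
    (δ a ⋆ b) (suc k) + (a ⋆ δ b) (suc k) ∎
    where
    import Data.Integer.Base as ℤ
    a′ a″ : ℕ → Carrier
    a′ = a ∘ suc
    a″ = a′ ∘ suc

  -- The coefficient sequence of t ↦ e^{tz} is characterised by f(0) = 1 and f′ = z f.
  IsExpSeq : Carrier → (ℕ → Carrier) → Set
  IsExpSeq z a = a 0 ≈ 1# × (∀ k → δ a k ≈ z * a k)

  ⋆-isExpSeq : ∀ {z w a b} → IsExpSeq z a → IsExpSeq w b → IsExpSeq (z + w) (a ⋆ b)
  ⋆-isExpSeq {z} {w} {a} {b} (a₀≈1 , δa≈za) (b₀≈1 , δb≈wb) =
    trans (*-cong a₀≈1 b₀≈1) (*-identityˡ 1#) , λ k → begin
      δ (a ⋆ b) k ≈⟨ leibniz a b k ⟩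
      (δ a ⋆ b) k + (a ⋆ δ b) k ≈⟨ +-cong (⋆-cong δa≈za (λ _ → refl) k) (⋆-cong (λ _ → refl) δb≈wb k) ⟩
      ((λ i → z * a i) ⋆ b) k + (a ⋆ (λ i → w * b i)) k ≈⟨ +-cong (⋆-*ˡ z a b k) (⋆-*ʳ w a b k) ⟩
      z * (a ⋆ b) k + w * (a ⋆ b) k ≈⟨ distribʳ _ _ _ ⟨
      (z + w) * (a ⋆ b) k ∎

  -- The equation f′ = z f reads (k + 1) a (k + 1) = z a k, which determines the coefficients one
  -- after another as soon as the factor k + 1 can be cancelled.
  isExpSeq-unique : (∀ k {x y} → suc k · x ≈ suc k · y → x ≈ y) →
                    ∀ {z w a b} → z ≈ w → IsExpSeq z a → IsExpSeq w b → ∀ k → a k ≈ b k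
  isExpSeq-unique cancel z≈w (a₀≈1 , _) (b₀≈1 , _) zero = trans a₀≈1 (sym b₀≈1)
  isExpSeq-unique cancel z≈w A@(_ , δa≈za) B@(_ , δb≈wb) (suc k) = cancel k
    (trans (δa≈za k) (trans (*-cong z≈w (isExpSeq-unique cancel z≈w A B k)) (sym (δb≈wb k))))

-- ℂ as a commutative ring, the 1-norm, and limits.

module ComplexNumbers (ℝ : CompleteOrderedField) where
  open Analysis ℝ public
  open CompleteOrderedField ℝ public
    using ( Carrier; 0#; 1#; _≤_; _<_; refl; sym; trans; *-nonNeg
          ; +-cong; +-congˡ; +-congʳ; *-cong; *-congˡ; *-congʳ; -‿cong
          ; +-assoc; +-comm; *-assoc; *-comm; distribˡ; distribʳ; zeroˡ; zeroʳ
          ; +-identityˡ; +-identityʳ; *-identityˡ; *-identityʳ )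
  open OrderedField ℝ public hiding (fromℕ)
  module ℝ-Solver = IntegerRingSolver ℝ.commutativeRing

  ℂ-commutativeRing : CommutativeRing 0ℓ 0ℓ
  ℂ-commutativeRing = record
    { Carrier = ℂ ; _≈_ = _≈_ ; _+_ = _+_ ; _*_ = _*_ ; -_ = -_ ; 0# = 0ℂ ; 1# = 1ℂ
    ; isCommutativeRing = record
      { isRing = record
        { +-isAbelianGroup = record
          { isGroup = record
            { isMonoid = record
              { isSemigroup = record
                { isMagma = record
                  { isEquivalence = record
                    { refl = refl , refl
                    ; sym = λ (p , q) → sym p , sym q
                    ; trans = λ (p , q) (r , s) → trans p r , trans q s }
                  ; ∙-cong = λ (p , q) (r , s) → +-cong p r , +-cong q s }
                ; assoc = λ _ _ _ → +-assoc _ _ _ , +-assoc _ _ _ }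
              ; identity = (λ _ → +-identityˡ _ , +-identityˡ _)
                         , (λ _ → +-identityʳ _ , +-identityʳ _) }
            ; inverse = (λ _ → ℝ.-‿inverseˡ _ , ℝ.-‿inverseˡ _)
                      , (λ _ → ℝ.-‿inverseʳ _ , ℝ.-‿inverseʳ _)
            ; ⁻¹-cong = λ (p , q) → -‿cong p , -‿cong q }
          ; comm = λ _ _ → +-comm _ _ , +-comm _ _ }
        ; *-cong = λ (p , q) (r , s) →
            +-cong (*-cong p r) (-‿cong (*-cong q s)) ,
            +-cong (*-cong p s) (*-cong q r)
        ; *-assoc = λ x y z →
            solve 6 (λ a b c d e f → (a :* c :- b :* d) :* e :- (a :* d :+ b :* c) :* f
                                  := a :* (c :* e :- d :* f) :- b :* (c :* f :+ d :* e)) refl (re x) (im x) (re y) (im y) (re z) (im z) ,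
            solve 6 (λ a b c d e f → (a :* c :- b :* d) :* f :+ (a :* d :+ b :* c) :* e
                                  := a :* (c :* f :+ d :* e) :+ b :* (c :* e :- d :* f)) refl (re x) (im x) (re y) (im y) (re z) (im z)
        ; *-identity =
            (λ _ → solve 2 (λ a b → con (+ 1) :* a :- con (+ 0) :* b := a) refl _ _
                 , solve 2 (λ a b → con (+ 1) :* b :+ con (+ 0) :* a := b) refl _ _) ,
            (λ _ → solve 2 (λ a b → a :* con (+ 1) :- b :* con (+ 0) := a) refl _ _
                 , solve 2 (λ a b → a :* con (+ 0) :+ b :* con (+ 1) := b) refl _ _)
        ; distrib =
            (λ x y z → solve 6 (λ a b c d e f → a :* (c :+ e) :- b :* (d :+ f) := (a :* c :- b :* d) :+ (a :* e :- b :* f)) refl (re x) (im x) (re y) (im y) (re z) (im z)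
                     , solve 6 (λ a b c d e f → a :* (d :+ f) :+ b :* (c :+ e) := (a :* d :+ b :* c) :+ (a :* f :+ b :* e)) refl (re x) (im x) (re y) (im y) (re z) (im z)) ,
            (λ x y z → solve 6 (λ a b c d e f → (c :+ e) :* a :- (d :+ f) :* b := (c :* a :- d :* b) :+ (e :* a :- f :* b)) refl (re x) (im x) (re y) (im y) (re z) (im z)
                     , solve 6 (λ a b c d e f → (c :+ e) :* b :+ (d :+ f) :* a := (c :* b :+ d :* a) :+ (e :* b :+ f :* a)) refl (re x) (im x) (re y) (im y) (re z) (im z)) }
      ; *-comm = λ _ _ →
          solve 4 (λ a b c d → a :* c :- b :* d := c :* a :- d :* b) refl _ _ _ _ ,
          solve 4 (λ a b c d → a :* d :+ b :* c := c :* b :+ d :* a) refl _ _ _ _ } }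
    where open ℝ-Solver

  module C = CommutativeRing ℂ-commutativeRing
  module ℂ-Solver = IntegerRingSolver ℂ-commutativeRing
  module ℂ-Sums = SequenceSums ℂ-commutativeRing
  module ℝ-Sums = SequenceSums ℝ.commutativeRing
  module ≈-Reasoning = Relation.Binary.Reasoning.Setoid C.setoid
  open ℂ-Sums public using (∑; ∑-cong; ∑-last; ∑-split; ∑-+; ∑-*ˡ; ∑-⋆; _⋆_)
  module C^ where
    open import Algebra.Properties.CommutativeSemiring.Exp C.commutativeSemiring public

  ι : Carrier → ℂ
  ι r = r +i 0#

  •≈ι* : ∀ c z → c • z ≈ ι c * z
  •≈ι* c z =
    solve 3 (λ c x y → c :* x := c :* x :- con (+ 0) :* y) refl _ _ _ ,
    solve 3 (λ c x y → c :* y := c :* y :+ con (+ 0) :* x) refl _ _ _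
    where open ℝ-Solver

  •-cong : ∀ {c d z w} → c ℝ.≈ d → z ≈ w → c • z ≈ d • w
  •-cong c≈d (p , q) = *-cong c≈d p , *-cong c≈d q

  •-* : ∀ c d z w → (c • z) * (d • w) ≈ (c ℝ.* d) • (z * w)
  •-* c d z w =
    solve 6 (λ c d x y u v → c :* x :* (d :* u) :- c :* y :* (d :* v) := c :* d :* (x :* u :- y :* v)) refl _ _ _ _ _ _ ,
    solve 6 (λ c d x y u v → c :* x :* (d :* v) :+ c :* y :* (d :* u) := c :* d :* (x :* v :+ y :* u)) refl _ _ _ _ _ _
    where open ℝ-Solver

  •-assoc : ∀ c d z → (c ℝ.* d) • z ≈ c • (d • z)
  •-assoc c d z = *-assoc _ _ _ , *-assoc _ _ _

  •-^ : ∀ c z k → (c • z) ^ k ≈ (c ℝ.^ k) • (z ^ k)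
  •-^ c z zero    = sym (*-identityˡ _) , sym (*-identityˡ _)
  •-^ c z (suc k) = C.trans (C.*-congˡ (•-^ c z k)) (•-* c (c ℝ.^ k) z (z ^ k))

  -- The 1-norm, equivalent to the modulus: |z| ≤ ‖z‖ ≤ 2 |z|. It is a sum of absolute values,
  -- subadditive and submultiplicative.
  ‖_‖ : ℂ → Carrier
  ‖ z ‖ = ∣ re z ∣ ℝ.+ ∣ im z ∣

  ‖‖-cong : ∀ {z w} → z ≈ w → ‖ z ‖ ℝ.≈ ‖ w ‖
  ‖‖-cong (p , q) = +-cong (∣∣-cong p) (∣∣-cong q)

  0≤‖z‖ : ∀ z → 0# ≤ ‖ z ‖
  0≤‖z‖ z = +-nonneg (0≤∣x∣ _) (0≤∣x∣ _)

  ‖0‖ : ‖ 0ℂ ‖ ℝ.≈ 0#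
  ‖0‖ = trans (+-cong ∣0∣ ∣0∣) (+-identityˡ _)

  ‖z‖≤0⇒z≈0 : ∀ {z} → ‖ z ‖ ≤ 0# → z ≈ 0ℂ
  ‖z‖≤0⇒z≈0 {z} N≤0 =
    ∣x∣≤0 (≤-trans (≤-by (0≤∣x∣ (im z)) refl) N≤0) ,
    ∣x∣≤0 (≤-trans (≤-by (0≤∣x∣ (re z)) (+-comm _ _)) N≤0)
    where
    open ℝ-Solver
    ∣x∣≤0 : ∀ {x} → ∣ x ∣ ≤ 0# → x ℝ.≈ 0#
    ∣x∣≤0 {x} p = antisym (≤-trans (x≤∣x∣ x) p)
      (≤-by (neg-nonneg (≤-trans (-x≤∣x∣ x) p)) (solve 1 (λ x → x := con (+ 0) :+ :- (:- x)) refl _))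

  ‖z+w‖≤‖z‖+‖w‖ : ∀ z w → ‖ z + w ‖ ≤ ‖ z ‖ ℝ.+ ‖ w ‖
  ‖z+w‖≤‖z‖+‖w‖ z w = ≤-respʳ
    (solve 4 (λ x y u v → x :+ u :+ (y :+ v) := x :+ y :+ (u :+ v)) refl _ _ _ _)
    (+-mono-≤ (∣x+y∣≤∣x∣+∣y∣ (re z) (re w)) (∣x+y∣≤∣x∣+∣y∣ (im z) (im w)))
    where open ℝ-Solver

  ‖-z‖ : ∀ z → ‖ - z ‖ ℝ.≈ ‖ z ‖
  ‖-z‖ z = +-cong (∣-x∣ _) (∣-x∣ _)

  ‖z-w‖-comm : ∀ z w → ‖ z - w ‖ ℝ.≈ ‖ w - z ‖
  ‖z-w‖-comm z w = trans (sym (‖-z‖ (z - w))) (‖‖-cong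
     (solve 2 (λ z w → :- (z :- w) := w :- z) C.refl z w))
    where open ℂ-Solver

  ‖z*w‖≤‖z‖*‖w‖ : ∀ z w → ‖ z * w ‖ ≤ ‖ z ‖ ℝ.* ‖ w ‖
  ‖z*w‖≤‖z‖*‖w‖ z w = begin
    ∣ x ℝ.* u ℝ.- y ℝ.* t ∣ ℝ.+ ∣ x ℝ.* t ℝ.+ y ℝ.* u ∣
      ≤⟨ +-mono-≤ (∣x+y∣≤∣x∣+∣y∣ _ _) (∣x+y∣≤∣x∣+∣y∣ _ _) ⟩
    ∣ x ℝ.* u ∣ ℝ.+ ∣ ℝ.- (y ℝ.* t) ∣ ℝ.+ (∣ x ℝ.* t ∣ ℝ.+ ∣ y ℝ.* u ∣)
      ≈⟨ +-cong (+-cong (∣xy∣≈∣x∣∣y∣ x u) (trans (∣-x∣ _) (∣xy∣≈∣x∣∣y∣ y t))) (+-cong (∣xy∣≈∣x∣∣y∣ x t) (∣xy∣≈∣x∣∣y∣ y u)) ⟩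
    ∣ x ∣ ℝ.* ∣ u ∣ ℝ.+ ∣ y ∣ ℝ.* ∣ t ∣ ℝ.+ (∣ x ∣ ℝ.* ∣ t ∣ ℝ.+ ∣ y ∣ ℝ.* ∣ u ∣)
      ≈⟨ solve 4 (λ x y u t → x :* u :+ y :* t :+ (x :* t :+ y :* u) := (x :+ y) :* (u :+ t)) refl _ _ _ _ ⟩
    ‖ z ‖ ℝ.* ‖ w ‖ ∎
    where
    open ≤-Reasoning
    open ℝ-Solver
    x = re z ; y = im z ; u = re w ; t = im w

  ‖c•z‖ : ∀ c z → ‖ c • z ‖ ℝ.≈ ∣ c ∣ ℝ.* ‖ z ‖
  ‖c•z‖ c z = trans (+-cong (∣xy∣≈∣x∣∣y∣ _ _) (∣xy∣≈∣x∣∣y∣ _ _)) (sym (distribˡ _ _ _))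

  ‖z^k‖≤‖z‖^k : ∀ z k → ‖ z ^ k ‖ ≤ ‖ z ‖ ℝ.^ k
  ‖z^k‖≤‖z‖^k z zero    = ≤-reflexive (trans (+-cong (nonneg⇒∣x∣≈x 0≤1) ∣0∣) (+-identityʳ _))
  ‖z^k‖≤‖z‖^k z (suc k) = ≤-trans (‖z*w‖≤‖z‖*‖w‖ z (z ^ k)) (*-monoˡ-≤ (0≤‖z‖ z) (‖z^k‖≤‖z‖^k z k))

  ∣z∣²≤‖z‖² : ∀ z → ∣ z ∣² ≤ ‖ z ‖ ℝ.* ‖ z ‖
  ∣z∣²≤‖z‖² z = ≤-by (*-nonNeg-2 (0≤∣x∣ (re z)) (0≤∣x∣ (im z))) (begin-equality
    (a ℝ.+ b) ℝ.* (a ℝ.+ b)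
      ≈⟨ solve 2 (λ a b → (a :+ b) :* (a :+ b) := a :* a :+ b :* b :+ (a :* b :+ a :* b)) refl a b ⟩
    a ℝ.* a ℝ.+ b ℝ.* b ℝ.+ (a ℝ.* b ℝ.+ a ℝ.* b)
      ≈⟨ +-congʳ (+-cong (∣x∣²≈x² _) (∣x∣²≈x² _)) ⟩
    ∣ z ∣² ℝ.+ (a ℝ.* b ℝ.+ a ℝ.* b) ∎)
    where
    open ≤-Reasoning
    open ℝ-Solver
    a = ∣ re z ∣ ; b = ∣ im z ∣
    *-nonNeg-2 : ∀ {x y} → 0# ≤ x → 0# ≤ y → 0# ≤ x ℝ.* y ℝ.+ x ℝ.* y
    *-nonNeg-2 p q = +-nonneg (*-nonNeg p q) (*-nonNeg p q)

  ∣z∣²<ε²⇒‖z‖<2ε : ∀ {z ε} → 0# < ε → ∣ z ∣² < ε ℝ.* ε → ‖ z ‖ < ε ℝ.+ ε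
  ∣z∣²<ε²⇒‖z‖<2ε {z} {ε} 0<ε z<ε = <-≤-trans
    (<-by (diff-pos (part (≤-<-trans (≤-by (square-nonneg (im z)) refl) z<ε)))
      (solve 3 (λ a b e → e :+ b := a :+ b :+ (e :- a)) refl _ ∣ im z ∣ _))
    (+-mono-≤ ≤-refl (<⇒≤ (part (≤-<-trans (≤-by (square-nonneg (re z)) (+-comm _ _)) z<ε))))
    where
    open ℝ-Solver
    part : ∀ {x} → x ℝ.* x < ε ℝ.* ε → ∣ x ∣ < ε
    part {x} p = square-<⇒< (<⇒≤ 0<ε) (≤-<-trans (≤-reflexive (∣x∣²≈x² x)) p)

  infix 4 _⟶_
  _⟶_ : (ℕ → ℂ) → ℂ → Set
  a ⟶ z = Null (λ m → ‖ a m - z ‖)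

  HasSum⇒⟶ : ∀ {a z} → HasSum a z → ∑ a ⟶ z
  HasSum⇒⟶ a→z ε 0<ε =
    -- Half of ε, because a modulus below ε bounds the 1-norm only by 2ε.
    let N , bound = a→z (½ ℝ.* ε) (*-pos 0<½ 0<ε) in
    N , λ m N≤m → <-respʳ (½+½ ε) (∣z∣²<ε²⇒‖z‖<2ε (*-pos 0<½ 0<ε) (bound m N≤m))

  ⟶⇒HasSum : ∀ {a z} → ∑ a ⟶ z → HasSum a z
  ⟶⇒HasSum {a} {z} a→z ε 0<ε =
    let N , bound = a→z ε 0<ε in
    N , λ m N≤m → ≤-<-trans (∣z∣²≤‖z‖² _) (square-mono-< (0≤‖z‖ _) (bound m N≤m))
    where
    square-mono-< : ∀ {x y} → 0# ≤ x → x < y → x ℝ.* x < y ℝ.* y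
    square-mono-< {x} {y} 0≤x x<y = ≤-<-trans (*-monoˡ-≤ 0≤x (<⇒≤ x<y))
      (<-by (*-pos (diff-pos x<y) (≤-<-trans 0≤x x<y))
        (solve 2 (λ x y → y :* y := x :* y :+ (y :- x) :* y) refl _ _))
      where open ℝ-Solver

  ⟶-cong : ∀ {a b z w} M → (∀ m → M ℕ.≤ m → a m ≈ b m) → z ≈ w → a ⟶ z → b ⟶ w
  ⟶-cong M a≈b z≈w = Null-≤ M λ m M≤m →
    ≤-reflexive (‖‖-cong (C.+-cong (C.sym (a≈b m M≤m)) (C.-‿cong (C.sym z≈w))))

  ⟶-unique : ∀ {a z w} → a ⟶ z → a ⟶ w → z ≈ w
  ⟶-unique {a} {z} {w} a→z a→w = begin
    z ≈⟨ solve 2 (λ z w → z := z :- w :+ w) C.refl z w ⟩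
    z - w + w ≈⟨ C.+-congʳ (‖z‖≤0⇒z≈0 (Null-const (Null-≤ 0 bound (Null-+ a→z a→w)))) ⟩
    0ℂ + w ≈⟨ C.+-identityˡ w ⟩
    w ∎
    where
    open ≈-Reasoning
    open ℂ-Solver
    bound : ∀ m → 0 ℕ.≤ m → ‖ z - w ‖ ≤ ‖ a m - z ‖ ℝ.+ ‖ a m - w ‖
    bound m _ = ≤-trans
      (≤-reflexive (‖‖-cong (solve 3 (λ z w a → z :- w := (a :- w) :- (a :- z)) C.refl z w (a m))))
      (≤-trans (‖z+w‖≤‖z‖+‖w‖ _ _) (≤-reflexive (trans (+-comm _ _) (+-congʳ (‖-z‖ _)))))

  ⟶-+ : ∀ {a b z w} → a ⟶ z → b ⟶ w → (λ m → a m + b m) ⟶ z + w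
  ⟶-+ {a} {b} {z} {w} a→z b→w = Null-≤ 0 (λ m _ → ≤-trans
    (≤-reflexive (‖‖-cong (solve 4 (λ a b z w → a :+ b :- (z :+ w) := (a :- z) :+ (b :- w)) C.refl (a m) (b m) z w)))
    (‖z+w‖≤‖z‖+‖w‖ _ _)) (Null-+ a→z b→w)
    where open ℂ-Solver

  -- a b - z w = (a - z)(b - w) + z (b - w) + w (a - z), and ‖b - w‖ ≤ 1 eventually.
  ⟶-* : ∀ {a b z w} → a ⟶ z → b ⟶ w → (λ m → a m * b m) ⟶ z * w
  ⟶-* {a} {b} {z} {w} a→z b→w = Null-≤ (proj₁ (b→w 1# 0<1)) bound
    (Null-+ (Null-*ˡ (1# ℝ.+ ‖ w ‖) (+-nonneg 0≤1 (0≤‖z‖ w)) a→z) (Null-*ˡ ‖ z ‖ (0≤‖z‖ z) b→w))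
    where
    bound : ∀ m → proj₁ (b→w 1# 0<1) ℕ.≤ m →
            ‖ a m * b m - z * w ‖ ≤ (1# ℝ.+ ‖ w ‖) ℝ.* ‖ a m - z ‖ ℝ.+ ‖ z ‖ ℝ.* ‖ b m - w ‖
    bound m M≤m = begin
      ‖ a m * b m - z * w ‖
        ≈⟨ ‖‖-cong (ℂ-Solver.solve 4 (λ a b z w → let open ℂ-Solver in
             a :* b :- z :* w := (b :- w) :* (a :- z) :+ w :* (a :- z) :+ z :* (b :- w)) C.refl (a m) (b m) z w) ⟩
      ‖ B * A + w * A + z * B ‖
        ≤⟨ ≤-trans (‖z+w‖≤‖z‖+‖w‖ _ _) (+-mono-≤ (≤-trans (‖z+w‖≤‖z‖+‖w‖ _ _)
             (+-mono-≤ (‖z*w‖≤‖z‖*‖w‖ B A) (‖z*w‖≤‖z‖*‖w‖ w A))) (‖z*w‖≤‖z‖*‖w‖ z B)) ⟩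
      ‖ B ‖ ℝ.* ‖ A ‖ ℝ.+ ‖ w ‖ ℝ.* ‖ A ‖ ℝ.+ ‖ z ‖ ℝ.* ‖ B ‖
        ≤⟨ +-mono-≤ (+-mono-≤ (*-monoʳ-≤ (0≤‖z‖ A) (<⇒≤ (proj₂ (b→w 1# 0<1) m M≤m))) ≤-refl) ≤-refl ⟩
      1# ℝ.* ‖ A ‖ ℝ.+ ‖ w ‖ ℝ.* ‖ A ‖ ℝ.+ ‖ z ‖ ℝ.* ‖ B ‖
        ≈⟨ +-congʳ (sym (distribʳ _ _ _)) ⟩
      (1# ℝ.+ ‖ w ‖) ℝ.* ‖ A ‖ ℝ.+ ‖ z ‖ ℝ.* ‖ B ‖ ∎
      where
      open ≤-Reasoning
      A = a m - z
      B = b m - w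

-- The exponential series and its functional equation.

module Exponential (ℝ : CompleteOrderedField) where
  open ComplexNumbers ℝ
  open ℝ-Sums using () renaming (∑ to ∑ᴿ; _⋆_ to infixl 7 _⋆ᴿ_)
  open import Algebra.Definitions.RawSemiring (Semiring.rawSemiring C.semiring)
    using () renaming (_×_ to _·ℂ_)

  ∑-nonneg : ∀ {a} → (∀ k → 0# ≤ a k) → ∀ m → 0# ≤ ∑ᴿ a m
  ∑-nonneg 0≤a zero    = ≤-refl
  ∑-nonneg 0≤a (suc m) = +-nonneg (0≤a 0) (∑-nonneg (0≤a ∘ suc) m)

  ⋆-nonneg : ∀ {a b} → (∀ k → 0# ≤ a k) → (∀ k → 0# ≤ b k) → ∀ k → 0# ≤ (a ⋆ᴿ b) k
  ⋆-nonneg 0≤a 0≤b zero    = *-nonNeg (0≤a 0) (0≤b 0)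
  ⋆-nonneg 0≤a 0≤b (suc k) = +-nonneg (*-nonNeg (0≤a 0) (0≤b (suc k))) (⋆-nonneg (0≤a ∘ suc) 0≤b k)

  ‖∑‖≤∑ : ∀ {a â} → (∀ k → ‖ a k ‖ ≤ â k) → ∀ m → ‖ ∑ a m ‖ ≤ ∑ᴿ â m
  ‖∑‖≤∑ a≤â zero    = ≤-reflexive ‖0‖
  ‖∑‖≤∑ a≤â (suc m) = ≤-trans (‖z+w‖≤‖z‖+‖w‖ _ _) (+-mono-≤ (a≤â 0) (‖∑‖≤∑ (a≤â ∘ suc) m))

  ∑-mono-length : ∀ {a} → (∀ k → 0# ≤ a k) → ∀ k m → ∑ᴿ a m ≤ ∑ᴿ a (k ℕ.+ m)
  ∑-mono-length {a} 0≤a k m rewrite ℕ.+-comm k m = ≤-by (∑-nonneg (λ i → 0≤a (m ℕ.+ i)) k) (ℝ-Sums.∑-split a m k)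

  ∑-segment-bound : ∀ {a â} → (∀ k → ‖ a k ‖ ≤ â k) → ∀ k i →
                    ‖ ∑ a (k ℕ.+ i) - ∑ a k ‖ ≤ ∑ᴿ â (k ℕ.+ i) ℝ.- ∑ᴿ â k
  ∑-segment-bound {a} {â} a≤â k i = begin
    ‖ ∑ a (k ℕ.+ i) - ∑ a k ‖
      ≈⟨ ‖‖-cong (C.+-congʳ (∑-split a k i)) ⟩
    ‖ ∑ a k + ∑ (λ j → a (k ℕ.+ j)) i - ∑ a k ‖
      ≈⟨ ‖‖-cong (ℂ-Solver.solve 2 (λ x y → let open ℂ-Solver in x :+ y :- x := y) C.refl _ _) ⟩
    ‖ ∑ (λ j → a (k ℕ.+ j)) i ‖
      ≤⟨ ‖∑‖≤∑ (λ j → a≤â (k ℕ.+ j)) i ⟩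
    ∑ᴿ (λ j → â (k ℕ.+ j)) i
      ≈⟨ ℝ-Solver.solve 2 (λ x y → let open ℝ-Solver in y := x :+ y :- x) refl (∑ᴿ â k) _ ⟩
    ∑ᴿ â k ℝ.+ ∑ᴿ (λ j → â (k ℕ.+ j)) i ℝ.- ∑ᴿ â k
      ≈⟨ +-congʳ (ℝ-Sums.∑-split â k i) ⟨
    ∑ᴿ â (k ℕ.+ i) ℝ.- ∑ᴿ â k ∎
    where open ≤-Reasoning

  -- The difference is the sum of the a j b l over the pairs of the rectangle outside the triangle,
  -- so it is dominated term by term. The induction removes one row; the triangle then shrinks while
  -- the row length `k + i` stays, which is what the slack `i` is for.
  rectangle-minus-triangle : ∀ {a b â b̂} → (∀ k → ‖ a k ‖ ≤ â k) → (∀ k → ‖ b k ‖ ≤ b̂ k) → ∀ k i →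
    ‖ ∑ a k * ∑ b (k ℕ.+ i) - ∑ (a ⋆ b) k ‖ ≤
    ∑ᴿ â k ℝ.* ∑ᴿ b̂ (k ℕ.+ i) ℝ.- ∑ᴿ (â ⋆ᴿ b̂) k
  rectangle-minus-triangle {a} {b} {â} {b̂} a≤â b≤b̂ zero i = ≤-reflexive (trans
    (trans (‖‖-cong (ℂ-Solver.solve 1 (λ x → let open ℂ-Solver in con (+ 0) :* x :- con (+ 0) := con (+ 0)) C.refl (∑ b i))) ‖0‖)
    (ℝ-Solver.solve 1 (λ x → let open ℝ-Solver in con (+ 0) := con (+ 0) :* x :- con (+ 0)) refl (∑ᴿ b̂ i)))
  rectangle-minus-triangle {a} {b} {â} {b̂} a≤â b≤b̂ (suc k) i = begin
    ‖ (a 0 + A′) * Bm - ∑ (a ⋆ b) (suc k) ‖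
      ≈⟨ ‖‖-cong (C.trans (C.+-congˡ (C.-‿cong (∑-⋆ a b k)))
          (ℂ-Solver.solve 5 (λ x y u s t → let open ℂ-Solver in
             (x :+ y) :* u :- (x :* s :+ t) := x :* (u :- s) :+ (y :* u :- t)) C.refl (a 0) A′ Bm Bk T′)) ⟩
    ‖ a 0 * (Bm - Bk) + (A′ * Bm - T′) ‖
      ≤⟨ ‖z+w‖≤‖z‖+‖w‖ _ _ ⟩
    ‖ a 0 * (Bm - Bk) ‖ ℝ.+ ‖ A′ * Bm - T′ ‖
      ≤⟨ +-mono-≤ (≤-trans (‖z*w‖≤‖z‖*‖w‖ _ _) (*-mono-≤ (0≤‖z‖ _) (≤-trans (0≤‖z‖ _) seg) (a≤â 0) seg)) IH ⟩
    â 0 ℝ.* (B̂m ℝ.- B̂k) ℝ.+ (Â′ ℝ.* B̂m ℝ.- T̂′)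
      ≈⟨ trans (ℝ-Solver.solve 5 (λ x y u s t → let open ℝ-Solver in
             x :* (u :- s) :+ (y :* u :- t) := (x :+ y) :* u :- (x :* s :+ t)) refl (â 0) Â′ B̂m B̂k T̂′)
          (+-congˡ (-‿cong (sym (ℝ-Sums.∑-⋆ â b̂ k)))) ⟩
    (â 0 ℝ.+ Â′) ℝ.* B̂m ℝ.- ∑ᴿ (â ⋆ᴿ b̂) (suc k) ∎
    where
    open ≤-Reasoning
    A′ = ∑ (a ∘ suc) k
    Bm = ∑ b (suc k ℕ.+ i)
    Bk = ∑ b (suc k)
    T′ = ∑ ((a ∘ suc) ⋆ b) k
    Â′ = ∑ᴿ (â ∘ suc) k
    B̂m = ∑ᴿ b̂ (suc k ℕ.+ i)
    B̂k = ∑ᴿ b̂ (suc k)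
    T̂′ = ∑ᴿ ((â ∘ suc) ⋆ᴿ b̂) k
    seg : ‖ Bm - Bk ‖ ≤ B̂m ℝ.- B̂k
    seg = ∑-segment-bound b≤b̂ (suc k) i
    IH : ‖ A′ * Bm - T′ ‖ ≤ Â′ ℝ.* B̂m ℝ.- T̂′
    IH = ≡.subst (λ j → ‖ A′ * ∑ b j - T′ ‖ ≤ Â′ ℝ.* ∑ᴿ b̂ j ℝ.- T̂′) (ℕ.+-suc k i)
           (rectangle-minus-triangle (a≤â ∘ suc) b≤b̂ k (suc i))

  -- Pairs with j < k and l < m satisfy j + l < k + m, so the rectangle lies inside the triangle and
  -- the surplus terms are nonnegative.
  rectangle≤triangle : ∀ {a b} → (∀ k → 0# ≤ a k) → (∀ k → 0# ≤ b k) → ∀ k m →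
    ∑ᴿ a k ℝ.* ∑ᴿ b m ≤ ∑ᴿ (a ⋆ᴿ b) (k ℕ.+ m)
  rectangle≤triangle {a} {b} 0≤a 0≤b zero m = ≤-trans (≤-reflexive (zeroˡ _)) (∑-nonneg (⋆-nonneg 0≤a 0≤b) m)
  rectangle≤triangle {a} {b} 0≤a 0≤b (suc k) m = begin
    (a 0 ℝ.+ ∑ᴿ (a ∘ suc) k) ℝ.* ∑ᴿ b m
      ≈⟨ distribʳ _ _ _ ⟩
    a 0 ℝ.* ∑ᴿ b m ℝ.+ ∑ᴿ (a ∘ suc) k ℝ.* ∑ᴿ b m
      ≤⟨ +-mono-≤ (*-monoˡ-≤ (0≤a 0) (∑-mono-length 0≤b (suc k) m)) (rectangle≤triangle (0≤a ∘ suc) 0≤b k m) ⟩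
    a 0 ℝ.* ∑ᴿ b (suc k ℕ.+ m) ℝ.+ ∑ᴿ ((a ∘ suc) ⋆ᴿ b) (k ℕ.+ m)
      ≈⟨ ℝ-Sums.∑-⋆ a b (k ℕ.+ m) ⟨
    ∑ᴿ (a ⋆ᴿ b) (suc k ℕ.+ m) ∎
    where open ≤-Reasoning

  ∑-halving : ∀ {b} → (∀ k → 0# ≤ b k) → (∀ k → b (suc k) ℝ.+ b (suc k) ≤ b k) → ∀ i →
              ∑ᴿ b i ≤ b 0 ℝ.+ b 0
  ∑-halving 0≤b halves zero    = +-nonneg (0≤b 0) (0≤b 0)
  ∑-halving 0≤b halves (suc i) =
    +-mono-≤ ≤-refl (≤-trans (∑-halving (0≤b ∘ suc) (halves ∘ suc) i) (halves 0))

  Null-halving : ∀ {b} → (∀ k → 0# ≤ b k) → (∀ k → b (suc k) ℝ.+ b (suc k) ≤ b k) → Null b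
  Null-halving {b} 0≤b halves = Null-≤ 0 (λ k _ → bound k) (Null-*ˡ (b 0) (0≤b 0) (Null-geometric 0<1 (⁻¹-inverse 0<2)))
    where
    open ≤-Reasoning
    open ℝ-Solver
    bound : ∀ k → b k ≤ b 0 ℝ.* ½ ℝ.^ k
    bound zero    = ≤-reflexive (sym (*-identityʳ _))
    bound (suc k) = begin
      b (suc k) ≈⟨ ½+½ _ ⟨
      ½ ℝ.* b (suc k) ℝ.+ ½ ℝ.* b (suc k) ≈⟨ distribˡ _ _ _ ⟨
      ½ ℝ.* (b (suc k) ℝ.+ b (suc k)) ≤⟨ *-monoˡ-≤ (<⇒≤ 0<½) (≤-trans (halves k) (bound k)) ⟩
      ½ ℝ.* (b 0 ℝ.* ½ ℝ.^ k) ≈⟨ solve 3 (λ h b p → h :* (b :* p) := b :* (h :* p)) refl _ _ _ ⟩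
      b 0 ℝ.* ½ ℝ.^ suc k ∎

  !⁻¹ : ℕ → Carrier
  !⁻¹ k = fromℕ (k !) ℝ.⁻¹

  fromℕ-! : ∀ k → fromℕ (suc k !) ℝ.≈ fromℕ (suc k) ℝ.* fromℕ (k !)
  fromℕ-! k = ×1-homo-* (suc k) (k !)

  0<! : ∀ k → 0# < fromℕ (k !)
  0<! zero    = fromℕ-suc-pos 0
  0<! (suc k) = <-respʳ (sym (fromℕ-! k)) (*-pos (fromℕ-suc-pos k) (0<! k))

  fromℕ1≈1 : fromℕ 1 ℝ.≈ 1#
  fromℕ1≈1 = +-identityʳ _

  !⁻¹-zero : !⁻¹ 0 ℝ.≈ 1#
  !⁻¹-zero = trans (sym (*-identityˡ _)) (trans (*-congʳ (sym fromℕ1≈1)) (⁻¹-inverse (fromℕ-suc-pos 0)))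

  !⁻¹-suc : ∀ k → fromℕ (suc k) ℝ.* !⁻¹ (suc k) ℝ.≈ !⁻¹ k
  !⁻¹-suc k = *-cancelˡ (pos⇒≉0 (0<! k)) (begin-equality
    fromℕ (k !) ℝ.* (fromℕ (suc k) ℝ.* !⁻¹ (suc k))
      ≈⟨ solve 3 (λ x y z → x :* (y :* z) := y :* x :* z) refl (fromℕ (k !)) (fromℕ (suc k)) (!⁻¹ (suc k)) ⟩
    fromℕ (suc k) ℝ.* fromℕ (k !) ℝ.* !⁻¹ (suc k)
      ≈⟨ *-congʳ (fromℕ-! k) ⟨
    fromℕ (suc k !) ℝ.* !⁻¹ (suc k)
      ≈⟨ ⁻¹-inverse (0<! (suc k)) ⟩
    1#
      ≈⟨ ⁻¹-inverse (0<! k) ⟨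
    fromℕ (k !) ℝ.* !⁻¹ k ∎)
    where
    open ≤-Reasoning
    open ℝ-Solver

  e : ℂ → ℕ → ℂ
  e z k = !⁻¹ k • z ^ k

  ê : Carrier → ℕ → Carrier
  ê c k = !⁻¹ k ℝ.* c ℝ.^ k

  ·≈fromℕ* : ∀ k x → k ℝ.· x ℝ.≈ fromℕ k ℝ.* x
  ·≈fromℕ* zero    x = sym (zeroˡ x)
  ·≈fromℕ* (suc k) x = trans (+-cong (sym (*-identityˡ x)) (·≈fromℕ* k x)) (sym (distribʳ _ _ _))

  ·≈fromℕ• : ∀ k z → k ·ℂ z ≈ fromℕ k • z
  ·≈fromℕ• zero    z = sym (zeroˡ _) , sym (zeroˡ _)
  ·≈fromℕ• (suc k) z = C.trans (C.+-congˡ (·≈fromℕ• k z))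
    (solve 2 (λ k x → x :+ k :* x := (con (+ 1) :+ k) :* x) refl (fromℕ k) (re z) ,
     solve 2 (λ k x → x :+ k :* x := (con (+ 1) :+ k) :* x) refl (fromℕ k) (im z))
    where open ℝ-Solver

  ·ℝ-cancel : ∀ k {x y} → suc k ℝ.· x ℝ.≈ suc k ℝ.· y → x ℝ.≈ y
  ·ℝ-cancel k {x} {y} kx≈ky = *-cancelˡ (pos⇒≉0 (fromℕ-suc-pos k))
    (trans (sym (·≈fromℕ* (suc k) x)) (trans kx≈ky (·≈fromℕ* (suc k) y)))

  ·ℂ-cancel : ∀ k {x y} → suc k ·ℂ x ≈ suc k ·ℂ y → x ≈ y
  ·ℂ-cancel k {x} {y} kx≈ky =
    *-cancelˡ (pos⇒≉0 (fromℕ-suc-pos k)) (proj₁ kx≈ky′) , *-cancelˡ (pos⇒≉0 (fromℕ-suc-pos k)) (proj₂ kx≈ky′)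
    where
    kx≈ky′ : fromℕ (suc k) • x ≈ fromℕ (suc k) • y
    kx≈ky′ = C.trans (C.sym (·≈fromℕ• (suc k) x)) (C.trans kx≈ky (·≈fromℕ• (suc k) y))

  ê-isExpSeq : ∀ c → ℝ-Sums.IsExpSeq c (ê c)
  ê-isExpSeq c = trans (*-identityʳ _) !⁻¹-zero , λ k → begin-equality
    suc k ℝ.· ê c (suc k) ≈⟨ ·≈fromℕ* (suc k) _ ⟩
    fromℕ (suc k) ℝ.* (!⁻¹ (suc k) ℝ.* (c ℝ.* c ℝ.^ k))
      ≈⟨ solve 4 (λ n f c p → n :* (f :* (c :* p)) := c :* (n :* f :* p)) refl (fromℕ (suc k)) (!⁻¹ (suc k)) c (c ℝ.^ k) ⟩
    c ℝ.* (fromℕ (suc k) ℝ.* !⁻¹ (suc k) ℝ.* c ℝ.^ k) ≈⟨ *-congˡ (*-congʳ (!⁻¹-suc k)) ⟩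
    c ℝ.* ê c k ∎
    where
    open ≤-Reasoning
    open ℝ-Solver

  e-isExpSeq : ∀ z → ℂ-Sums.IsExpSeq z (e z)
  e-isExpSeq z = (trans (*-identityʳ _) !⁻¹-zero , zeroʳ _) , λ k → begin
    suc k ·ℂ e z (suc k) ≈⟨ ·≈fromℕ• (suc k) _ ⟩
    fromℕ (suc k) • (!⁻¹ (suc k) • (z * z ^ k)) ≈⟨ •-assoc _ _ _ ⟨
    (fromℕ (suc k) ℝ.* !⁻¹ (suc k)) • (z * z ^ k) ≈⟨ •-cong (!⁻¹-suc k) C.refl ⟩
    !⁻¹ k • (z * z ^ k) ≈⟨ •≈ι* _ _ ⟩
    ι (!⁻¹ k) * (z * z ^ k) ≈⟨ solve 3 (λ c z w → c :* (z :* w) := z :* (c :* w)) C.refl _ _ _ ⟩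
    z * (ι (!⁻¹ k) * z ^ k) ≈⟨ C.*-congˡ (•≈ι* _ _) ⟨
    z * e z k ∎
    where
    open ≈-Reasoning
    open ℂ-Solver

  0≤!⁻¹ : ∀ k → 0# ≤ !⁻¹ k
  0≤!⁻¹ k = <⇒≤ (⁻¹-pos (0<! k))

  ê-nonneg : ∀ {c} → 0# ≤ c → ∀ k → 0# ≤ ê c k
  ê-nonneg 0≤c k = *-nonNeg (0≤!⁻¹ k) (^-nonneg k 0≤c)

  ‖e‖≤ê : ∀ z k → ‖ e z k ‖ ≤ ê ‖ z ‖ k
  ‖e‖≤ê z k = ≤-trans (≤-reflexive (trans (‖c•z‖ _ _) (*-congʳ (nonneg⇒∣x∣≈x (0≤!⁻¹ k)))))
                      (*-monoˡ-≤ (0≤!⁻¹ k) (‖z^k‖≤‖z‖^k z k))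

  -- Consecutive terms have the ratio c / (k + 1), which is at most ½ once 2c ≤ k + 1.
  ê-halves : ∀ {c} → 0# ≤ c → ∀ k → c ℝ.+ c ≤ fromℕ (suc k) → ê c (suc k) ℝ.+ ê c (suc k) ≤ ê c k
  ê-halves {c} 0≤c k 2c≤k+1 = *-cancel-≤ (fromℕ-suc-pos k) (begin
    fromℕ (suc k) ℝ.* (ê c (suc k) ℝ.+ ê c (suc k))
      ≈⟨ solve 2 (λ n x → n :* (x :+ x) := n :* x :+ n :* x) refl (fromℕ (suc k)) (ê c (suc k)) ⟩
    fromℕ (suc k) ℝ.* ê c (suc k) ℝ.+ fromℕ (suc k) ℝ.* ê c (suc k)
      ≈⟨ +-cong step step ⟩
    c ℝ.* ê c k ℝ.+ c ℝ.* ê c k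
      ≈⟨ distribʳ _ _ _ ⟨
    (c ℝ.+ c) ℝ.* ê c k
      ≤⟨ *-monoʳ-≤ (ê-nonneg 0≤c k) 2c≤k+1 ⟩
    fromℕ (suc k) ℝ.* ê c k ∎)
    where
    open ≤-Reasoning
    open ℝ-Solver
    step : fromℕ (suc k) ℝ.* ê c (suc k) ℝ.≈ c ℝ.* ê c k
    step = trans (sym (·≈fromℕ* (suc k) _)) (proj₂ (ê-isExpSeq c) k)

  -- From index `M` on, each term is at most half its predecessor, so the tail is at most twice its
  -- first term.
  module Tail {c} (0≤c : 0# ≤ c) M (2c≤M+1 : c ℝ.+ c ≤ fromℕ (suc M)) where
    halves : ∀ k → M ℕ.≤ k → ê c (suc k) ℝ.+ ê c (suc k) ≤ ê c k
    halves k M≤k = ê-halves 0≤c k (≤-trans 2c≤M+1 (fromℕ-mono (s≤s M≤k)))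

    ê-null : Null (ê c)
    ê-null = Null-shift M (Null-halving (λ k → ê-nonneg 0≤c (k ℕ.+ M)) (λ k → halves (k ℕ.+ M) (ℕ.m≤n+m M k)))

    ∑ê-tail : ∀ m → M ℕ.≤ m → ∀ i → ∑ᴿ (ê c) (m ℕ.+ i) ℝ.- ∑ᴿ (ê c) m ≤ ê c m ℝ.+ ê c m
    ∑ê-tail m M≤m i = begin
      ∑ᴿ (ê c) (m ℕ.+ i) ℝ.- ∑ᴿ (ê c) m
        ≈⟨ +-congʳ (ℝ-Sums.∑-split (ê c) m i) ⟩
      ∑ᴿ (ê c) m ℝ.+ ∑ᴿ (λ j → ê c (m ℕ.+ j)) i ℝ.- ∑ᴿ (ê c) m
        ≈⟨ solve 2 (λ x y → x :+ y :- x := y) refl (∑ᴿ (ê c) m) _ ⟩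
      ∑ᴿ (λ j → ê c (m ℕ.+ j)) i
        ≤⟨ ∑-halving (λ k → ê-nonneg 0≤c (m ℕ.+ k)) halves′ i ⟩
      ê c (m ℕ.+ 0) ℝ.+ ê c (m ℕ.+ 0)
        ≡⟨ ≡.cong (λ k → ê c k ℝ.+ ê c k) (ℕ.+-identityʳ m) ⟩
      ê c m ℝ.+ ê c m ∎
      where
      open ≤-Reasoning
      open ℝ-Solver
      halves′ : ∀ k → ê c (m ℕ.+ suc k) ℝ.+ ê c (m ℕ.+ suc k) ≤ ê c (m ℕ.+ k)
      halves′ k rewrite ℕ.+-suc m k = halves (m ℕ.+ k) (ℕ.≤-trans M≤m (ℕ.m≤m+n m k))

  tail-index : ∀ {c} → 0# ≤ c → ∃[ M ] c ℝ.+ c ≤ fromℕ (suc M)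
  tail-index {c} 0≤c = let M , 2c<M = archimedean (c ℝ.+ c) (+-nonneg 0≤c 0≤c) in
    M , ≤-trans (<⇒≤ 2c<M) (fromℕ-mono (ℕ.n≤1+n M))

  -- e^z e^w and the partial sum of e^{z+w} differ by the terms of a square outside a triangle,
  -- which are dominated by a tail of the series of e^{‖z‖+‖w‖}.
  exp-+ : ∀ {z w Z W} → ∑ (e z) ⟶ Z → ∑ (e w) ⟶ W → ∑ (e (z + w)) ⟶ Z * W
  exp-+ {z} {w} {Z} {W} z→Z w→W = ⟶-cong 0
    (λ m _ → solve 2 (λ x y → x :+ (y :- x) := y) C.refl (∑ (e z) m * ∑ (e w) m) (∑ (e (z + w)) m))
    (C.+-identityʳ _)
    (⟶-+ (⟶-* z→Z w→W) (Null-≤ M bound (Null-+ ê-null ê-null)))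
    where
    open ℂ-Solver
    0≤c : 0# ≤ ‖ z ‖ ℝ.+ ‖ w ‖
    0≤c = +-nonneg (0≤‖z‖ z) (0≤‖z‖ w)
    M : ℕ
    M = proj₁ (tail-index 0≤c)
    open Tail 0≤c M (proj₂ (tail-index 0≤c))
    c : Carrier
    c = ‖ z ‖ ℝ.+ ‖ w ‖
    ⋆≈e : ∀ k → (e z ⋆ e w) k ≈ e (z + w) k
    -- Both sequences start with 1 and solve f′ = (z + w) f.
    ⋆≈e = ℂ-Sums.isExpSeq-unique ·ℂ-cancel C.refl
      (ℂ-Sums.⋆-isExpSeq (e-isExpSeq z) (e-isExpSeq w)) (e-isExpSeq (z + w))
    ⋆≈ê : ∀ k → (ê ‖ z ‖ ⋆ᴿ ê ‖ w ‖) k ℝ.≈ ê c k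
    ⋆≈ê = ℝ-Sums.isExpSeq-unique ·ℝ-cancel refl
      (ℝ-Sums.⋆-isExpSeq (ê-isExpSeq ‖ z ‖) (ê-isExpSeq ‖ w ‖)) (ê-isExpSeq c)
    bound : ∀ m → M ℕ.≤ m → ‖ ∑ (e (z + w)) m - ∑ (e z) m * ∑ (e w) m - 0ℂ ‖ ≤ ê c m ℝ.+ ê c m
    bound m M≤m = begin
      ‖ ∑ (e (z + w)) m - ∑ (e z) m * ∑ (e w) m - 0ℂ ‖
        ≈⟨ ‖‖-cong (solve 2 (λ x y → x :- y :- con (+ 0) := x :- y) C.refl (∑ (e (z + w)) m) (∑ (e z) m * ∑ (e w) m)) ⟩
      ‖ ∑ (e (z + w)) m - ∑ (e z) m * ∑ (e w) m ‖
        ≈⟨ ‖z-w‖-comm _ _ ⟩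
      ‖ ∑ (e z) m * ∑ (e w) m - ∑ (e (z + w)) m ‖
        ≈⟨ ‖‖-cong (C.+-congˡ (C.-‿cong (∑-cong m (λ k _ → ⋆≈e k)))) ⟨
      ‖ ∑ (e z) m * ∑ (e w) m - ∑ (e z ⋆ e w) m ‖
        ≤⟨ ≡.subst (λ j → ‖ ∑ (e z) m * ∑ (e w) j - ∑ (e z ⋆ e w) m ‖ ≤
              ∑ᴿ (ê ‖ z ‖) m ℝ.* ∑ᴿ (ê ‖ w ‖) j ℝ.- ∑ᴿ (ê ‖ z ‖ ⋆ᴿ ê ‖ w ‖) m)
             (ℕ.+-identityʳ m) (rectangle-minus-triangle (‖e‖≤ê z) (‖e‖≤ê w) m 0) ⟩
      ∑ᴿ (ê ‖ z ‖) m ℝ.* ∑ᴿ (ê ‖ w ‖) m ℝ.- ∑ᴿ (ê ‖ z ‖ ⋆ᴿ ê ‖ w ‖) m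
        ≤⟨ +-mono-≤ (rectangle≤triangle (ê-nonneg (0≤‖z‖ z)) (ê-nonneg (0≤‖z‖ w)) m m) ≤-refl ⟩
      ∑ᴿ (ê ‖ z ‖ ⋆ᴿ ê ‖ w ‖) (m ℕ.+ m) ℝ.- ∑ᴿ (ê ‖ z ‖ ⋆ᴿ ê ‖ w ‖) m
        ≈⟨ +-cong (ℝ-Sums.∑-cong (m ℕ.+ m) (λ k _ → ⋆≈ê k)) (-‿cong (ℝ-Sums.∑-cong m (λ k _ → ⋆≈ê k))) ⟩
      ∑ᴿ (ê c) (m ℕ.+ m) ℝ.- ∑ᴿ (ê c) m
        ≤⟨ ∑ê-tail m M≤m m ⟩
      ê c m ℝ.+ ê c m ∎
      where open ≤-Reasoning

-- e^{ix}: existence, addition formula, and estimates for sin.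

module Trigonometry (ℝ : CompleteOrderedField) where
  open ComplexNumbers ℝ
  open Exponential ℝ

  ∣x∣≤⇒ : ∀ {x b} → ∣ x ∣ ≤ b → ℝ.- b ≤ x
  ∣x∣≤⇒ {x} {b} ∣x∣≤b = ≤-by (diff-nonneg (≤-trans (-x≤∣x∣ x) ∣x∣≤b))
    (solve 2 (λ x b → x := :- b :+ (b :- :- x)) refl x b)
    where open ℝ-Solver

  -- The intervals from s i - 2 β i to s i + 2 β i are nested: the centre moves by at most β i, and
  -- the radius shrinks by at least β i.
  halving-limit : (s β : ℕ → Carrier) → (∀ i → ∣ s (suc i) ℝ.- s i ∣ ≤ β i) →
                  (∀ i → 0# ≤ β i) → (∀ i → β (suc i) ℝ.+ β (suc i) ≤ β i) →
                  ∃[ l ] (∀ i → ∣ s i ℝ.- l ∣ ≤ β i ℝ.+ β i)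
  halving-limit s β step 0≤β halves = proj₁ nested , λ i → let a≤l , l≤b = proj₂ nested i in
    ∣∣-least (≤-by (diff-nonneg a≤l) (solve 3 (λ s b l → b :+ b := s :- l :+ (l :- (s :- (b :+ b)))) refl (s i) (β i) _))
             (≤-by (diff-nonneg l≤b) (solve 3 (λ s b l → b :+ b := :- (s :- l) :+ (s :+ (b :+ b) :- l)) refl (s i) (β i) _))
    where
    open ℝ-Solver
    nested : ∃[ l ] (∀ i → s i ℝ.- (β i ℝ.+ β i) ≤ l × l ≤ s i ℝ.+ (β i ℝ.+ β i))
    nested = nested-intervals _ _
      (λ i → ≤-by (+-nonneg (diff-nonneg (∣x∣≤⇒ (step i))) (diff-nonneg (halves i)))
        (solve 4 (λ s t b c → t :- (c :+ c) := s :- (b :+ b) :+ ((t :- s :- :- b) :+ (b :- (c :+ c)))) refl (s i) (s (suc i)) (β i) (β (suc i))))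
      (λ i → ≤-by (+-nonneg (diff-nonneg (≤-trans (x≤∣x∣ _) (step i))) (diff-nonneg (halves i)))
        (solve 4 (λ s t b c → s :+ (b :+ b) := t :+ (c :+ c) :+ ((b :- (t :- s)) :+ (b :- (c :+ c)))) refl (s i) (s (suc i)) (β i) (β (suc i))))
      (λ i → ≤-by (+-nonneg (+-nonneg (0≤β i) (0≤β i)) (+-nonneg (0≤β i) (0≤β i)))
        (solve 2 (λ s b → s :+ (b :+ b) := s :- (b :+ b) :+ (b :+ b :+ (b :+ b))) refl (s i) (β i)))

  ∣re∣≤‖‖ : ∀ z → ∣ re z ∣ ≤ ‖ z ‖
  ∣re∣≤‖‖ z = ≤-by (0≤∣x∣ (im z)) refl

  ∣im∣≤‖‖ : ∀ z → ∣ im z ∣ ≤ ‖ z ‖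
  ∣im∣≤‖‖ z = ≤-by (0≤∣x∣ (re z)) (+-comm _ _)

  abstract
    -- Real and imaginary part are halving limits with error 2β each, hence 4β in the 1-norm. The
    -- index `M` is left free so that cutting the series after one or two terms gives explicit
    -- estimates near 0.
    exp-converges-from : ∀ z M → ‖ z ‖ ℝ.+ ‖ z ‖ ≤ fromℕ (suc M) → let β = ê ‖ z ‖ M in
      ∃[ w ] (∑ (e z) ⟶ w × ‖ ∑ (e z) M - w ‖ ≤ (β ℝ.+ β) ℝ.+ (β ℝ.+ β))
    exp-converges-from z M 2c≤M+1 = w
      , Null-≤ M (λ m M≤m → ≡.subst (λ k → ‖ ∑ (e z) k - w ‖ ≤ (ê c k ℝ.+ ê c k) ℝ.+ (ê c k ℝ.+ ê c k)) (ℕ.m∸n+n≡m M≤m) (close (m ℕ.∸ M)))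
          (Null-+ (Null-+ ê-null ê-null) (Null-+ ê-null ê-null))
      , close 0
      where
      open ℂ-Solver
      c : Carrier
      c = ‖ z ‖
      open Tail (0≤‖z‖ z) M 2c≤M+1
      step : ∀ i → ‖ ∑ (e z) (suc (i ℕ.+ M)) - ∑ (e z) (i ℕ.+ M) ‖ ≤ ê c (i ℕ.+ M)
      step i = ≤-trans (≤-reflexive (‖‖-cong (C.trans (C.+-congʳ (∑-last (e z) (i ℕ.+ M)))
        (solve 2 (λ s x → s :+ x :- s := x) C.refl (∑ (e z) (i ℕ.+ M)) (e z (i ℕ.+ M)))))) (‖e‖≤ê z (i ℕ.+ M))
      0≤β : ∀ i → 0# ≤ ê c (i ℕ.+ M)
      0≤β i = ê-nonneg (0≤‖z‖ z) (i ℕ.+ M)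
      β-halves : ∀ i → ê c (suc i ℕ.+ M) ℝ.+ ê c (suc i ℕ.+ M) ≤ ê c (i ℕ.+ M)
      β-halves i = halves (i ℕ.+ M) (ℕ.m≤n+m M i)
      re-limit : ∃[ l ] (∀ i → ∣ re (∑ (e z) (i ℕ.+ M)) ℝ.- l ∣ ≤ ê c (i ℕ.+ M) ℝ.+ ê c (i ℕ.+ M))
      re-limit = halving-limit _ _ (λ i → ≤-trans (∣re∣≤‖‖ _) (step i)) 0≤β β-halves
      im-limit : ∃[ l ] (∀ i → ∣ im (∑ (e z) (i ℕ.+ M)) ℝ.- l ∣ ≤ ê c (i ℕ.+ M) ℝ.+ ê c (i ℕ.+ M))
      im-limit = halving-limit _ _ (λ i → ≤-trans (∣im∣≤‖‖ _) (step i)) 0≤β β-halves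
      w : ℂ
      w = proj₁ re-limit +i proj₁ im-limit
      close : ∀ i → ‖ ∑ (e z) (i ℕ.+ M) - w ‖ ≤ (ê c (i ℕ.+ M) ℝ.+ ê c (i ℕ.+ M)) ℝ.+ (ê c (i ℕ.+ M) ℝ.+ ê c (i ℕ.+ M))
      close i = +-mono-≤ (proj₂ re-limit i) (proj₂ im-limit i)

  e-cong : ∀ {z w} → z ≈ w → ∀ k → e z k ≈ e w k
  e-cong z≈w = ℂ-Sums.isExpSeq-unique ·ℂ-cancel z≈w (e-isExpSeq _) (e-isExpSeq _)

  exp-cong : ∀ {z z′ w} → z ≈ z′ → ∑ (e z) ⟶ w → ∑ (e z′) ⟶ w
  exp-cong z≈z′ = ⟶-cong 0 (λ m _ → ∑-cong m (λ k _ → e-cong z≈z′ k)) C.refl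

  exp-unique : ∀ {z z′ w w′} → z ≈ z′ → ∑ (e z) ⟶ w → ∑ (e z′) ⟶ w′ → w ≈ w′
  exp-unique z≈z′ z→w z′→w′ = ⟶-unique (exp-cong z≈z′ z→w) z′→w′

  abstract
    exp-exists : ∀ z → ∃[ w ] ∑ (e z) ⟶ w
    exp-exists z =
      let M , 2c≤M+1 = tail-index (+-nonneg (0≤∣x∣ (re z)) (0≤∣x∣ (im z)))
          w , z→w , _ = exp-converges-from z M 2c≤M+1
      in w , z→w

  i[_] : Carrier → ℂ
  i[ x ] = 0# +i x

  i[]-+ : ∀ x y → i[ x ] + i[ y ] ≈ i[ x ℝ.+ y ]
  i[]-+ x y = +-identityˡ _ , refl

  -- The statement speaks of the exponential as a relation; this fixes a value of it at each point
  -- of the imaginary axis.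
  cis : Carrier → ℂ
  cis x = proj₁ (exp-exists i[ x ])

  cis-spec : ∀ x → ∑ (e i[ x ]) ⟶ cis x
  cis-spec x = proj₂ (exp-exists i[ x ])

  sin : Carrier → Carrier
  sin x = im (cis x)

  cis-cong : ∀ {x y} → x ℝ.≈ y → cis x ≈ cis y
  cis-cong {x} {y} x≈y = exp-unique {i[ x ]} {i[ y ]} (refl , x≈y) (cis-spec x) (cis-spec y)

  cis-+ : ∀ x y → cis (x ℝ.+ y) ≈ cis x * cis y
  cis-+ x y = exp-unique (C.sym (i[]-+ x y)) (cis-spec (x ℝ.+ y)) (exp-+ (cis-spec x) (cis-spec y))

  conj : ℂ → ℂ
  conj z = re z +i (ℝ.- im z)

  conj-* : ∀ z w → conj (z * w) ≈ conj z * conj w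
  conj-* z w =
    solve 4 (λ a b c d → a :* c :- b :* d := a :* c :- :- b :* :- d) refl _ _ _ _ ,
    solve 4 (λ a b c d → :- (a :* d :+ b :* c) := a :* :- d :+ :- b :* c) refl _ _ _ _
    where open ℝ-Solver

  -0≈0 : ℝ.- 0# ℝ.≈ 0#
  -0≈0 = solve 0 (:- con (+ 0) := con (+ 0)) refl
    where open ℝ-Solver

  conj-^ : ∀ z k → conj (z ^ k) ≈ conj z ^ k
  conj-^ z zero    = refl , -0≈0
  conj-^ z (suc k) = C.trans (conj-* z (z ^ k)) (C.*-congˡ (conj-^ z k))

  conj-∑ : ∀ a m → conj (∑ a m) ≈ ∑ (conj ∘ a) m
  conj-∑ a zero    = refl , -0≈0
  conj-∑ a (suc m) = C.trans
    (refl , solve 2 (λ x y → :- (x :+ y) := :- x :+ :- y) refl _ _) (C.+-congˡ (conj-∑ (a ∘ suc) m))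
    where open ℝ-Solver

  -- The coefficients 1/k! are real, so conjugation passes through every partial sum, and it
  -- preserves the 1-norm.
  exp-conj : ∀ {z w} → ∑ (e z) ⟶ w → ∑ (e (conj z)) ⟶ conj w
  exp-conj {z} {w} z→w = Null-≤ 0 (λ m _ → ≤-reflexive (begin-equality
    ‖ ∑ (e (conj z)) m - conj w ‖ ≈⟨ ‖‖-cong (C.+-congʳ (∑-cong m (λ k _ → conj-e k))) ⟨
    ‖ ∑ (conj ∘ e z) m - conj w ‖ ≈⟨ ‖‖-cong (C.+-congʳ (conj-∑ (e z) m)) ⟨
    ‖ conj (∑ (e z) m) - conj w ‖ ≈⟨ +-congˡ (∣∣-cong (solve 2 (λ x y → :- x :- :- y := :- (x :- y)) refl _ _)) ⟩
    ‖ conj (∑ (e z) m - w) ‖ ≈⟨ +-congˡ (∣-x∣ _) ⟩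
    ‖ ∑ (e z) m - w ‖ ∎)) z→w
    where
    open ≤-Reasoning
    open ℝ-Solver
    conj-e : ∀ k → conj (e z k) ≈ e (conj z) k
    conj-e k = C.trans (refl , solve 2 (λ x y → :- (x :* y) := x :* :- y) refl _ _) (•-cong refl (conj-^ z k))

  cis-neg : ∀ x → cis (ℝ.- x) ≈ conj (cis x)
  cis-neg x = exp-unique C.refl (cis-spec (ℝ.- x)) (exp-conj (cis-spec x))

  ‖ix‖ : ∀ x → ‖ i[ x ] ‖ ℝ.≈ ∣ x ∣
  ‖ix‖ x = trans (+-congʳ ∣0∣) (+-identityˡ _)

  ê-one : ∀ c → ê c 1 ℝ.≈ c
  ê-one c = trans (*-cong !⁻¹-zero (*-identityʳ c)) (*-identityˡ c)

  ê-two : ∀ c → ê c 2 ℝ.+ ê c 2 ℝ.≈ c ℝ.* c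
  ê-two c = trans (solve 1 (λ x → x :+ x := x :+ (x :+ con (+ 0))) refl (ê c 2))
    (trans (proj₂ (ê-isExpSeq c) 1) (*-congˡ (ê-one c)))
    where open ℝ-Solver

  e-zero : ∀ z → e z 0 ≈ 1ℂ
  e-zero z = proj₁ (e-isExpSeq z)

  e-one : ∀ z → e z 1 ≈ z
  e-one z = C.trans (•-cong !⁻¹-zero (C.*-identityʳ z)) (*-identityˡ _ , *-identityˡ _)

  4# : Carrier
  4# = 2# ℝ.* 2#

  -- The series is cut after its constant term: the error is at most four times the size |x| of the
  -- next term, and |x| ≤ 1 makes the terms halve from there on.
  ‖cis-1‖≤4∣x∣ : ∀ {x} → ∣ x ∣ ≤ 1# → ‖ cis x - 1ℂ ‖ ≤ 4# ℝ.* ∣ x ∣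
  ‖cis-1‖≤4∣x∣ {x} ∣x∣≤1 = begin
    ‖ cis x - 1ℂ ‖ ≈⟨ ‖z-w‖-comm _ _ ⟩
    ‖ 1ℂ - cis x ‖ ≈⟨ ‖‖-cong (C.+-cong (C.trans (C.+-identityʳ (e i[ x ] 0)) (e-zero i[ x ]))
                                              (C.-‿cong (⟶-unique z→w (cis-spec x)))) ⟨
    ‖ ∑ (e i[ x ]) 1 - w ‖ ≤⟨ close ⟩
    (ê c 1 ℝ.+ ê c 1) ℝ.+ (ê c 1 ℝ.+ ê c 1) ≈⟨ +-cong (+-cong ê≈∣x∣ ê≈∣x∣) (+-cong ê≈∣x∣ ê≈∣x∣) ⟩
    (∣ x ∣ ℝ.+ ∣ x ∣) ℝ.+ (∣ x ∣ ℝ.+ ∣ x ∣) ≈⟨ solve 1 (λ x → (x :+ x) :+ (x :+ x) := con (+ 2) :* con (+ 2) :* x) refl ∣ x ∣ ⟩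
    4# ℝ.* ∣ x ∣ ∎
    where
    open ≤-Reasoning
    open ℝ-Solver
    c : Carrier
    c = ‖ i[ x ] ‖
    approximation = exp-converges-from i[ x ] 1
      (+-mono-≤ (≤-trans (≤-reflexive (‖ix‖ x)) ∣x∣≤1) (≤-trans (≤-reflexive (‖ix‖ x)) (≤-trans ∣x∣≤1 (≤-reflexive (sym (+-identityʳ _))))))
    w = proj₁ approximation
    z→w = proj₁ (proj₂ approximation)
    close = proj₂ (proj₂ approximation)
    ê≈∣x∣ : ê c 1 ℝ.≈ ∣ x ∣
    ê≈∣x∣ = trans (ê-one c) (‖ix‖ x)

  cis0≈1 : cis 0# ≈ 1ℂ
  cis0≈1 = begin
    cis 0# ≈⟨ solve 2 (λ z w → z := z :- w :+ w) C.refl (cis 0#) 1ℂ ⟩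
    cis 0# - 1ℂ + 1ℂ ≈⟨ C.+-congʳ (‖z‖≤0⇒z≈0 (≤-trans (‖cis-1‖≤4∣x∣ (≤-trans (≤-reflexive ∣0∣) 0≤1))
                                 (≤-reflexive (trans (*-congˡ ∣0∣) (zeroʳ _))))) ⟩
    0ℂ + 1ℂ ≈⟨ C.+-identityˡ 1ℂ ⟩
    1ℂ ∎
    where
    open ≈-Reasoning
    open ℂ-Solver

  z*conj : ∀ z → z * conj z ≈ ι ∣ z ∣²
  z*conj z =
    solve 2 (λ a b → a :* a :- b :* :- b := a :* a :+ b :* b) refl _ _ ,
    solve 2 (λ a b → a :* :- b :+ b :* a := con (+ 0)) refl _ _
    where open ℝ-Solver

  ∣cis∣²≈1 : ∀ x → ∣ cis x ∣² ℝ.≈ 1#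
  ∣cis∣²≈1 x = proj₁ (begin
    ι ∣ cis x ∣² ≈⟨ z*conj (cis x) ⟨
    cis x * conj (cis x) ≈⟨ C.*-congˡ (cis-neg x) ⟨
    cis x * cis (ℝ.- x) ≈⟨ cis-+ x (ℝ.- x) ⟨
    cis (x ℝ.- x) ≈⟨ cis-cong (ℝ.-‿inverseʳ x) ⟩
    cis 0# ≈⟨ cis0≈1 ⟩
    1ℂ ∎)
    where open ≈-Reasoning

  ∣z∣²≈1⇒‖z‖≤2 : ∀ {z} → ∣ z ∣² ℝ.≈ 1# → ‖ z ‖ ≤ 2#
  ∣z∣²≈1⇒‖z‖≤2 {z} ∣z∣≈1 = +-mono-≤
    (part (≤-trans (≤-by (square-nonneg (im z)) refl) (≤-reflexive ∣z∣≈1)))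
    (part (≤-trans (≤-by (square-nonneg (re z)) (+-comm _ _)) (≤-reflexive ∣z∣≈1)))
    where
    open ℝ-Solver
    part : ∀ {x} → x ℝ.* x ≤ 1# → ∣ x ∣ ≤ 1#
    part {x} xx≤1 with ≤-or-> ∣ x ∣ 1#
    ... | inj₁ ∣x∣≤1 = ∣x∣≤1
    ... | inj₂ 1<∣x∣ = contradiction xx≤1 (<⇒≱ (<-respʳ (∣x∣²≈x² x) (<-≤-trans 1<∣x∣
            (≤-trans (≤-reflexive (sym (*-identityˡ _))) (*-monoʳ-≤ (0≤∣x∣ x) (<⇒≤ 1<∣x∣))))))

  -- By the addition formula e^{it} - e^{is} = e^{is} (e^{i(t-s)} - 1). The constant 8 is the bound
  -- 2 for the 1-norm of e^{is} times the 4 of `‖cis-1‖≤4∣x∣`.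
  sin-lipschitz : ∀ s t → ∣ t ℝ.- s ∣ ≤ 1# → ∣ sin t ℝ.- sin s ∣ ≤ 2# ℝ.* 4# ℝ.* ∣ t ℝ.- s ∣
  sin-lipschitz s t h≤1 = begin
    ∣ sin t ℝ.- sin s ∣
      ≤⟨ ∣im∣≤‖‖ (cis t - cis s) ⟩
    ‖ cis t - cis s ‖
      ≈⟨ ‖‖-cong (C.+-congʳ (C.trans (cis-cong (ℝ-Solver.solve 2 (λ s t → let open ℝ-Solver in t := s :+ (t :- s)) refl s t)) (cis-+ s (t ℝ.- s)))) ⟩
    ‖ cis s * cis (t ℝ.- s) - cis s ‖
      ≈⟨ ‖‖-cong (ℂ-Solver.solve 2 (λ z w → let open ℂ-Solver in z :* w :- z := z :* (w :- con (+ 1))) C.refl (cis s) (cis (t ℝ.- s))) ⟩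
    ‖ cis s * (cis (t ℝ.- s) - 1ℂ) ‖
      ≤⟨ ‖z*w‖≤‖z‖*‖w‖ _ _ ⟩
    ‖ cis s ‖ ℝ.* ‖ cis (t ℝ.- s) - 1ℂ ‖
      ≤⟨ *-mono-≤ (0≤‖z‖ _) (*-nonNeg (square-nonneg 2#) (0≤∣x∣ _)) (∣z∣²≈1⇒‖z‖≤2 (∣cis∣²≈1 s)) (‖cis-1‖≤4∣x∣ h≤1) ⟩
    2# ℝ.* (4# ℝ.* ∣ t ℝ.- s ∣)
      ≈⟨ *-assoc _ _ _ ⟨
    2# ℝ.* 4# ℝ.* ∣ t ℝ.- s ∣ ∎
    where open ≤-Reasoning

  ½≤1 : ½ ≤ 1#
  ½≤1 = ≤-by (<⇒≤ 0<½) (trans (sym (½+½ 1#)) (+-cong (*-identityʳ ½) (*-identityʳ ½)))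

  -- sin x ≥ x - 2 x², by cutting the series of e^{ix} after the linear term.
  sin-pos-small : ∀ {x} → 0# < x → x < ½ → 0# < sin x
  sin-pos-small {x} 0<x x<½ = <-≤-trans 0<x[1-2x]
    (≤-by (diff-nonneg bound) (solve 2 (λ x s → s := x :* (con (+ 1) :- con (+ 2) :* x) :+ (x :* x :+ x :* x :- (x :- s))) refl x (sin x)))
    where
    open ℝ-Solver
    c : Carrier
    c = ‖ i[ x ] ‖
    c≈x : c ℝ.≈ x
    c≈x = trans (‖ix‖ x) (nonneg⇒∣x∣≈x (<⇒≤ 0<x))
    c≤1 : c ≤ 1#
    c≤1 = ≤-trans (≤-reflexive c≈x) (≤-trans (<⇒≤ x<½) ½≤1)
    0<x[1-2x] : 0# < x ℝ.* (1# ℝ.- 2# ℝ.* x)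
    0<x[1-2x] = *-pos 0<x (<-respʳ
      (trans (solve 3 (λ x h o → con (+ 2) :* (h :- x) := con (+ 2) :* h :- con (+ 2) :* x) refl x ½ 1#) (+-congʳ (⁻¹-inverse 0<2)))
      (*-pos 0<2 (diff-pos x<½)))
    approximation = exp-converges-from i[ x ] 2 (+-mono-≤ c≤1
      (≤-trans c≤1 (≤-by (+-nonneg 0≤1 ≤-refl) refl)))
    w = proj₁ approximation
    z→w = proj₁ (proj₂ approximation)
    close = proj₂ (proj₂ approximation)
    bound : x ℝ.- sin x ≤ x ℝ.* x ℝ.+ x ℝ.* x
    bound = begin
      x ℝ.- sin x
        ≈⟨ +-cong (trans (solve 1 (λ x → x := con (+ 0) :+ (x :+ con (+ 0))) refl x)
              (sym (+-cong (proj₂ (e-zero i[ x ])) (+-congʳ (proj₂ (e-one i[ x ]))))))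
            (-‿cong (sym (proj₂ (⟶-unique z→w (cis-spec x))))) ⟩
      im (∑ (e i[ x ]) 2 - w)
        ≤⟨ ≤-trans (x≤∣x∣ _) (∣im∣≤‖‖ _) ⟩
      ‖ ∑ (e i[ x ]) 2 - w ‖
        ≤⟨ close ⟩
      (ê c 2 ℝ.+ ê c 2) ℝ.+ (ê c 2 ℝ.+ ê c 2)
        ≈⟨ +-cong (ê-two c) (ê-two c) ⟩
      c ℝ.* c ℝ.+ c ℝ.* c
        ≈⟨ +-cong (*-cong c≈x c≈x) (*-cong c≈x c≈x) ⟩
      x ℝ.* x ℝ.+ x ℝ.* x ∎
      where open ≤-Reasoning

-- Positivity of sin on (0, π), and the roots e^{iπ/N} of -1.

module RootsOfUnity (ℝ : CompleteOrderedField) where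
  open ComplexNumbers ℝ
  open Exponential ℝ
  open Trigonometry ℝ

  -- The choice h = ε / (K + ε) meets both upper bounds at once.
  small-step : ∀ {K ε} → 0# < K → 0# < ε → ∃[ h ] (0# < h × h ≤ 1# × K ℝ.* h < ε)
  small-step {K} {ε} 0<K 0<ε = h , 0<h
    , *-cancel-≤ 0<K+ε (≤-by (<⇒≤ 0<K) (sym (trans (+-congʳ [K+ε]h≈ε) (solve 2 (λ k e → e :+ k := (k :+ e) :* con (+ 1)) refl K ε))))
    , <-by (*-pos 0<ε 0<h) (trans (sym [K+ε]h≈ε) (distribʳ h K ε))
    where
    open ℝ-Solver
    0<K+ε : 0# < K ℝ.+ ε
    0<K+ε = +-pos-nonneg 0<K (<⇒≤ 0<ε)
    h : Carrier
    h = (K ℝ.+ ε) ℝ.⁻¹ ℝ.* ε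
    0<h : 0# < h
    0<h = *-pos (⁻¹-pos 0<K+ε) 0<ε
    [K+ε]h≈ε : (K ℝ.+ ε) ℝ.* h ℝ.≈ ε
    [K+ε]h≈ε = trans (sym (*-assoc _ _ _)) (trans (*-congʳ (⁻¹-inverse 0<K+ε)) (*-identityˡ ε))

  8# : Carrier
  8# = 2# ℝ.* 4#

  0<8 : 0# < 8#
  0<8 = *-pos 0<2 (*-pos 0<2 0<2)

  sin-near : ∀ s t {h} → h ≤ 1# → ∣ t ℝ.- s ∣ ≤ h → ∣ sin t ℝ.- sin s ∣ ≤ 8# ℝ.* h
  sin-near s t h≤1 t≈s = ≤-trans (sin-lipschitz s t (≤-trans t≈s h≤1)) (*-monoˡ-≤ (<⇒≤ 0<8) t≈s)

  sin-near-pos : ∀ s t {h} → h ≤ 1# → ∣ t ℝ.- s ∣ ≤ h → 8# ℝ.* h < sin s → 0# < sin t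
  sin-near-pos s t {h} h≤1 t≈s 8h<sin = <-≤-trans (diff-pos 8h<sin)
    (≤-by (diff-nonneg (∣x∣≤⇒ (sin-near s t h≤1 t≈s)))
      (solve 3 (λ a b k → a := b :- k :+ (a :- b :- :- k)) refl (sin t) (sin s) (8# ℝ.* h)))
    where open ℝ-Solver

  sin-near-neg : ∀ s t {h} → h ≤ 1# → ∣ t ℝ.- s ∣ ≤ h → 8# ℝ.* h < ℝ.- sin s → sin t < 0#
  sin-near-neg s t {h} h≤1 t≈s 8h<-sin = ≤-<-trans
    (≤-by (diff-nonneg (≤-trans (x≤∣x∣ _) (sin-near s t h≤1 t≈s)))
      (solve 3 (λ a b k → b :+ k := a :+ (k :- (a :- b))) refl (sin t) (sin s) (8# ℝ.* h)))
    (<-by (diff-pos 8h<-sin) (solve 2 (λ b k → con (+ 0) := b :+ k :+ (:- b :- k)) refl (sin s) (8# ℝ.* h)))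
    where open ℝ-Solver

  -- If sin were ≤ 0 at x₀, the last point of [0, x₀] where sin ≥ 0 would be a zero of sin in (0, π).
  module _ {π} (sin≉0 : ∀ x → 0# < x → x < π → ¬ (sin x ℝ.≈ 0#))
           {x₀} (0<x₀ : 0# < x₀) (x₀<π : x₀ < π) (sin≤0 : sin x₀ ≤ 0#) where
    private
      Nonneg : Carrier → Set
      Nonneg t = 0# ≤ t × t ≤ x₀ × 0# ≤ sin t

      0∈Nonneg : Nonneg 0#
      0∈Nonneg = ≤-refl , <⇒≤ 0<x₀ , ≤-reflexive (sym (proj₂ cis0≈1))

    module _ {s} (upper : ∀ {t} → Nonneg t → t ≤ s) (approx : ∀ {y} → y < s → ∃[ t ] (Nonneg t × y < t)) where
      0≤s : 0# ≤ s
      0≤s = upper 0∈Nonneg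

      s≤x₀ : s ≤ x₀
      s≤x₀ with ≤-or-> s x₀
      ... | inj₁ s≤x₀ = s≤x₀
      ... | inj₂ x₀<s with approx x₀<s
      ...   | _ , (_ , t≤x₀ , _) , x₀<t = contradiction t≤x₀ (<⇒≱ x₀<t)

      ¼ : Carrier
      ¼ = ½ ℝ.* ½

      0<¼ : 0# < ¼
      0<¼ = *-pos 0<½ 0<½

      ¼<½ : ¼ < ½
      ¼<½ = <-by 0<¼ (sym (½+½ ½))

      -- The initial stretch where sin is positive keeps the supremum away from 0: either `x₀`
      -- belongs to it, contradicting sin x₀ ≤ 0, or it contributes the point ¼.
      0<s : 0# < s
      0<s with ≤-or-> ½ x₀
      ... | inj₂ x₀<½ = contradiction sin≤0 (<⇒≱ (sin-pos-small 0<x₀ x₀<½))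
      ... | inj₁ ½≤x₀ = <-≤-trans 0<¼ (upper (<⇒≤ 0<¼ , ≤-trans (<⇒≤ ¼<½) ½≤x₀ , <⇒≤ (sin-pos-small 0<¼ ¼<½)))

      near-above : ∀ {a b h} → a ≤ b → b ≤ a ℝ.+ h → ∣ b ℝ.- a ∣ ≤ h
      near-above {a} {b} {h} a≤b b≤a+h = ∣∣-least
        (≤-by (diff-nonneg b≤a+h) (solve 3 (λ a b h → h := b :- a :+ (a :+ h :- b)) refl a b h))
        (≤-by (+-nonneg (+-nonneg (diff-nonneg a≤b) (diff-nonneg a≤b)) (diff-nonneg b≤a+h))
          (solve 3 (λ a b h → h := :- (b :- a) :+ (b :- a :+ (b :- a) :+ (a :+ h :- b))) refl a b h))
        where open ℝ-Solver

      -- sin stays positive up to s + h. If s + h ≤ x₀, this point contradicts the upper bound;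
      -- otherwise `x₀` lies within h of s and sin x₀ would be positive.
      positive-impossible : ¬ (0# < sin s)
      positive-impossible 0<sin = from-step (small-step 0<8 0<sin)
        where
        from-step : ¬ (∃[ h ] (0# < h × h ≤ 1# × 8# ℝ.* h < sin s))
        from-step (h , 0<h , h≤1 , 8h<sin) with ≤-or-> (s ℝ.+ h) x₀
        ... | inj₁ s+h≤x₀ = <⇒≱ (<-by 0<h refl) (upper
                ( +-nonneg 0≤s (<⇒≤ 0<h) , s+h≤x₀
                , <⇒≤ (sin-near-pos s (s ℝ.+ h) h≤1 (near-above (≤-by (<⇒≤ 0<h) refl) ≤-refl) 8h<sin)))
        ... | inj₂ x₀<s+h = <⇒≱ (sin-near-pos s x₀ h≤1 (near-above s≤x₀ (<⇒≤ x₀<s+h)) 8h<sin) sin≤0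

      -- sin is then negative within h of s, whereas the supremum is approximated that closely by
      -- points with sin ≥ 0.
      negative-impossible : ¬ (sin s < 0#)
      negative-impossible sin<0 = from-step (small-step 0<8 (neg-pos sin<0))
        where
        open ℝ-Solver
        from-step : ¬ (∃[ h ] (0# < h × h ≤ 1# × 8# ℝ.* h < ℝ.- sin s))
        from-step (h , 0<h , h≤1 , 8h<-sin) = from-point (approx (<-by 0<h (solve 2 (λ s h → s := s :- h :+ h) refl s h)))
          where
          from-point : ¬ (∃[ t ] (Nonneg t × s ℝ.- h < t))
          from-point (t , t∈ , s-h<t) = <⇒≱
            (sin-near-neg s t h≤1 (≤-trans (≤-reflexive ∣t-s∣≈∣s-t∣) (near-above (upper t∈)
              (≤-by (diff-nonneg (<⇒≤ s-h<t)) (solve 3 (λ s h t → t :+ h := s :+ (t :- (s :- h))) refl s h t)))) 8h<-sin)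
            (proj₂ (proj₂ t∈))
            where
            ∣t-s∣≈∣s-t∣ : ∣ t ℝ.- s ∣ ℝ.≈ ∣ s ℝ.- t ∣
            ∣t-s∣≈∣s-t∣ = trans (sym (∣-x∣ _)) (∣∣-cong (solve 2 (λ s t → :- (t :- s) := s :- t) refl s t))

      supremum-impossible : ⊥
      supremum-impossible with ≤-or-> (sin s) 0# | ≤-or-> 0# (sin s)
      ... | inj₂ 0<sin | _          = positive-impossible 0<sin
      ... | _          | inj₂ sin<0 = negative-impossible sin<0
      ... | inj₁ sin≤0 | inj₁ 0≤sin = sin≉0 s 0<s (≤-<-trans s≤x₀ x₀<π) (antisym sin≤0 0≤sin)

    sin-not-nonpositive : ⊥
    sin-not-nonpositive =
      let _ , upper , approx = ℝ.complete Nonneg (0# , 0∈Nonneg) (x₀ , λ (_ , t≤x₀ , _) → t≤x₀)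
      in supremum-impossible upper approx

  cis-^ : ∀ x k → cis x ^ k ≈ cis (fromℕ k ℝ.* x)
  cis-^ x zero    = C.sym (C.trans (cis-cong (zeroˡ x)) cis0≈1)
  cis-^ x (suc k) = C.trans (C.*-congˡ (cis-^ x k)) (C.trans (C.sym (cis-+ x (fromℕ k ℝ.* x)))
    (cis-cong (solve 2 (λ x k → x :+ k :* x := (con (+ 1) :+ k) :* x) refl x (fromℕ k))))
    where open ℝ-Solver

  module _ {π} (isPi : IsPi π) where
    private
      0<π : 0# < π
      0<π = proj₁ isPi

    sin≉0 : ∀ x → 0# < x → x < π → ¬ (sin x ℝ.≈ 0#)
    sin≉0 x 0<x x<π = proj₂ (proj₂ isPi) x (cis x) 0<x x<π (⟶⇒HasSum {e i[ x ]} {cis x} (cis-spec x))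

    sin-pos : ∀ {x} → 0# < x → x < π → 0# < sin x
    sin-pos {x} 0<x x<π with ≤-or-> (sin x) 0#
    ... | inj₂ 0<sin = 0<sin
    ... | inj₁ sin≤0 = ⊥-elim (sin-not-nonpositive sin≉0 0<x x<π sin≤0)

    sinπ≈0 : sin π ℝ.≈ 0#
    sinπ≈0 = let w , isExp , imw≈0 = proj₁ (proj₂ isPi) in
      trans (proj₂ (⟶-unique {∑ (e i[ π ])} {cis π} {w} (cis-spec π) (HasSum⇒⟶ {e i[ π ]} {w} isExp))) imw≈0

    -- With y = π/2: 0 = sin π = 2 sin y cos y and sin y ≠ 0 force cos y = 0, so e^{iπ} = (i sin y)² = -1.
    cisπ≈-1 : cis π ≈ - 1ℂ
    cisπ≈-1 = (begin-equality
      re (cis π) ≈⟨ proj₁ cisπ≈cisy² ⟩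
      cos ℝ.* cos ℝ.- sin y ℝ.* sin y ≈⟨ solve 2 (λ c s → c :* c :- s :* s := con (+ 2) :* (c :* c) :- (c :* c :+ s :* s)) refl cos (sin y) ⟩
      2# ℝ.* (cos ℝ.* cos) ℝ.- ∣ cis y ∣² ≈⟨ +-cong (*-congˡ (*-congˡ cos≈0)) (-‿cong (∣cis∣²≈1 y)) ⟩
      2# ℝ.* (cos ℝ.* 0#) ℝ.- 1# ≈⟨ solve 1 (λ c → con (+ 2) :* (c :* con (+ 0)) :- con (+ 1) := :- con (+ 1)) refl cos ⟩
      ℝ.- 1# ∎) , trans sinπ≈0 (sym -0≈0)
      where
      open ≤-Reasoning
      open ℝ-Solver
      y : Carrier
      y = ½ ℝ.* π
      cos : Carrier
      cos = re (cis y)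
      0<y : 0# < y
      0<y = *-pos 0<½ 0<π
      y<π : y < π
      y<π = <-by 0<y (sym (½+½ π))
      cisπ≈cisy² : cis π ≈ cis y * cis y
      cisπ≈cisy² = C.trans (cis-cong (sym (½+½ π))) (cis-+ y y)
      cos≈0 : cos ℝ.≈ 0#
      cos≈0 = *-cancel-0 (sin≉0 y 0<y y<π) (*-cancel-0 (pos⇒≉0 0<2) (begin-equality
        2# ℝ.* (sin y ℝ.* cos) ≈⟨ solve 2 (λ c s → con (+ 2) :* (s :* c) := c :* s :+ s :* c) refl cos (sin y) ⟩
        cos ℝ.* sin y ℝ.+ sin y ℝ.* cos ≈⟨ proj₂ cisπ≈cisy² ⟨
        sin π ≈⟨ sinπ≈0 ⟩
        0# ∎))

  -- Satisfied by ω = e^{iπ/N}.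
  record IsHalfTurnRoot (N : ℕ) (ω : ℂ) : Set where
    field
      ω^N≈-1 : ω ^ N ≈ - 1ℂ
      ∣ω∣²≈1 : ∣ ω ∣² ℝ.≈ 1#
      im-pos : ∀ k → 0 ℕ.< k → k ℕ.< N → 0# < im (ω ^ k)

  -- The imaginary part of the k-th power is sin (k x), and 0 < k x < N x = π.
  cis-isHalfTurnRoot : ∀ {π x} N → IsPi π → 0# < x → fromℕ N ℝ.* x ℝ.≈ π → IsHalfTurnRoot N (cis x)
  cis-isHalfTurnRoot {π} {x} N isPi 0<x Nx≈π = record
    { ω^N≈-1 = C.trans (cis-^ x N) (C.trans (cis-cong Nx≈π) (cisπ≈-1 isPi))
    ; ∣ω∣²≈1 = ∣cis∣²≈1 x
    ; im-pos = λ { (suc k) _ k<N → <-respʳ (sym (proj₂ (cis-^ x (suc k))))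
        (sin-pos isPi (*-pos (fromℕ-suc-pos k) 0<x) (<-≤-trans (<-by (*-pos 0<1 0<x)
            (solve 2 (λ x k → (con (+ 1) :+ k) :* x := k :* x :+ con (+ 1) :* x) refl x (fromℕ (suc k))))
          (≤-trans (*-monoʳ-≤ (<⇒≤ 0<x) (fromℕ-mono k<N)) (≤-reflexive Nx≈π)))) }
    }
    where open ℝ-Solver

  module _ {n ζ} .{{_ : ℕ.NonZero n}} (isExp : IsExp2πi/ n ζ) where
    private
      π : Carrier
      π = proj₁ isExp
      isPi : IsPi π
      isPi = proj₁ (proj₂ isExp)
      0<n : 0# < fromℕ n
      0<n = from-nonZero n
        where
        from-nonZero : ∀ n .{{_ : ℕ.NonZero n}} → 0# < fromℕ n
        from-nonZero (suc n) = fromℕ-suc-pos n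
      x y : Carrier
      x = fromℕ 2 ℝ.* π ℝ.* fromℕ n ℝ.⁻¹
      y = π ℝ.* fromℕ n ℝ.⁻¹
      0<y : 0# < y
      0<y = *-pos (proj₁ isPi) (⁻¹-pos 0<n)
      ζ≈cis : ζ ≈ cis x
      ζ≈cis = ⟶-unique {∑ (e i[ x ])} {ζ} {cis x} (HasSum⇒⟶ {e i[ x ]} {ζ} (proj₂ (proj₂ isExp))) (cis-spec x)
      nx≈2π : fromℕ n ℝ.* x ℝ.≈ fromℕ 2 ℝ.* π
      nx≈2π = trans (solve 3 (λ n t i → n :* (t :* i) := n :* i :* t) refl (fromℕ n) (fromℕ 2 ℝ.* π) (fromℕ n ℝ.⁻¹))
        (trans (*-congʳ (⁻¹-inverse 0<n)) (*-identityˡ _))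
        where open ℝ-Solver

    -- For n = 2m the number e^{2πi/n} = e^{iπ/m} is itself a half-turn root.
    root-even : ∀ m → n ≡.≡ 2 ℕ.* m → ∃[ ω ] (IsHalfTurnRoot m ω × ζ ≈ ω)
    root-even m n≡2m = cis x , cis-isHalfTurnRoot m isPi (*-pos (*-pos (fromℕ-suc-pos 1) (proj₁ isPi)) (⁻¹-pos 0<n)) mx≈π , ζ≈cis
      where
      open ≤-Reasoning
      mx≈π : fromℕ m ℝ.* x ℝ.≈ π
      mx≈π = *-cancelˡ (pos⇒≉0 (fromℕ-suc-pos 1)) (begin-equality
        fromℕ 2 ℝ.* (fromℕ m ℝ.* x) ≈⟨ *-assoc _ _ _ ⟨
        fromℕ 2 ℝ.* fromℕ m ℝ.* x ≈⟨ *-congʳ (×1-homo-* 2 m) ⟨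
        fromℕ (2 ℕ.* m) ℝ.* x ≡⟨ ≡.cong (λ k → fromℕ k ℝ.* x) n≡2m ⟨
        fromℕ n ℝ.* x ≈⟨ nx≈2π ⟩
        fromℕ 2 ℝ.* π ∎)

    -- The square root e^{iπ/n} of ζ. For odd n its powers carry the angular order of the
    -- generators; for every n it yields |ζ| = 1 and ζⁿ = (-1)² = 1.
    root-any : ∃[ ω ] (IsHalfTurnRoot n ω × ζ ≈ ω * ω)
    root-any = cis y
      , cis-isHalfTurnRoot n isPi 0<y (trans (solve 3 (λ n p i → n :* (p :* i) := n :* i :* p) refl (fromℕ n) π (fromℕ n ℝ.⁻¹))
          (trans (*-congʳ (⁻¹-inverse 0<n)) (*-identityˡ π)))
      , C.trans ζ≈cis (C.trans (cis-cong
          (solve 2 (λ p i → (con (+ 1) :+ (con (+ 1) :+ con (+ 0))) :* p :* i := p :* i :+ p :* i) refl π (fromℕ n ℝ.⁻¹))) (cis-+ y y))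
      where open ℝ-Solver

-- Convex hulls, and zonotopes of generators ordered by argument.

module ConvexHulls (ℝ : CompleteOrderedField) where
  open ComplexNumbers ℝ

  -- Hull Y s z: z is a nonnegative combination of points of Y with total weight s.
  data Hull (Y : Pred ℂ 0ℓ) : Carrier → ℂ → Set where
    empty : ∀ {s z} → s ℝ.≈ 0# → z ≈ 0ℂ → Hull Y s z
    add   : ∀ {s z s′ z′} t y → 0# ≤ t → y ∈ Y → Hull Y s z →
            s′ ℝ.≈ t ℝ.+ s → z′ ≈ t • y + z → Hull Y s′ z′

  Hull-resp : ∀ {Y s s′ z z′} → s ℝ.≈ s′ → z ≈ z′ → Hull Y s z → Hull Y s′ z′
  Hull-resp s≈ z≈ (empty s≈0 z≈0)       = empty (trans (sym s≈) s≈0) (C.trans (C.sym z≈) z≈0)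
  Hull-resp s≈ z≈ (add t y 0≤t y∈Y h p q) = add t y 0≤t y∈Y h (trans (sym s≈) p) (C.trans (C.sym z≈) q)

  Hull-point : ∀ {Y y} → y ∈ Y → Hull Y 1# y
  Hull-point {y = y} y∈Y = add 1# y 0≤1 y∈Y (empty refl C.refl) (sym (+-identityʳ _)) (unit (re y) , unit (im y))
    where
    open ℝ-Solver
    unit : ∀ x → x ℝ.≈ 1# ℝ.* x ℝ.+ 0#
    unit = solve 1 (λ x → x := con (+ 1) :* x :+ con (+ 0)) refl

  Hull-+ : ∀ {Y s s′ z z′} → Hull Y s z → Hull Y s′ z′ → Hull Y (s ℝ.+ s′) (z + z′)
  Hull-+ {s = s} {s′} {z} {z′} (empty s≈0 z≈0) h′ = Hull-resp
    (sym (trans (+-congʳ s≈0) (+-identityˡ s′))) (C.sym (C.trans (C.+-congʳ z≈0) (C.+-identityˡ z′))) h′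
  Hull-+ (add t y 0≤t y∈Y h p q) h′ = add t y 0≤t y∈Y (Hull-+ h h′)
    (trans (+-congʳ p) (+-assoc _ _ _)) (C.trans (C.+-congʳ q) (C.+-assoc _ _ _))

  Hull-scale : ∀ {Y a s z} → 0# ≤ a → Hull Y s z → Hull Y (a ℝ.* s) (a • z)
  Hull-scale {a = a} 0≤a (empty s≈0 (p , q)) = empty (trans (*-congˡ s≈0) (zeroʳ a))
    (trans (*-congˡ p) (zeroʳ a) , trans (*-congˡ q) (zeroʳ a))
  Hull-scale {a = a} 0≤a (add {z = z} t y 0≤t y∈Y h p (q , q′)) = add (a ℝ.* t) y (*-nonNeg 0≤a 0≤t) y∈Y (Hull-scale 0≤a h)
    (trans (*-congˡ p) (distribˡ _ _ _))
    (trans (*-congˡ q) (expand (re y) (re z)) , trans (*-congˡ q′) (expand (im y) (im z)))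
    where
    open ℝ-Solver
    expand : ∀ y z → a ℝ.* (t ℝ.* y ℝ.+ z) ℝ.≈ a ℝ.* t ℝ.* y ℝ.+ a ℝ.* z
    expand y z = solve 4 (λ a t y z → a :* (t :* y :+ z) := a :* t :* y :+ a :* z) refl a t y z

  -- A combination of total weight s picks up the translation s times. Carrying the weight along
  -- lets the induction pass through partial combinations of weight other than 1.
  Hull-affine : ∀ {Y Y′} r d → (∀ y → y ∈ Y → Hull Y′ 1# (r • y + d)) →
                ∀ {s z} → Hull Y s z → Hull Y′ s (r • z + s • d)
  Hull-affine r d f (empty s≈0 (p , q)) = empty s≈0 (vanish (re d) p , vanish (im d) q)
    where
    open ℝ-Solver
    vanish : ∀ {x} d → x ℝ.≈ 0# → r ℝ.* x ℝ.+ _ ℝ.* d ℝ.≈ 0#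
    vanish d x≈0 = trans (+-cong (*-congˡ x≈0) (*-congʳ s≈0))
      (solve 2 (λ r d → r :* con (+ 0) :+ con (+ 0) :* d := con (+ 0)) refl r d)
  Hull-affine r d f (add {s} {z} {s′} t y 0≤t y∈Y h p (q , q′)) = Hull-resp
    (trans (+-congʳ (*-identityʳ t)) (sym p))
    (regroup (re y) (re z) (re d) q , regroup (im y) (im z) (im d) q′)
    (Hull-+ (Hull-scale 0≤t (f y y∈Y)) (Hull-affine r d f h))
    where
    open ℝ-Solver
    regroup : ∀ {x} y z d → x ℝ.≈ t ℝ.* y ℝ.+ z →
              t ℝ.* (r ℝ.* y ℝ.+ d) ℝ.+ (r ℝ.* z ℝ.+ s ℝ.* d) ℝ.≈ r ℝ.* x ℝ.+ s′ ℝ.* d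
    regroup y z d x≈ = trans
      (solve 6 (λ t r s y z d → t :* (r :* y :+ d) :+ (r :* z :+ s :* d) := r :* (t :* y :+ z) :+ (t :+ s) :* d) refl t r s y z d)
      (sym (+-cong (*-congˡ x≈) (*-congʳ p)))

  Hull-affine₁ : ∀ {Y Y′} r d → (∀ y → y ∈ Y → Hull Y′ 1# (r • y + d)) →
                 ∀ {z} → Hull Y 1# z → Hull Y′ 1# (r • z + d)
  Hull-affine₁ r d f h = Hull-resp refl (C.+-congˡ (*-identityˡ _ , *-identityˡ _)) (Hull-affine r d f h)

  Hull-translate : ∀ {Y Y′} d → (∀ y → y ∈ Y → Hull Y′ 1# (y + d)) → ∀ {z} → Hull Y 1# z → Hull Y′ 1# (z + d)
  Hull-translate d f {z} h = Hull-resp refl (C.+-congʳ (1• z))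
    (Hull-affine₁ 1# d (λ y y∈Y → Hull-resp refl (C.+-congʳ (C.sym (1• y))) (f y y∈Y)) h)
    where
    1• : ∀ z → 1# • z ≈ z
    1• z = *-identityˡ _ , *-identityˡ _

  Hull-convex : ∀ {Y t z z′} → 0# ≤ t → t ≤ 1# → Hull Y 1# z → Hull Y 1# z′ →
                Hull Y 1# ((1# ℝ.- t) • z + t • z′)
  Hull-convex {t = t} 0≤t t≤1 h h′ = Hull-resp (solve 1 (λ t → (con (+ 1) :- t) :* con (+ 1) :+ t :* con (+ 1) := con (+ 1)) refl t) C.refl
    (Hull-+ (Hull-scale (diff-nonneg t≤1) h) (Hull-scale 0≤t h′))
    where open ℝ-Solver

  conv⇒Hull : ∀ {Y z} → z ∈ conv Y → Hull Y 1# z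
  conv⇒Hull {Y} (m , t , y , 0≤t , ∑t≈1 , y∈Y , z≈) = Hull-resp ∑t≈1 (C.sym z≈) (combination m t y 0≤t y∈Y)
    where
    combination : ∀ m (t : Fin m → Carrier) (y : Fin m → ℂ) → (∀ i → 0# ≤ t i) → (∀ i → y i ∈ Y) →
                  Hull Y (ℝ.sum t) (sum (λ i → t i • y i))
    combination zero    t y 0≤t y∈Y = empty refl C.refl
    combination (suc m) t y 0≤t y∈Y = add (t zero) (y zero) (0≤t zero) (y∈Y zero)
      (combination m (t ∘ suc) (y ∘ suc) (0≤t ∘ suc) (y∈Y ∘ suc)) refl C.refl

  Hull⇒conv : ∀ {Y z} → Hull Y 1# z → z ∈ conv Y
  Hull⇒conv {Y} h = let m , t , y , 0≤t , y∈Y , s≈ , z≈ = combination h in m , t , y , 0≤t , sym s≈ , y∈Y , z≈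
    where
    combination : ∀ {s z} → Hull Y s z → ∃[ m ] Σ[ t ∈ (Fin m → Carrier) ] Σ[ y ∈ (Fin m → ℂ) ]
      ((∀ i → 0# ≤ t i) × (∀ i → y i ∈ Y) × s ℝ.≈ ℝ.sum t × z ≈ sum (λ i → t i • y i))
    combination (empty s≈0 z≈0) = 0 , (λ ()) , (λ ()) , (λ ()) , (λ ()) , s≈0 , z≈0
    combination (add t₀ y₀ 0≤t₀ y₀∈Y h p q) =
      let m , t , y , 0≤t , y∈Y , s≈ , z≈ = combination h in
      suc m , (λ { zero → t₀ ; (suc i) → t i }) , (λ { zero → y₀ ; (suc i) → y i })
            , (λ { zero → 0≤t₀ ; (suc i) → 0≤t i }) , (λ { zero → y₀∈Y ; (suc i) → y∈Y i })
            , trans p (+-congˡ s≈) , C.trans q (C.+-congˡ z≈)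

  -- The determinant of z and w, positive when w is turned counterclockwise from z by an angle
  -- strictly between 0 and π.
  cross : ℂ → ℂ → Carrier
  cross z w = re z ℝ.* im w ℝ.- im z ℝ.* re w

  cross-cong : ∀ {z z′ w w′} → z ≈ z′ → w ≈ w′ → cross z w ℝ.≈ cross z′ w′
  cross-cong (p , q) (r , s) = +-cong (*-cong p s) (-‿cong (*-cong q r))

  cross-+ˡ : ∀ z z′ w → cross (z + z′) w ℝ.≈ cross z w ℝ.+ cross z′ w
  cross-+ˡ z z′ w = solve 6 (λ a b c d x y → (a :+ c) :* y :- (b :+ d) :* x := a :* y :- b :* x :+ (c :* y :- d :* x))
    refl (re z) (im z) (re z′) (im z′) (re w) (im w)
    where open ℝ-Solver

  cross-+ʳ : ∀ z w w′ → cross z (w + w′) ℝ.≈ cross z w ℝ.+ cross z w′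
  cross-+ʳ z w w′ = solve 6 (λ x y a b c d → x :* (b :+ d) :- y :* (a :+ c) := x :* b :- y :* a :+ (x :* d :- y :* c))
    refl (re z) (im z) (re w) (im w) (re w′) (im w′)
    where open ℝ-Solver

  cross-neg : ∀ z w → cross (- z) (- w) ℝ.≈ cross z w
  cross-neg z w = solve 4 (λ a b x y → :- a :* :- y :- :- b :* :- x := a :* y :- b :* x) refl (re z) (im z) (re w) (im w)
    where open ℝ-Solver

  cross-∑ˡ-nonneg : ∀ f m w → (∀ k → k ℕ.< m → 0# ≤ cross (f k) w) → 0# ≤ cross (∑ f m) w
  cross-∑ˡ-nonneg f zero    w 0≤ = ≤-reflexive (solve 2 (λ x y → con (+ 0) := con (+ 0) :* y :- con (+ 0) :* x) refl (re w) (im w))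
    where open ℝ-Solver
  cross-∑ˡ-nonneg f (suc m) w 0≤ = ≤-respʳ (sym (cross-+ˡ (f 0) (∑ (f ∘ suc) m) w))
    (+-nonneg (0≤ 0 z<s) (cross-∑ˡ-nonneg (f ∘ suc) m w (λ k k<m → 0≤ (suc k) (s<s k<m))))

  cross-∑ˡ-pos : ∀ f m w → (∀ k → k ℕ.< suc m → 0# < cross (f k) w) → 0# < cross (∑ f (suc m)) w
  cross-∑ˡ-pos f m w 0< = <-respʳ (sym (cross-+ˡ (f 0) (∑ (f ∘ suc) m) w))
    (+-pos-nonneg (0< 0 z<s) (cross-∑ˡ-nonneg (f ∘ suc) m w (λ k k<m → <⇒≤ (0< (suc k) (s<s k<m)))))

  cross-∑ʳ-nonneg : ∀ f m z → (∀ k → k ℕ.< m → 0# ≤ cross z (f k)) → 0# ≤ cross z (∑ f m)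
  cross-∑ʳ-nonneg f zero    z 0≤ = ≤-reflexive (solve 2 (λ x y → con (+ 0) := x :* con (+ 0) :- y :* con (+ 0)) refl (re z) (im z))
    where open ℝ-Solver
  cross-∑ʳ-nonneg f (suc m) z 0≤ = ≤-respʳ (sym (cross-+ʳ z (f 0) (∑ (f ∘ suc) m)))
    (+-nonneg (0≤ 0 z<s) (cross-∑ʳ-nonneg (f ∘ suc) m z (λ k k<m → 0≤ (suc k) (s<s k<m))))

  -- By Cramer's rule, cross a b • m ≈ cross m b • a + cross a m • b, so m lies in the cone of a and b.
  -- The weights below express w + (a + b) through the four given points.
  parallelogram-corner : ∀ {Y} w a b m → 0# < cross a b → 0# ≤ cross m b → 0# ≤ cross a m →
    Hull Y 1# w → Hull Y 1# (w + a) → Hull Y 1# (w + b) → Hull Y 1# (w + (a + b + m)) →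
    Hull Y 1# (w + (a + b))
  parallelogram-corner {Y} w a b m 0<D 0≤A 0≤B hw ha hb hm = from-total (total A B)
    where
    open ℝ-Solver
    D A B : Carrier
    D = cross a b
    A = cross m b
    B = cross a m

    normalise : ∀ {E z} → 0# < E → Hull Y E (E • z) → Hull Y 1# z
    normalise {E} {z} 0<E h = Hull-resp (trans (*-comm _ _) (⁻¹-inverse 0<E))
      (cancel (re z) , cancel (im z)) (Hull-scale (<⇒≤ (⁻¹-pos 0<E)) h)
      where
      cancel : ∀ x → E ℝ.⁻¹ ℝ.* (E ℝ.* x) ℝ.≈ x
      cancel x = trans (solve 3 (λ e i x → i :* (e :* x) := e :* i :* x) refl E (E ℝ.⁻¹) x)
                   (trans (*-congʳ (⁻¹-inverse 0<E)) (*-identityˡ x))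

    combine : ∀ {s t u z₁ z₂ z₃} → 0# ≤ s → 0# ≤ t → 0# ≤ u →
              Hull Y 1# z₁ → Hull Y 1# z₂ → Hull Y 1# z₃ →
              Hull Y (s ℝ.+ t ℝ.+ u) (s • z₁ + t • z₂ + u • z₃)
    combine {s} {t} {u} 0≤s 0≤t 0≤u h₁ h₂ h₃ = Hull-resp
      (solve 3 (λ s t u → s :* con (+ 1) :+ t :* con (+ 1) :+ u :* con (+ 1) := s :+ t :+ u) refl s t u) C.refl
      (Hull-+ (Hull-+ (Hull-scale 0≤s h₁) (Hull-scale 0≤t h₂)) (Hull-scale 0≤u h₃))

    cramer-re : D ℝ.* re m ℝ.≈ A ℝ.* re a ℝ.+ B ℝ.* re b
    cramer-re = solve 6 (λ a b c d x y → (a :* d :- b :* c) :* x := (x :* d :- y :* c) :* a :+ (a :* y :- b :* x) :* c)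
      refl (re a) (im a) (re b) (im b) (re m) (im m)

    cramer-im : D ℝ.* im m ℝ.≈ A ℝ.* im a ℝ.+ B ℝ.* im b
    cramer-im = solve 6 (λ a b c d x y → (a :* d :- b :* c) :* y := (x :* d :- y :* c) :* b :+ (a :* y :- b :* x) :* d)
      refl (re a) (im a) (re b) (im b) (re m) (im m)

    case-A : ∀ D A B w a b m → D ℝ.* m ℝ.≈ A ℝ.* a ℝ.+ B ℝ.* b →
      D ℝ.* (w ℝ.+ (a ℝ.+ b ℝ.+ m)) ℝ.+ (A ℝ.- B) ℝ.* (w ℝ.+ b) ℝ.+ B ℝ.* w ℝ.≈ (D ℝ.+ A) ℝ.* (w ℝ.+ (a ℝ.+ b))
    case-A D A B w a b m Dm≈ = trans
      (solve 7 (λ D A B w a b m → D :* (w :+ (a :+ b :+ m)) :+ (A :- B) :* (w :+ b) :+ B :* w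
                 := D :* (w :+ (a :+ b)) :+ D :* m :+ (A :- B) :* b :+ A :* w) refl D A B w a b m)
      (trans (+-congʳ (+-congʳ (+-congˡ Dm≈)))
        (solve 6 (λ D A B w a b → D :* (w :+ (a :+ b)) :+ (A :* a :+ B :* b) :+ (A :- B) :* b :+ A :* w
                   := (D :+ A) :* (w :+ (a :+ b))) refl D A B w a b))

    case-B : ∀ D A B w a b m → D ℝ.* m ℝ.≈ A ℝ.* a ℝ.+ B ℝ.* b →
      D ℝ.* (w ℝ.+ (a ℝ.+ b ℝ.+ m)) ℝ.+ (B ℝ.- A) ℝ.* (w ℝ.+ a) ℝ.+ A ℝ.* w ℝ.≈ (D ℝ.+ B) ℝ.* (w ℝ.+ (a ℝ.+ b))
    case-B D A B w a b m Dm≈ = trans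
      (solve 7 (λ D A B w a b m → D :* (w :+ (a :+ b :+ m)) :+ (B :- A) :* (w :+ a) :+ A :* w
                 := D :* (w :+ (a :+ b)) :+ D :* m :+ (B :- A) :* a :+ B :* w) refl D A B w a b m)
      (trans (+-congʳ (+-congʳ (+-congˡ Dm≈)))
        (solve 6 (λ D A B w a b → D :* (w :+ (a :+ b)) :+ (A :* a :+ B :* b) :+ (B :- A) :* a :+ B :* w
                   := (D :+ B) :* (w :+ (a :+ b))) refl D A B w a b))

    -- The comparison of A and B decides whether `w + b` or `w + a` takes part, since its weight A -
    -- B or B - A must be nonnegative.
    from-total : A ≤ B ⊎ B ≤ A → Hull Y 1# (w + (a + b))
    from-total (inj₂ B≤A) = normalise {D ℝ.+ A} (+-pos-nonneg 0<D 0≤A) (Hull-resp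
      (solve 3 (λ D A B → D :+ (A :- B) :+ B := D :+ A) refl D A B)
      (case-A D A B (re w) (re a) (re b) (re m) cramer-re , case-A D A B (im w) (im a) (im b) (im m) cramer-im)
      (combine (<⇒≤ 0<D) (diff-nonneg B≤A) 0≤B hm hb hw))
    from-total (inj₁ A≤B) = normalise {D ℝ.+ B} (+-pos-nonneg 0<D 0≤B) (Hull-resp
      (solve 3 (λ D A B → D :+ (B :- A) :+ A := D :+ B) refl D A B)
      (case-B D A B (re w) (re a) (re b) (re m) cramer-re , case-B D A B (im w) (im a) (im b) (im m) cramer-im)
      (combine (<⇒≤ 0<D) (diff-nonneg A≤B) 0≤A hm ha hw))

  module _ (g : ℕ → ℂ) where
    -- Vertices of the zonotope of g 0, …, g (N - 1) when these are ordered by argument.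
    Vertex : ℕ → Pred ℂ 0ℓ
    Vertex N z = ∃[ i ] (i ℕ.≤ N × (z ≈ ∑ g i ⊎ z ≈ ∑ g N - ∑ g i))

    -- The arguments increase and stay within less than a half turn.
    Ordered : ℕ → Set
    Ordered N = ∀ i j → i ℕ.< j → j ℕ.< N → 0# < cross (g i) (g j)

    module _ {N} (ordered : Ordered (suc N)) where
      private
        prefix suffix : ℕ → ℂ
        prefix i = ∑ g i
        suffix i = ∑ (λ j → g (i ℕ.+ j)) (N ℕ.∸ i)

        prefix+suffix : ∀ {i} → i ℕ.≤ N → ∑ g N ≈ prefix i + suffix i
        prefix+suffix {i} i≤N = C.trans (C.reflexive (≡.cong (∑ g) (≡.sym (ℕ.m+[n∸m]≡n i≤N)))) (∑-split g i (N ℕ.∸ i))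

        total-last : ∑ g (suc N) ≈ ∑ g N + g N
        total-last = ∑-last g N

        i+j<N : ∀ {i j} → i ℕ.≤ N → j ℕ.< N ℕ.∸ i → i ℕ.+ j ℕ.< N
        i+j<N {i} i≤N j<N-i = ℕ.<-≤-trans (ℕ.+-monoʳ-< i j<N-i) (ℕ.≤-reflexive (ℕ.m+[n∸m]≡n i≤N))

        cross-prefix-last : ∀ {i} → suc i ℕ.≤ N → 0# < cross (prefix (suc i)) (g N)
        cross-prefix-last {i} i<N = cross-∑ˡ-pos g i (g N) λ k k≤i → ordered k N (ℕ.<-≤-trans k≤i i<N) ℕ.≤-refl

        cross-suffix-last : ∀ {i} → i ℕ.≤ N → 0# ≤ cross (suffix i) (g N)
        cross-suffix-last {i} i≤N = cross-∑ˡ-nonneg _ (N ℕ.∸ i) (g N) λ j j< → <⇒≤ (ordered (i ℕ.+ j) N (i+j<N i≤N j<) ℕ.≤-refl)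

        cross-prefix-suffix : ∀ {i} → i ℕ.≤ N → 0# ≤ cross (prefix i) (suffix i)
        cross-prefix-suffix {i} i≤N = cross-∑ˡ-nonneg g i (suffix i) λ k k<i → cross-∑ʳ-nonneg _ (N ℕ.∸ i) (g k) λ j j< →
          <⇒≤ (ordered k (i ℕ.+ j) (ℕ.<-≤-trans k<i (ℕ.m≤m+n i j)) (ℕ.m<n⇒m<1+n (i+j<N i≤N j<)))

        vertex : ∀ {z} i → i ℕ.≤ suc N → z ≈ ∑ g i ⊎ z ≈ ∑ g (suc N) - ∑ g i → Hull (Vertex (suc N)) 1# z
        vertex i i≤N z≈ = Hull-point (i , i≤N , z≈)

        -- All generators of the suffix have arguments between those of the prefix and of `g N`, so
        -- `suffix i` lies in the cone of the two. The point is thus the corner of a parallelogram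
        -- over the vertices 0, prefix and `g N`, and adding the suffix leads to the total sum. The
        -- empty prefix spans no parallelogram, but there the point `g N` is a vertex already.
        prefix+last : ∀ i → i ℕ.≤ N → Hull (Vertex (suc N)) 1# (prefix i + g N)
        prefix+last zero    _   = vertex N (ℕ.n≤1+n N) (inj₂ (C.trans
          (solve 2 (λ s x → con (+ 0) :+ x := s :+ x :- s) C.refl (∑ g N) (g N)) (C.+-congʳ (C.sym total-last))))
          where open ℂ-Solver
        prefix+last (suc i) i<N = Hull-resp refl (C.+-identityˡ _)
          (parallelogram-corner 0ℂ (prefix (suc i)) (g N) (suffix (suc i))
            (cross-prefix-last i<N) (cross-suffix-last i<N) (cross-prefix-suffix i<N)
            (vertex 0 z≤n (inj₁ C.refl))
            (vertex (suc i) (ℕ.m≤n⇒m≤1+n i<N) (inj₁ (C.+-identityˡ _)))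
            (vertex N (ℕ.n≤1+n N) (inj₂ (C.trans (solve 2 (λ s x → con (+ 0) :+ x := s :+ x :- s) C.refl (∑ g N) (g N)) (C.+-congʳ (C.sym total-last)))))
            (vertex (suc N) ℕ.≤-refl (inj₁ (C.trans
              (solve 3 (λ p x q → con (+ 0) :+ (p :+ x :+ q) := p :+ q :+ x) C.refl (prefix (suc i)) (g N) (suffix (suc i)))
              (C.trans (C.+-congʳ (C.sym (prefix+suffix i<N))) (C.sym total-last))))))
          where open ℂ-Solver

        -- The reflection z ↦ ∑ g (suc N) - z swaps the two kinds of vertices.
        coprefix : ∀ i → i ℕ.≤ N → Hull (Vertex (suc N)) 1# (∑ g N - prefix i)
        coprefix zero    _   = vertex N (ℕ.n≤1+n N) (inj₁ (solve 1 (λ s → s :- con (+ 0) := s) C.refl (∑ g N)))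
          where open ℂ-Solver
        coprefix (suc i) i<N = Hull-resp refl
          (C.trans (C.+-congʳ total-last) (solve 3 (λ s p x → s :+ x :+ (:- p :+ :- x) := s :- p) C.refl (∑ g N) (prefix (suc i)) (g N)))
          (parallelogram-corner (∑ g (suc N)) (- prefix (suc i)) (- g N) (- suffix (suc i))
            (<-respʳ (sym (cross-neg (prefix (suc i)) (g N))) (cross-prefix-last i<N))
            (≤-respʳ (sym (cross-neg (suffix (suc i)) (g N))) (cross-suffix-last i<N))
            (≤-respʳ (sym (cross-neg (prefix (suc i)) (suffix (suc i)))) (cross-prefix-suffix i<N))
            (vertex (suc N) ℕ.≤-refl (inj₁ C.refl))
            (vertex (suc i) (ℕ.m≤n⇒m≤1+n i<N) (inj₂ C.refl))
            (vertex N (ℕ.n≤1+n N) (inj₁ (C.trans (C.+-congʳ total-last) (solve 2 (λ s x → s :+ x :- x := s) C.refl (∑ g N) (g N)))))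
            (vertex 0 z≤n (inj₁ (C.trans (C.+-congʳ (C.trans total-last (C.+-congʳ (prefix+suffix i<N))))
              (solve 3 (λ p x q → p :+ q :+ x :+ (:- p :+ :- x :+ :- q) := con (+ 0)) C.refl (prefix (suc i)) (g N) (suffix (suc i)))))))
          where open ℂ-Solver

      -- With `Vertex-+last` this makes four cases. A prefix sum that is kept and a complementary
      -- sum that gains `g N` are vertices again; the other two are the corners `prefix+last` and
      -- `coprefix`.
      Vertex-weaken : ∀ y → y ∈ Vertex N → Hull (Vertex (suc N)) 1# (y + 0ℂ)
      Vertex-weaken y (i , i≤N , inj₁ y≈) = vertex i (ℕ.m≤n⇒m≤1+n i≤N) (inj₁ (C.trans (C.+-identityʳ y) y≈))
      Vertex-weaken y (i , i≤N , inj₂ y≈) = Hull-resp refl (C.sym (C.trans (C.+-identityʳ y) y≈)) (coprefix i i≤N)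

      Vertex-+last : ∀ y → y ∈ Vertex N → Hull (Vertex (suc N)) 1# (y + g N)
      Vertex-+last y (i , i≤N , inj₁ y≈) = Hull-resp refl (C.+-congʳ (C.sym y≈)) (prefix+last i i≤N)
      Vertex-+last y (i , i≤N , inj₂ y≈) = vertex i (ℕ.m≤n⇒m≤1+n i≤N) (inj₂ (C.trans (C.+-congʳ y≈)
        (C.trans (solve 3 (λ s p x → s :- p :+ x := s :+ x :- p) C.refl (∑ g N) (prefix i) (g N)) (C.+-congʳ (C.sym total-last)))))
        where open ℂ-Solver

    -- x + t g = (1 - t) x + t (x + g) with x in the smaller zonotope, so it is enough that both the
    -- old hull and its translate by the last generator lie in the new hull.
    zonotope⊆Hull : (t : ℕ → Carrier) → (∀ i → 0# ≤ t i) → (∀ i → t i ≤ 1#) → ∀ N → Ordered N →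
                    Hull (Vertex N) 1# (∑ (λ i → t i • g i) N)
    zonotope⊆Hull t 0≤t t≤1 zero    _       = Hull-point (0 , z≤n , inj₁ C.refl)
    zonotope⊆Hull t 0≤t t≤1 (suc N) ordered = Hull-resp refl
      (C.trans (mix (re x) (re (g N)) , mix (im x) (im (g N))) (C.sym (∑-last (λ i → t i • g i) N)))
      (Hull-convex (0≤t N) (t≤1 N) (Hull-translate 0ℂ (Vertex-weaken ordered) IH) (Hull-translate (g N) (Vertex-+last ordered) IH))
      where
      open ℝ-Solver
      x : ℂ
      x = ∑ (λ i → t i • g i) N
      IH : Hull (Vertex N) 1# x
      IH = zonotope⊆Hull t 0≤t t≤1 N (λ i j i<j j<N → ordered i j i<j (ℕ.m<n⇒m<1+n j<N))
      mix : ∀ x g → (1# ℝ.- t N) ℝ.* (x ℝ.+ 0#) ℝ.+ t N ℝ.* (x ℝ.+ g) ℝ.≈ x ℝ.+ t N ℝ.* g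
      mix = solve 3 (λ t x g → (con (+ 1) :- t) :* (x :+ con (+ 0)) :+ t :* (x :+ g) := x :+ t :* g) refl (t N)

    -- After N steps the walk repeats them with opposite sign. Its positions are therefore the
    -- prefix sums on the way out and the complementary sums on the way back, all translated by
    -- `u 0`.
    module _ {N} (u : ℕ → ℂ) (step : ∀ j → u (suc j) ≈ u j + g j) (antiperiodic : ∀ j → g (N ℕ.+ j) ≈ - g j) where
      walk : ∀ j → u j ≈ ∑ g j + u 0
      walk zero    = C.sym (C.+-identityˡ _)
      walk (suc j) = C.trans (step j) (C.trans (C.+-congʳ (walk j))
        (C.trans (solve 3 (λ s u x → s :+ u :+ x := s :+ x :+ u) C.refl (∑ g j) (u 0) (g j)) (C.+-congʳ (C.sym (∑-last g j)))))
        where open ℂ-Solver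

      walk-back : ∀ j → u (N ℕ.+ j) ≈ ∑ g N - ∑ g j + u 0
      walk-back j = C.trans (walk (N ℕ.+ j)) (C.+-congʳ (C.trans (∑-split g N j) (C.+-congˡ (retrace j))))
        where
        open ℂ-Solver
        retrace : ∀ j → ∑ (λ i → g (N ℕ.+ i)) j ≈ - ∑ g j
        retrace j = C.trans (∑-cong j (λ k _ → C.trans (antiperiodic k) (solve 1 (λ x → :- x := :- con (+ 1) :* x) C.refl (g k))))
          (C.trans (∑-*ˡ (- 1ℂ) g j) (solve 1 (λ x → :- con (+ 1) :* x := :- x) C.refl (∑ g j)))

      zonotope⊆walk-Hull : (t : ℕ → Carrier) → (∀ i → 0# ≤ t i) → (∀ i → t i ≤ 1#) → Ordered N →
                           Hull (λ z → ∃[ j ] z ≈ u j) 1# (∑ (λ i → t i • g i) N + u 0)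
      zonotope⊆walk-Hull t 0≤t t≤1 ordered = Hull-translate (u 0)
        (λ { y (i , _ , inj₁ y≈) → Hull-point (i , C.trans (C.+-congʳ y≈) (C.sym (walk i)))
           ; y (i , _ , inj₂ y≈) → Hull-point (N ℕ.+ i , C.trans (C.+-congʳ y≈) (C.sym (walk-back i))) })
        (zonotope⊆Hull t 0≤t t≤1 N ordered)

-- Expansions in base q, regrouped by residue modulo n.

module DigitExpansions (ℝ : CompleteOrderedField) where
  open ComplexNumbers ℝ
  open Trigonometry ℝ

  ∣zw∣² : ∀ z w → ∣ z * w ∣² ℝ.≈ ∣ z ∣² ℝ.* ∣ w ∣²
  ∣zw∣² z w = solve 4 (λ a b c d → (a :* c :- b :* d) :* (a :* c :- b :* d) :+ (a :* d :+ b :* c) :* (a :* d :+ b :* c)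
                 := (a :* a :+ b :* b) :* (c :* c :+ d :* d)) refl (re z) (im z) (re w) (im w)
    where open ℝ-Solver

  ∣z^k∣²≈1 : ∀ {z} → ∣ z ∣² ℝ.≈ 1# → ∀ k → ∣ z ^ k ∣² ℝ.≈ 1#
  ∣z^k∣²≈1 ∣z∣≈1 zero = solve 0 (con (+ 1) :* con (+ 1) :+ con (+ 0) :* con (+ 0) := con (+ 1)) refl
    where open ℝ-Solver
  ∣z^k∣²≈1 {z} ∣z∣≈1 (suc k) = trans (∣zw∣² z (z ^ k)) (trans (*-cong ∣z∣≈1 (∣z^k∣²≈1 ∣z∣≈1 k)) (*-identityˡ _))

  ∣conj∣² : ∀ z → ∣ conj z ∣² ℝ.≈ ∣ z ∣²
  ∣conj∣² z = solve 2 (λ a b → a :* a :+ :- b :* :- b := a :* a :+ b :* b) refl (re z) (im z)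
    where open ℝ-Solver

  ⁻¹-inverseʳ : ∀ {z} → 0# < ∣ z ∣² → z * z ⁻¹ ≈ 1ℂ
  ⁻¹-inverseʳ {z} 0<∣z∣² =
    trans (solve 3 (λ i a b → a :* (i :* a) :- b :* (i :* :- b) := (a :* a :+ b :* b) :* i) refl i (re z) (im z)) (⁻¹-inverse 0<∣z∣²) ,
    solve 3 (λ i a b → a :* (i :* :- b) :+ b :* (i :* a) := con (+ 0)) refl i (re z) (im z)
    where
    open ℝ-Solver
    i : Carrier
    i = ∣ z ∣² ℝ.⁻¹

  module Base {p ζ} (1<p : 1# < p) (∣ζ∣²≈1 : ∣ ζ ∣² ℝ.≈ 1#)
              {n} .{{_ : ℕ.NonZero n}} (ζ^n≈1 : ζ ^ n ≈ 1ℂ) where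
    q Q : ℂ
    q = p • ζ
    Q = q ⁻¹

    P R c : Carrier
    P = p ℝ.⁻¹
    R = p ℝ.^ n
    c = (R ℝ.- 1#) ℝ.⁻¹

    private
      0<p : 0# < p
      0<p = ≤-<-trans 0≤1 1<p

      0<P : 0# < P
      0<P = ⁻¹-pos 0<p

      0<R : 0# < R
      0<R = ^-pos n 0<p

      0<R-1 : 0# < R ℝ.- 1#
      0<R-1 = diff-pos (from-nonZero n)
        where
        from-nonZero : ∀ n .{{_ : ℕ.NonZero n}} → 1# < p ℝ.^ n
        from-nonZero (suc n) = 1<^suc 1<p n

    0<c : 0# < c
    0<c = ⁻¹-pos 0<R-1

    -- c = 1/(R - 1) is the value of R⁻¹ + R⁻² + ..., and multiplication by R shifts this series.
    Rc≈1+c : R ℝ.* c ℝ.≈ 1# ℝ.+ c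
    Rc≈1+c = trans (solve 2 (λ R c → R :* c := (R :- con (+ 1)) :* c :+ c) refl R c) (+-congʳ (⁻¹-inverse 0<R-1))
      where open ℝ-Solver

    q^n≈ιR : q ^ n ≈ ι R
    q^n≈ιR = C.trans (•-^ p ζ n) (C.trans (•-cong refl ζ^n≈1) (*-identityʳ _ , zeroʳ _))

    q*Q≈1 : q * Q ≈ 1ℂ
    q*Q≈1 = ⁻¹-inverseʳ {q} (<-respʳ (sym (trans
      (solve 3 (λ p a b → p :* a :* (p :* a) :+ p :* b :* (p :* b) := p :* p :* (a :* a :+ b :* b)) refl p (re ζ) (im ζ))
      (trans (*-congˡ ∣ζ∣²≈1) (*-identityʳ _)))) (*-pos 0<p 0<p))
      where open ℝ-Solver

    Q≈P•conjζ : Q ≈ P • conj ζ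
    Q≈P•conjζ = begin
      Q ≈⟨ C.*-identityʳ Q ⟨
      Q * 1ℂ ≈⟨ C.*-congˡ q*[P•conjζ]≈1 ⟨
      Q * (q * (P • conj ζ)) ≈⟨ solve 3 (λ Q q z → Q :* (q :* z) := q :* Q :* z) C.refl Q q (P • conj ζ) ⟩
      q * Q * (P • conj ζ) ≈⟨ C.*-congʳ q*Q≈1 ⟩
      1ℂ * (P • conj ζ) ≈⟨ C.*-identityˡ _ ⟩
      P • conj ζ ∎
      where
      open ≈-Reasoning
      open ℂ-Solver
      q*[P•conjζ]≈1 : q * (P • conj ζ) ≈ 1ℂ
      q*[P•conjζ]≈1 = C.trans (•-* p P ζ (conj ζ)) (C.trans (•-cong (⁻¹-inverse 0<p) (C.trans (z*conj ζ) (∣ζ∣²≈1 , refl)))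
        (*-identityˡ _ , *-identityˡ _))

    ‖Q^k‖≤2P^k : ∀ k → ‖ Q ^ k ‖ ≤ 2# ℝ.* P ℝ.^ k
    ‖Q^k‖≤2P^k k = begin
      ‖ Q ^ k ‖ ≈⟨ ‖‖-cong (C.trans (C^.^-congˡ k Q≈P•conjζ) (•-^ P (conj ζ) k)) ⟩
      ‖ (P ℝ.^ k) • (conj ζ ^ k) ‖ ≈⟨ ‖c•z‖ _ _ ⟩
      ∣ P ℝ.^ k ∣ ℝ.* ‖ conj ζ ^ k ‖ ≈⟨ *-congʳ (nonneg⇒∣x∣≈x (^-nonneg k (<⇒≤ 0<P))) ⟩
      P ℝ.^ k ℝ.* ‖ conj ζ ^ k ‖ ≤⟨ *-monoˡ-≤ (^-nonneg k (<⇒≤ 0<P))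
                                              (∣z∣²≈1⇒‖z‖≤2 (∣z^k∣²≈1 {conj ζ} (trans (∣conj∣² ζ) ∣ζ∣²≈1) k)) ⟩
      P ℝ.^ k ℝ.* 2# ≈⟨ *-comm _ _ ⟩
      2# ℝ.* P ℝ.^ k ∎
      where open ≤-Reasoning

    P^k-null : Null (λ k → P ℝ.^ k)
    P^k-null = Null-geometric (diff-pos 1<p) (trans (*-congʳ
      (solve 1 (λ p → con (+ 1) :+ (p :- con (+ 1)) := p) refl p)) (⁻¹-inverse 0<p))
      where open ℝ-Solver

    -- The polynomial with coefficients X (i + k - 1), …, X i (constant term first), evaluated at q.
    window : (ℕ → Carrier) → ℕ → ℕ → ℂ
    window X zero    i = 0ℂ
    window X (suc k) i = window X k (suc i) + X i • q ^ k

    -- `window` is defined by splitting off the leading term; here the constant term is split off.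
    -- Comparing both splittings at length n + 1 shifts the window by one.
    window-horner : ∀ X k i → window X (suc k) i ≈ ι (X (k ℕ.+ i)) + q * window X k i
    window-horner X zero    i = begin
      0ℂ + X i • 1ℂ ≈⟨ C.+-congˡ (•≈ι* (X i) 1ℂ) ⟩
      0ℂ + ι (X i) * 1ℂ ≈⟨ solve 2 (λ x q → con (+ 0) :+ x :* con (+ 1) := x :+ q :* con (+ 0)) C.refl (ι (X i)) q ⟩
      ι (X i) + q * 0ℂ ∎
      where
      open ≈-Reasoning
      open ℂ-Solver
    window-horner X (suc k) i = begin
      window X (suc k) (suc i) + X i • (q * q ^ k)
        ≈⟨ C.+-cong (window-horner X k (suc i)) (•≈ι* (X i) (q * q ^ k)) ⟩
      ι (X (k ℕ.+ suc i)) + q * window X k (suc i) + ι (X i) * (q * q ^ k)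
        ≡⟨ ≡.cong (λ j → ι (X j) + q * window X k (suc i) + ι (X i) * (q * q ^ k)) (ℕ.+-suc k i) ⟩
      ι (X (suc k ℕ.+ i)) + q * window X k (suc i) + ι (X i) * (q * q ^ k)
        ≈⟨ solve 5 (λ y q w x r → y :+ q :* w :+ x :* (q :* r) := y :+ q :* (w :+ x :* r)) C.refl
             (ι (X (suc k ℕ.+ i))) q (window X k (suc i)) (ι (X i)) (q ^ k) ⟩
      ι (X (suc k ℕ.+ i)) + q * (window X k (suc i) + ι (X i) * q ^ k)
        ≈⟨ C.+-congˡ (C.*-congˡ (C.+-congˡ (•≈ι* (X i) (q ^ k)))) ⟨
      ι (X (suc k ℕ.+ i)) + q * window X (suc k) i ∎
      where
      open ≈-Reasoning
      open ℂ-Solver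

    window≈∑ : ∀ X k i → window X k i ≈ ∑ (λ j → X (i ℕ.+ (k ℕ.∸ suc j)) • q ^ j) k
    window≈∑ X zero    i = C.refl
    window≈∑ X (suc k) i = begin
      window X k (suc i) + X i • q ^ k
        ≈⟨ C.+-congʳ (window≈∑ X k (suc i)) ⟩
      ∑ (λ j → X (suc i ℕ.+ (k ℕ.∸ suc j)) • q ^ j) k + X i • q ^ k
        ≈⟨ C.+-cong (∑-cong k (λ j j<k → C.reflexive (≡.cong (λ l → X l • q ^ j) (index j<k))))
             (C.reflexive (≡.cong (λ l → X l • q ^ k) (≡.sym (≡.trans (≡.cong (i ℕ.+_) (ℕ.n∸n≡0 k)) (ℕ.+-identityʳ i))))) ⟩
      ∑ (λ j → X (i ℕ.+ (k ℕ.∸ j)) • q ^ j) k + X (i ℕ.+ (k ℕ.∸ k)) • q ^ k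
        ≈⟨ ∑-last (λ j → X (i ℕ.+ (k ℕ.∸ j)) • q ^ j) k ⟨
      ∑ (λ j → X (i ℕ.+ (k ℕ.∸ j)) • q ^ j) (suc k) ∎
      where
      open ≈-Reasoning
      index : ∀ {j} → j ℕ.< k → suc i ℕ.+ (k ℕ.∸ suc j) ≡.≡ i ℕ.+ (k ℕ.∸ j)
      index {j} j<k = ≡.trans (≡.sym (ℕ.+-suc i _)) (≡.cong (i ℕ.+_) (≡.sym (ℕ.+-∸-assoc 1 j<k)))

    ‖window‖-bounded : ∀ {X b} → 0# ≤ b → (∀ i → ∣ X i ∣ ≤ b) → ∀ k → ∃[ B ] (0# ≤ B × (∀ i → ‖ window X k i ‖ ≤ B))
    ‖window‖-bounded 0≤b X≤b zero    = 0# , ≤-refl , λ _ → ≤-reflexive ‖0‖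
    ‖window‖-bounded {b = b} 0≤b X≤b (suc k) =
      let B , 0≤B , W≤B = ‖window‖-bounded 0≤b X≤b k in
      B ℝ.+ b ℝ.* ‖ q ^ k ‖ , +-nonneg 0≤B (*-nonNeg 0≤b (0≤‖z‖ _)) , λ i →
        ≤-trans (‖z+w‖≤‖z‖+‖w‖ _ _) (+-mono-≤ (W≤B (suc i))
          (≤-trans (≤-reflexive (‖c•z‖ _ _)) (*-monoʳ-≤ (0≤‖z‖ _) (X≤b i))))

    module Expansion {x X : ℕ → Carrier} (shift : ∀ i → R ℝ.* X i ℝ.≈ x i ℝ.+ X (n ℕ.+ i)) where
      -- The top term X i qⁿ equals R X i because qⁿ = R. By the recurrence it is the digit x i plus
      -- X (n + i), and the latter is the constant term that the longer window has in excess.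
      q*window : ∀ i → q * window X n i ≈ window X n (suc i) + ι (x i)
      q*window i = begin
        q * window X n i
          ≈⟨ solve 2 (λ y w → w := y :+ w :- y) C.refl (ι (X (n ℕ.+ i))) (q * window X n i) ⟩
        ι (X (n ℕ.+ i)) + q * window X n i - ι (X (n ℕ.+ i))
          ≈⟨ C.+-congʳ (window-horner X n i) ⟨
        window X n (suc i) + X i • q ^ n - ι (X (n ℕ.+ i))
          ≈⟨ C.+-congʳ (C.+-congˡ (C.trans (•-cong refl q^n≈ιR) R•)) ⟩
        window X n (suc i) + (ι (x i) + ι (X (n ℕ.+ i))) - ι (X (n ℕ.+ i))
          ≈⟨ solve 3 (λ w x y → w :+ (x :+ y) :- y := w :+ x) C.refl (window X n (suc i)) (ι (x i)) (ι (X (n ℕ.+ i))) ⟩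
        window X n (suc i) + ι (x i) ∎
        where
        open ≈-Reasoning
        open ℂ-Solver
        R• : X i • ι R ≈ ι (x i) + ι (X (n ℕ.+ i))
        R• = trans (*-comm _ _) (shift i) , trans (zeroʳ _) (sym (+-identityˡ _))

      -- Writing `q*window` as W m = Q (W (m + 1) + x m) and iterating expands W 0 digit by digit.
      remainder : ∀ m → window X n 0 ≈ ∑ (λ j → x j • Q ^ suc j) m + Q ^ m * window X n m
      remainder zero    = solve 1 (λ w → w := con (+ 0) :+ con (+ 1) :* w) C.refl (window X n 0)
        where open ℂ-Solver
      remainder (suc m) = begin
        window X n 0
          ≈⟨ remainder m ⟩
        T + Q ^ m * window X n m
          ≈⟨ C.+-congˡ (C.*-congˡ (C.trans (C.sym (C.*-identityˡ _)) (C.*-congʳ (C.sym q*Q≈1)))) ⟩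
        T + Q ^ m * (q * Q * window X n m)
          ≈⟨ solve 5 (λ t r q Q w → t :+ r :* (q :* Q :* w) := t :+ Q :* r :* (q :* w)) C.refl T (Q ^ m) q Q (window X n m) ⟩
        T + Q ^ suc m * (q * window X n m)
          ≈⟨ C.+-congˡ (C.*-congˡ (q*window m)) ⟩
        T + Q ^ suc m * (window X n (suc m) + ι (x m))
          ≈⟨ solve 4 (λ t r w x → t :+ r :* (w :+ x) := t :+ x :* r :+ r :* w) C.refl T (Q ^ suc m) (window X n (suc m)) (ι (x m)) ⟩
        T + ι (x m) * Q ^ suc m + Q ^ suc m * window X n (suc m)
          ≈⟨ C.+-congʳ (C.+-congˡ (•≈ι* (x m) (Q ^ suc m))) ⟨
        T + x m • Q ^ suc m + Q ^ suc m * window X n (suc m)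
          ≈⟨ C.+-congʳ (∑-last (λ j → x j • Q ^ suc j) m) ⟨
        ∑ (λ j → x j • Q ^ suc j) (suc m) + Q ^ suc m * window X n (suc m) ∎
        where
        open ≈-Reasoning
        open ℂ-Solver
        T : ℂ
        T = ∑ (λ j → x j • Q ^ suc j) m

      expansion : ∀ {b} → 0# ≤ b → (∀ i → ∣ X i ∣ ≤ b) →
                  ∑ (λ j → x j • Q ^ suc j) ⟶ ∑ (λ k → X (n ℕ.∸ suc k) • q ^ k) n
      expansion 0≤b X≤b =
        let B , 0≤B , W≤B = ‖window‖-bounded 0≤b X≤b n in
        ⟶-cong {z = window X n 0} 0 (λ _ _ → C.refl) (window≈∑ X n 0)
          (Null-≤ 0 (λ m _ → bound B W≤B m) (Null-*ˡ (2# ℝ.* B) (*-nonNeg (<⇒≤ 0<2) 0≤B) P^k-null))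
        where
        bound : ∀ B → (∀ i → ‖ window X n i ‖ ≤ B) → ∀ m →
                ‖ ∑ (λ j → x j • Q ^ suc j) m - window X n 0 ‖ ≤ 2# ℝ.* B ℝ.* P ℝ.^ m
        bound B W≤B m = begin
          ‖ T - window X n 0 ‖
            ≈⟨ ‖‖-cong (C.+-congˡ (C.-‿cong (remainder m))) ⟩
          ‖ T - (T + Q ^ m * window X n m) ‖
            ≈⟨ ‖‖-cong (ℂ-Solver.solve 2 (λ t w → let open ℂ-Solver in t :- (t :+ w) := :- w) C.refl T (Q ^ m * window X n m)) ⟩
          ‖ - (Q ^ m * window X n m) ‖
            ≈⟨ ‖-z‖ _ ⟩
          ‖ Q ^ m * window X n m ‖
            ≤⟨ ‖z*w‖≤‖z‖*‖w‖ _ _ ⟩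
          ‖ Q ^ m ‖ ℝ.* ‖ window X n m ‖
            ≤⟨ *-mono-≤ (0≤‖z‖ _) (≤-trans (0≤‖z‖ _) (W≤B m)) (‖Q^k‖≤2P^k m) (W≤B m) ⟩
          2# ℝ.* P ℝ.^ m ℝ.* B
            ≈⟨ ℝ-Solver.solve 3 (λ t p b → let open ℝ-Solver in t :* p :* b := t :* b :* p) refl 2# (P ℝ.^ m) B ⟩
          2# ℝ.* B ℝ.* P ℝ.^ m ∎
          where
          open ≤-Reasoning
          T : ℂ
          T = ∑ (λ j → x j • Q ^ suc j) m

    module Regroup {x : ℕ → Carrier} {lo hi} (lo≤x : ∀ i → lo ≤ x i) (x≤hi : ∀ i → x i ≤ hi) where
      private
        r : Carrier
        r = R ℝ.⁻¹

        0≤r : 0# ≤ r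
        0≤r = <⇒≤ (⁻¹-pos 0<R)

        r*R* : ∀ y → r ℝ.* (R ℝ.* y) ℝ.≈ y
        r*R* y = trans (solve 3 (λ r R y → r :* (R :* y) := R :* r :* y) refl r R y)
                   (trans (*-congʳ (⁻¹-inverse 0<R)) (*-identityˡ y))
          where open ℝ-Solver

        -- c y is the value of the series in R⁻¹ all of whose digits are y, so prefixing another y
        -- does not change it.
        fixed-point : ∀ y → r ℝ.* (y ℝ.+ c ℝ.* y) ℝ.≈ c ℝ.* y
        fixed-point y = trans (*-congˡ (trans (solve 2 (λ y c → y :+ c :* y := (con (+ 1) :+ c) :* y) refl y c)
            (trans (*-congʳ (sym Rc≈1+c)) (*-assoc _ _ _)))) (r*R* (c ℝ.* y))
          where open ℝ-Solver

        -- Truncations of ∑ₗ x (i + l n) R^{-(l+1)} whose tail is continued by the constant digit y.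
        truncation : Carrier → ℕ → ℕ → Carrier
        truncation y i zero    = c ℝ.* y
        truncation y i (suc m) = r ℝ.* (x i ℝ.+ truncation y (n ℕ.+ i) m)

        lower↑ : ∀ i m → truncation lo i m ≤ truncation lo i (suc m)
        lower↑ i zero    = ≤-trans (≤-reflexive (sym (fixed-point lo))) (*-monoˡ-≤ 0≤r (+-mono-≤ (lo≤x i) ≤-refl))
        lower↑ i (suc m) = *-monoˡ-≤ 0≤r (+-mono-≤ ≤-refl (lower↑ (n ℕ.+ i) m))

        upper↓ : ∀ i m → truncation hi i (suc m) ≤ truncation hi i m
        upper↓ i zero    = ≤-trans (*-monoˡ-≤ 0≤r (+-mono-≤ (x≤hi i) ≤-refl)) (≤-reflexive (fixed-point hi))
        upper↓ i (suc m) = *-monoˡ-≤ 0≤r (+-mono-≤ ≤-refl (upper↓ (n ℕ.+ i) m))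

        lower≤upper : ∀ i m → truncation lo i m ≤ truncation hi i m
        lower≤upper i zero    = *-monoˡ-≤ (<⇒≤ 0<c) (≤-trans (lo≤x i) (x≤hi i))
        lower≤upper i (suc m) = *-monoˡ-≤ 0≤r (+-mono-≤ ≤-refl (lower≤upper (n ℕ.+ i) m))

        width : ∀ i m → truncation hi i m ℝ.- truncation lo i m ℝ.≈ (c ℝ.* hi ℝ.- c ℝ.* lo) ℝ.* r ℝ.^ m
        width i zero    = sym (*-identityʳ _)
        width i (suc m) = trans
          (solve 4 (λ r x a b → r :* (x :+ b) :- r :* (x :+ a) := r :* (b :- a)) refl r (x i) (truncation lo (n ℕ.+ i) m) (truncation hi (n ℕ.+ i) m))
          (trans (*-congˡ (width (n ℕ.+ i) m)) (solve 3 (λ r w p → r :* (w :* p) := w :* (r :* p)) refl r (c ℝ.* hi ℝ.- c ℝ.* lo) (r ℝ.^ m)))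
          where open ℝ-Solver

        width-null : Null (λ m → (c ℝ.* hi ℝ.- c ℝ.* lo) ℝ.* r ℝ.^ m)
        width-null = Null-*ˡ _ (diff-nonneg (lower≤upper 0 0)) (Null-geometric 0<R-1 (trans (*-congʳ
            (solve 1 (λ R → con (+ 1) :+ (R :- con (+ 1)) := R) refl R)) (⁻¹-inverse 0<R)))
          where open ℝ-Solver

        -- y exceeds z by at most the width of the interval of truncations, which tends to 0.
        -- Lengths start at 1, where `truncation` unfolds.
        squeeze : ∀ {y z} i → (∀ m → truncation lo i (suc m) ≤ z) → (∀ m → y ≤ truncation hi i (suc m)) → y ≤ z
        squeeze {y} {z} i lo≤z y≤hi = ≤-limit 1 width-null λ { (suc m) _ →
          ≤-by (+-nonneg (diff-nonneg (lo≤z m)) (diff-nonneg (y≤hi m)))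
            (trans (+-congˡ (sym (width i (suc m))))
              (solve 4 (λ y z a b → z :+ (b :- a) := y :+ ((z :- a) :+ (b :- y))) refl y z (truncation lo i (suc m)) (truncation hi i (suc m)))) }
          where open ℝ-Solver

      abstract
        limits : ∀ i → ∃[ s ] (∀ m → truncation lo i m ≤ s × s ≤ truncation hi i m)
        limits i = nested-intervals _ _ (lower↑ i) (upper↓ i) (lower≤upper i)

      X : ℕ → Carrier
      X i = proj₁ (limits i)

      X-bounds : ∀ i → c ℝ.* lo ≤ X i × X i ≤ c ℝ.* hi
      X-bounds i = proj₂ (limits i) 0

      -- `X i` and r (x i + X (n + i)) lie in the same shrinking intervals: the first by its choice,
      -- the second because a truncation at i unfolds to one at n + i.
      X-shift : ∀ i → R ℝ.* X i ℝ.≈ x i ℝ.+ X (n ℕ.+ i)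
      X-shift i = trans (*-congˡ (antisym
          (squeeze i (λ m → proj₁ (below-above m)) (λ m → proj₂ (proj₂ (limits i) (suc m))))
          (squeeze i (λ m → proj₁ (proj₂ (limits i) (suc m))) (λ m → proj₂ (below-above m)))))
        (trans (solve 3 (λ R r y → R :* (r :* y) := r :* (R :* y)) refl R r (x i ℝ.+ X (n ℕ.+ i))) (r*R* _))
        where
        open ℝ-Solver
        below-above : ∀ m → truncation lo i (suc m) ≤ r ℝ.* (x i ℝ.+ X (n ℕ.+ i)) × r ℝ.* (x i ℝ.+ X (n ℕ.+ i)) ≤ truncation hi i (suc m)
        below-above m = let a≤X , X≤b = proj₂ (limits (n ℕ.+ i)) m in
          *-monoˡ-≤ 0≤r (+-mono-≤ ≤-refl a≤X) , *-monoˡ-≤ 0≤r (+-mono-≤ ≤-refl X≤b)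

      regroup : ∑ (λ j → x j • Q ^ suc j) ⟶ ∑ (λ k → X (n ℕ.∸ suc k) • q ^ k) n
      regroup = Expansion.expansion X-shift (+-nonneg (0≤∣x∣ (c ℝ.* lo)) (0≤∣x∣ (c ℝ.* hi))) λ i →
        let clo≤X , X≤chi = X-bounds i in
        ∣∣-least (≤-trans X≤chi (≤-trans (x≤∣x∣ _) (≤-by (0≤∣x∣ (c ℝ.* lo)) (+-comm _ _))))
                 (≤-trans (neg-mono-≤ clo≤X) (≤-trans (-x≤∣x∣ _) (≤-by (0≤∣x∣ (c ℝ.* hi)) refl)))

    module Periodic (y : ℕ → Carrier) where
      digit : ℕ → Carrier
      digit j = y (n ℕ.∸ suc (j % n))

      private
        -- For periodic digits the recurrence becomes R X = x + X, solved by c x with c = 1/(R - 1).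
        X : ℕ → Carrier
        X i = c ℝ.* digit i

        X-shift : ∀ i → R ℝ.* X i ℝ.≈ digit i ℝ.+ X (n ℕ.+ i)
        X-shift i = trans (sym (*-assoc _ _ _)) (trans (*-congʳ Rc≈1+c)
          (trans (solve 2 (λ c d → (con (+ 1) :+ c) :* d := d :+ c :* d) refl c (digit i))
            (+-congˡ (*-congˡ (ℝ.reflexive (≡.cong (λ k → y (n ℕ.∸ suc k))
              (≡.sym (≡.trans (≡.cong (_% n) (ℕ.+-comm n i)) ([m+n]%n≡m%n i n)))))))))
          where open ℝ-Solver

        reindex : ∀ {k} → k ℕ.< n → digit (n ℕ.∸ suc k) ≡.≡ y k
        reindex {k} k<n = ≡.cong y (≡.trans
          (≡.cong (λ l → n ℕ.∸ suc l) (m<n⇒m%n≡m (ℕ.∸-monoʳ-< z<s k<n)))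
          (≡.trans (≡.cong (n ℕ.∸_) (≡.sym (ℕ.+-∸-assoc 1 k<n))) (ℕ.m∸[m∸n]≡n (ℕ.<⇒≤ k<n))))

      periodic-expansion : ∀ {b} → (∀ i → ∣ y i ∣ ≤ b) → ∑ (λ j → digit j • Q ^ suc j) ⟶ c • ∑ (λ k → y k • q ^ k) n
      periodic-expansion {b} y≤b = ⟶-cong 0 (λ _ _ → C.refl) (begin
        ∑ (λ k → X (n ℕ.∸ suc k) • q ^ k) n
          ≈⟨ ∑-cong n (λ k k<n → C.trans (C.reflexive (≡.cong (λ d → (c ℝ.* d) • q ^ k) (reindex k<n)))
               (C.trans (•-assoc c (y k) (q ^ k)) (•≈ι* c _))) ⟩
        ∑ (λ k → ι c * (y k • q ^ k)) n
          ≈⟨ ∑-*ˡ (ι c) (λ k → y k • q ^ k) n ⟩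
        ι c * ∑ (λ k → y k • q ^ k) n
          ≈⟨ •≈ι* c _ ⟨
        c • ∑ (λ k → y k • q ^ k) n ∎)
        (Expansion.expansion {digit} {X} X-shift (*-nonNeg (<⇒≤ 0<c) (≤-trans (0≤∣x∣ (y 0)) (y≤b 0))) λ i →
          ≤-trans (≤-reflexive (trans (∣xy∣≈∣x∣∣y∣ _ _) (*-congʳ (nonneg⇒∣x∣≈x (<⇒≤ 0<c)))))
            (*-monoˡ-≤ (<⇒≤ 0<c) (y≤b _)))
        where open ≈-Reasoning

-- Cyclic positions of exponents modulo n.

module _ (n : ℕ) .{{_ : ℕ.NonZero n}} where
  private
    unique-nonneg : ∀ {k l} t → k ℕ.< n → l ℕ.< n → + k ≡ + l ℤ.+ + t ℤ.* + n → k ≡ l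
    unique-nonneg {k} {l} t k<n l<n eq = ≡.trans (≡.sym (m<n⇒m%n≡m k<n)) (≡.trans (≡.cong (_% n) k≡l+tn)
      (≡.trans ([m+kn]%n≡m%n l t n) (m<n⇒m%n≡m l<n)))
      where
      k≡l+tn : k ≡ l ℕ.+ t ℕ.* n
      k≡l+tn = ℤ.+-injective (≡.trans eq (≡.cong (λ i → + l ℤ.+ i) (≡.sym (ℤ.pos-* t n))))

  -- Two representatives in the range 0, ..., n - 1 of one class coincide; the sign of `t` tells
  -- which side to read as a natural number plus a multiple of n.
  residue-unique : ∀ {k l} t → k ℕ.< n → l ℕ.< n → + k ≡ + l ℤ.+ t ℤ.* + n → k ≡ l
  residue-unique (+ t)          k<n l<n eq = unique-nonneg t k<n l<n eq
  residue-unique {k} {l} -[1+ t ] k<n l<n eq = ≡.sym (unique-nonneg (suc t) l<n k<n (≡.trans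
    (solve 3 (λ l t n → l := l :+ :- t :* n :+ t :* n) ≡.refl (+ l) (+ suc t) (+ n))
    (≡.cong (ℤ._+ + suc t ℤ.* + n) (≡.sym eq))))
    where open IntegerRingSolver ℤ.+-*-commutativeRing

  -- The position of k in the cyclic order that starts at a = h - 1, left unsimplified so that it
  -- agrees with `residues` at h = a + 1.
  offset : ℕ → ℕ → ℕ
  offset a k = (+ k ℤ.- + suc a ℤ.+ 1ℤ) %ℕ n

  offset-spec : ∀ a k → + k ≡ + (a ℕ.+ offset a k) ℤ.+ (+ k ℤ.- + suc a ℤ.+ 1ℤ) /ℕ n ℤ.* + n
  offset-spec a k = ≡.trans
    (≡.trans (solve 2 (λ k a → k := a :+ (k :- (con (+ 1) :+ a) :+ con (+ 1))) ≡.refl (+ k) (+ a))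
      (≡.cong (λ i → + a ℤ.+ i) (a≡a%ℕn+[a/ℕn]*n (+ k ℤ.- + suc a ℤ.+ 1ℤ) n)))
    (≡.sym (ℤ.+-assoc (+ a) (+ offset a k) ((+ k ℤ.- + suc a ℤ.+ 1ℤ) /ℕ n ℤ.* + n)))
    where open IntegerRingSolver ℤ.+-*-commutativeRing

  %-spec : ∀ i → + i ≡ + (i % n) ℤ.+ + (i / n) ℤ.* + n
  %-spec i = ≡.trans (≡.cong (λ j → + j) (m≡m%n+[m/n]*n i n)) (≡.cong (λ j → + (i % n) ℤ.+ j) (ℤ.pos-* (i / n) n))

  offset≡⇒≡ : ∀ a {k b} → k ℕ.< n → offset a k ≡ b → k ≡ (a ℕ.+ b) % n
  offset≡⇒≡ a {k} k<n ≡.refl = residue-unique (+ (a+b / n) ℤ.+ t) k<n (m%n<n a+b n) (≡.trans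
    (≡.trans (offset-spec a k) (≡.cong (ℤ._+ t ℤ.* + n) (%-spec a+b)))
    (solve 4 (λ r u t n → r :+ u :* n :+ t :* n := r :+ (u :+ t) :* n) ≡.refl (+ (a+b % n)) (+ (a+b / n)) t (+ n)))
    where
    open IntegerRingSolver ℤ.+-*-commutativeRing
    a+b : ℕ
    a+b = a ℕ.+ offset a k
    t : ℤ
    t = (+ k ℤ.- + suc a ℤ.+ 1ℤ) /ℕ n

  ≡⇒offset≡ : ∀ a {k b} → b ℕ.< n → k ≡ (a ℕ.+ b) % n → offset a k ≡ b
  ≡⇒offset≡ a {k} {b} b<n k≡ = residue-unique (ℤ.- (t ℤ.+ u)) (n%ℕd<d (+ k ℤ.- + suc a ℤ.+ 1ℤ) n) b<n (begin
    + offset a k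
      ≡⟨ solve 4 (λ o a t n → o := a :+ o :+ t :* n :- a :- t :* n) ≡.refl (+ offset a k) (+ a) t (+ n) ⟩
    + (a ℕ.+ offset a k) ℤ.+ t ℤ.* + n ℤ.- + a ℤ.- t ℤ.* + n
      ≡⟨ ≡.cong (λ i → i ℤ.- + a ℤ.- t ℤ.* + n) (≡.trans (≡.sym (offset-spec a k)) (≡.cong (λ j → + j) k≡)) ⟩
    + ((a ℕ.+ b) % n) ℤ.- + a ℤ.- t ℤ.* + n
      ≡⟨ solve 5 (λ r u a t n → r :- a :- t :* n := r :+ u :* n :- a :- (t :+ u) :* n) ≡.refl (+ ((a ℕ.+ b) % n)) u (+ a) t (+ n) ⟩
    + ((a ℕ.+ b) % n) ℤ.+ u ℤ.* + n ℤ.- + a ℤ.- (t ℤ.+ u) ℤ.* + n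
      ≡⟨ ≡.cong (λ i → i ℤ.- + a ℤ.- (t ℤ.+ u) ℤ.* + n) (≡.sym (%-spec (a ℕ.+ b))) ⟩
    + (a ℕ.+ b) ℤ.- + a ℤ.- (t ℤ.+ u) ℤ.* + n
      ≡⟨ solve 4 (λ a b s n → a :+ b :- a :- s :* n := b :+ (:- s) :* n) ≡.refl (+ a) (+ b) (t ℤ.+ u) (+ n) ⟩
    + b ℤ.+ (ℤ.- (t ℤ.+ u)) ℤ.* + n ∎)
    where
    open IntegerRingSolver ℤ.+-*-commutativeRing
    open ≡.≡-Reasoning
    t u : ℤ
    t = (+ k ℤ.- + suc a ℤ.+ 1ℤ) /ℕ n
    u = + ((a ℕ.+ b) / n)

  -- The bound is computed in ℤ because it is -1 for b = 0, which occurs at n = 1 with ⌊n/2⌋ = 0.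
  ≤-1⇒< : ∀ {i} b → + i ℤ.≤ + b ℤ.- 1ℤ → i ℕ.< b
  ≤-1⇒< zero    ()
  ≤-1⇒< (suc b) (+≤+ i≤b) = s≤s i≤b

  <⇒≤-1 : ∀ {i} b → i ℕ.< b → + i ℤ.≤ + b ℤ.- 1ℤ
  <⇒≤-1 (suc b) (s≤s i≤b) = +≤+ i≤b

-- Sums over residue sets as cyclic arcs of powers.

module ResidueSums (ℝ : CompleteOrderedField) where
  open ComplexNumbers ℝ

  indicator : ∀ {P : Set} → Dec P → ℂ → ℂ
  indicator d z = if does d then z else 0ℂ

  sumPowers-filter : ∀ {P : Pred ℕ _} (P? : Decidable P) q n →
                     sumPowers q (filter P? (upTo n)) ≈ ∑ (λ k → indicator (P? k) (q ^ k)) n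
  sumPowers-filter P? q n = from-applyUpTo id n
    where
    from-applyUpTo : ∀ (f : ℕ → ℕ) n → sumPowers q (filter P? (applyUpTo f n)) ≈ ∑ (λ k → indicator (P? (f k)) (q ^ f k)) n
    from-applyUpTo f zero    = C.refl
    from-applyUpTo f (suc n) with P? (f 0)
    ... | yes _ = C.+-congˡ (from-applyUpTo (f ∘ suc) n)
    ... | no  _ = C.trans (from-applyUpTo (f ∘ suc) n) (C.sym (C.+-identityˡ _))

  ∑-0 : ∀ {f} n → (∀ k → k ℕ.< n → f k ≈ 0ℂ) → ∑ f n ≈ 0ℂ
  ∑-0 zero    f≈0 = C.refl
  ∑-0 (suc n) f≈0 = C.trans (C.+-cong (f≈0 0 z<s) (∑-0 n (λ k k<n → f≈0 (suc k) (s<s k<n)))) (C.+-identityˡ _)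

  indicator-cong : ∀ {P Q : Set} (P? : Dec P) (Q? : Dec Q) {z} → (P → Q) → (Q → P) → indicator P? z ≈ indicator Q? z
  indicator-cong (yes _) (yes _) _ _ = C.refl
  indicator-cong (no  _) (no  _) _ _ = C.refl
  indicator-cong (yes p) (no ¬q) f _ = contradiction (f p) ¬q
  indicator-cong (no ¬p) (yes q) _ g = contradiction (g q) ¬p

  indicator-no : ∀ {P : Set} (P? : Dec P) {z} → ¬ P → indicator P? z ≈ 0ℂ
  indicator-no (yes p) ¬p = contradiction p ¬p
  indicator-no (no  _) _  = C.refl

  indicator-⊎ : ∀ {P Q R : Set} (P? : Dec P) (Q? : Dec Q) (R? : Dec R) {z} →
                (P → Q ⊎ R) → (Q → P) → (R → P) → (Q → ¬ R) → indicator P? z ≈ indicator Q? z + indicator R? z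
  indicator-⊎ _       (yes q) (yes r) _ _ _ ¬qr = contradiction r (¬qr q)
  indicator-⊎ (yes _) (yes _) (no  _) _ _ _ _ = C.sym (C.+-identityʳ _)
  indicator-⊎ (yes _) (no  _) (yes _) _ _ _ _ = C.sym (C.+-identityˡ _)
  indicator-⊎ (no  _) (no  _) (no  _) _ _ _ _ = C.sym (C.+-identityˡ _)
  indicator-⊎ (yes p) (no ¬q) (no ¬r) f _ _ _ = contradiction (f p) [ ¬q , ¬r ]′
  indicator-⊎ (no ¬p) (yes q) _       _ g _ _ = contradiction (g q) ¬p
  indicator-⊎ (no ¬p) _       (yes r) _ _ h _ = contradiction (h r) ¬p

  ∑-indicator-≡ : ∀ f {l n} → l ℕ.< n → ∑ (λ k → indicator (k ℕ.≟ l) (f k)) n ≈ f l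
  ∑-indicator-≡ f {zero}  {suc n} _   = C.trans (C.+-congˡ (∑-0 n (λ _ _ → C.refl))) (C.+-identityʳ _)
  ∑-indicator-≡ f {suc l} {suc n} l<n = C.trans (C.+-identityˡ _)
    (C.trans (∑-cong n (λ k _ → suc-indicator k)) (∑-indicator-≡ (f ∘ suc) (s<s⁻¹ l<n)))
    where
    suc-indicator : ∀ k → indicator (suc k ℕ.≟ suc l) (f (suc k)) ≈ indicator (k ℕ.≟ l) (f (suc k))
    suc-indicator k = indicator-cong (suc k ℕ.≟ suc l) (k ℕ.≟ l) ℕ.suc-injective (≡.cong suc)

  module _ (q : ℂ) (n : ℕ) .{{_ : ℕ.NonZero n}} where
    -- The exponent is reduced, as the powers of q are not periodic: in the application qⁿ = pⁿ > 1.
    power : ℕ → ℂ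
    power k = q ^ (k % n)

    arc : ℕ → ℕ → ℂ
    arc a b = ∑ (λ j → power (a ℕ.+ j)) b

    -- The filtered list runs through the exponents in increasing order, the arc in cyclic order, so
    -- both are compared through indicators: raising b by one admits exactly the exponent (a + b)
    -- mod n, which is new because b < n.
    residues-sum : ∀ a b → b ℕ.≤ n → sumPowers q (residues n b (suc a)) ≈ arc a b
    residues-sum a b b≤n = C.trans (sumPowers-filter within? q n) (C.trans
      (∑-cong {λ k → indicator (within? k) (q ^ k)} {λ k → indicator (offset n a k ℕ.<? b) (q ^ k)} n (λ k _ → same-indicator k))
      (count b b≤n))
      where
      within? : ∀ k → Dec (+ offset n a k ℤ.≤ + b ℤ.- 1ℤ)
      within? k = + offset n a k ℤ.≤? + b ℤ.- 1ℤ

      same-indicator : ∀ k → indicator (within? k) (q ^ k) ≈ indicator (offset n a k ℕ.<? b) (q ^ k)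
      same-indicator k = indicator-cong (within? k) (offset n a k ℕ.<? b) (≤-1⇒< n b) (<⇒≤-1 n b)

      split : ∀ b → b ℕ.< n → ∀ k → k ℕ.< n → indicator (offset n a k ℕ.<? suc b) (q ^ k) ≈
              indicator (offset n a k ℕ.<? b) (q ^ k) + indicator (k ℕ.≟ (a ℕ.+ b) % n) (q ^ k)
      split b b<n k k<n = indicator-⊎ (offset n a k ℕ.<? suc b) (offset n a k ℕ.<? b) (k ℕ.≟ (a ℕ.+ b) % n)
        (λ o≤b → [ inj₁ , (λ o≡b → inj₂ (offset≡⇒≡ n a k<n o≡b)) ]′ (ℕ.m≤n⇒m<n∨m≡n (ℕ.s≤s⁻¹ o≤b)))
        ℕ.m<n⇒m<1+n
        (λ k≡ → ℕ.≤-reflexive (≡.cong suc (≡⇒offset≡ n a b<n k≡)))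
        (λ o<b k≡ → contradiction (≡⇒offset≡ n a b<n k≡) (ℕ.<⇒≢ o<b))

      count : ∀ b → b ℕ.≤ n → ∑ (λ k → indicator (offset n a k ℕ.<? b) (q ^ k)) n ≈ arc a b
      count zero    _   = ∑-0 n (λ k _ → indicator-no (offset n a k ℕ.<? 0) {q ^ k} ℕ.n≮0)
      count (suc b) b<n = begin
        ∑ (below (suc b)) n ≈⟨ ∑-cong {below (suc b)} {λ k → below b k + new k} n (split b b<n) ⟩
        ∑ (λ k → below b k + new k) n ≈⟨ ∑-+ (below b) new n ⟩
        ∑ (below b) n + ∑ new n ≈⟨ C.+-cong (count b (ℕ.<⇒≤ b<n)) (∑-indicator-≡ (q ^_) (m%n<n (a ℕ.+ b) n)) ⟩
        arc a b + power (a ℕ.+ b) ≈⟨ ∑-last (λ j → power (a ℕ.+ j)) b ⟨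
        arc a (suc b) ∎
        where
        open ≈-Reasoning
        below : ℕ → ℕ → ℂ
        below b k = indicator (offset n a k ℕ.<? b) (q ^ k)
        new : ℕ → ℂ
        new k = indicator (k ℕ.≟ (a ℕ.+ b) % n) (q ^ k)

    power-% : ∀ i j → (i % n ℕ.+ j) % n ≡ (i ℕ.+ j) % n
    power-% i j = ≡.trans (%-distribˡ-+ (i % n) j n) (≡.trans
      (≡.cong (λ k → (k ℕ.+ j % n) % n) (m%n%n≡m%n i n)) (≡.sym (%-distribˡ-+ i j n)))

    power-periodic : ∀ i → power (n ℕ.+ i) ≈ power i
    power-periodic i = C.reflexive (≡.cong (q ^_) (≡.trans (≡.cong (_% n) (ℕ.+-comm n i)) ([m+n]%n≡m%n i n)))

    power-< : ∀ {i} → i ℕ.< n → power i ≈ q ^ i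
    power-< i<n = C.reflexive (≡.cong (q ^_) (m<n⇒m%n≡m i<n))

    arc-% : ∀ a b → arc a b ≈ arc (a % n) b
    arc-% a b = ∑-cong b (λ j _ → C.reflexive (≡.cong (q ^_) (≡.sym (power-% a j))))

    -- Two ways to read the arc of length b + 1 from a; this is how an arc slides by one exponent.
    arc-shift : ∀ a b → power a + arc (suc a) b ≈ arc a b + power (a ℕ.+ b)
    arc-shift a b = C.trans (C.+-cong (C.reflexive (≡.cong power (≡.sym (ℕ.+-identityʳ a))))
        (∑-cong b (λ j _ → C.reflexive (≡.cong power (≡.sym (ℕ.+-suc a j))))))
      (∑-last (λ j → power (a ℕ.+ j)) b)

-- Interleaved sequences and parity.

interleave : ∀ {X : Set} → (ℕ → X) → (ℕ → X) → ℕ → X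
interleave a b zero    = a 0
interleave a b (suc j) = interleave b (a ∘ suc) j

interleave-elim : ∀ {X : Set} (P : ℕ → X → Set) {a b} →
                  (∀ i → P (i ℕ.+ i) (a i)) → (∀ i → P (suc (i ℕ.+ i)) (b i)) → ∀ j → P j (interleave a b j)
interleave-elim P pa pb zero    = pa 0
interleave-elim P {a} pa pb (suc j) = interleave-elim (P ∘ suc) pb
  (λ i → ≡.subst (λ k → P k (a (suc i))) (≡.cong suc (ℕ.+-suc i i)) (pa (suc i))) j

interleave-rel : ∀ {X Y : Set} (_~_ : X → Y → Set) {a b a′ b′} →
                 (∀ i → a i ~ a′ i) → (∀ i → b i ~ b′ i) → ∀ j → interleave a b j ~ interleave a′ b′ j
interleave-rel _~_ a~a′ b~b′ zero    = a~a′ 0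
interleave-rel _~_ a~a′ b~b′ (suc j) = interleave-rel _~_ b~b′ (a~a′ ∘ suc) j

interleave-zip : ∀ {X Y Z : Set} (f : X → Y → Z) a b a′ b′ j →
                 f (interleave a b j) (interleave a′ b′ j) ≡ interleave (λ i → f (a i) (a′ i)) (λ i → f (b i) (b′ i)) j
interleave-zip f a b a′ b′ zero    = ≡.refl
interleave-zip f a b a′ b′ (suc j) = interleave-zip f b (a ∘ suc) b′ (a′ ∘ suc) j

interleave-shift : ∀ {X : Set} (a b : ℕ → X) m j →
                   interleave a b (m ℕ.+ m ℕ.+ j) ≡ interleave (λ i → a (m ℕ.+ i)) (λ i → b (m ℕ.+ i)) j
interleave-shift a b zero    j = ≡.refl
interleave-shift a b (suc m) j rewrite ℕ.+-suc m m = interleave-shift (a ∘ suc) (b ∘ suc) m j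

parity : ∀ n → ∃[ m ] (n ≡ m ℕ.+ m ⊎ n ≡ suc (m ℕ.+ m))
parity zero    = 0 , inj₁ ≡.refl
parity (suc n) with parity n
... | m , inj₁ n≡ = m , inj₂ (≡.cong suc n≡)
... | m , inj₂ n≡ = suc m , inj₁ (≡.trans (≡.cong suc n≡) (≡.cong suc (≡.sym (ℕ.+-suc m m))))

⌈2a/2⌉≡a : ∀ a → ⌈ 2 ℕ.* a /2⌉ ≡ a
⌈2a/2⌉≡a a rewrite ℕ.+-identityʳ a = ≡.sym (ℕ.n≡⌈n+n/2⌉ a)

⌈1+2a/2⌉≡1+a : ∀ a → ⌈ suc (2 ℕ.* a) /2⌉ ≡ suc a
⌈1+2a/2⌉≡1+a a rewrite ℕ.+-identityʳ a = ≡.cong suc (≡.sym (ℕ.n≡⌊n+n/2⌋ a))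

2∤1+2a : ∀ a → ¬ (2 ∣ suc (2 ℕ.* a))
2∤1+2a a 2∣ with ∣1⇒≡1 (∣m+n∣m⇒∣n (≡.subst (2 ∣_) (ℕ.+-comm 1 (2 ℕ.* a)) 2∣) (m∣m*n a))
... | ()

-- The zonotope of the powers of q lies in the hull of the vₕ.

module Zonotope (ℝ : CompleteOrderedField) where
  open ComplexNumbers ℝ
  open RootsOfUnity ℝ
  open ConvexHulls ℝ
  open DigitExpansions ℝ
  open ResidueSums ℝ

  interleave-step : ∀ {A B a b} → (∀ i → B i ≈ A i + a i) → (∀ i → A (suc i) ≈ B i + b i) →
                    ∀ j → interleave A B (suc j) ≈ interleave A B j + interleave a b j
  interleave-step A→B B→A zero    = A→B 0
  interleave-step A→B B→A (suc j) = interleave-step B→A (A→B ∘ suc) j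

  ∑-interleave : ∀ f h m → ∑ (interleave f h) (suc (m ℕ.+ m)) ≈ ∑ f (suc m) + ∑ h m
  ∑-interleave f h zero    = C.sym (C.+-identityʳ _)
  ∑-interleave f h (suc m) = begin
    f 0 + (h 0 + ∑ (interleave (f ∘ suc) (h ∘ suc)) (m ℕ.+ suc m))
      ≡⟨ ≡.cong (λ k → f 0 + (h 0 + ∑ (interleave (f ∘ suc) (h ∘ suc)) k)) (ℕ.+-suc m m) ⟩
    f 0 + (h 0 + ∑ (interleave (f ∘ suc) (h ∘ suc)) (suc (m ℕ.+ m)))
      ≈⟨ C.+-congˡ (C.+-congˡ (∑-interleave (f ∘ suc) (h ∘ suc) m)) ⟩
    f 0 + (h 0 + (∑ (f ∘ suc) (suc m) + ∑ (h ∘ suc) m))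
      ≈⟨ solve 4 (λ x y s t → x :+ (y :+ (s :+ t)) := x :+ s :+ (y :+ t)) C.refl (f 0) (h 0) (∑ (f ∘ suc) (suc m)) (∑ (h ∘ suc) m) ⟩
    ∑ f (suc (suc m)) + ∑ h (suc m) ∎
    where
    open ≈-Reasoning
    open ℂ-Solver

  -- e^{iφ} and e^{i(φ+ψ)} span the area sin ψ.
  cross-powers : ∀ {ω} → ∣ ω ∣² ℝ.≈ 1# → ∀ ρ ρ′ i k →
                 cross (ρ • ω ^ i) (ρ′ • ω ^ (i ℕ.+ k)) ℝ.≈ ρ ℝ.* ρ′ ℝ.* im (ω ^ k)
  cross-powers {ω} ∣ω∣≈1 ρ ρ′ i k = begin-equality
    cross (ρ • ω ^ i) (ρ′ • ω ^ (i ℕ.+ k))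
      ≈⟨ cross-cong (C.refl {ρ • ω ^ i}) (•-cong refl (C^.^-homo-* ω i k)) ⟩
    cross (ρ • ω ^ i) (ρ′ • (ω ^ i * ω ^ k))
      ≈⟨ solve 6 (λ r s a b x y → r :* a :* (s :* (a :* y :+ b :* x)) :- r :* b :* (s :* (a :* x :- b :* y))
                   := r :* s :* y :* (a :* a :+ b :* b)) refl ρ ρ′ (re (ω ^ i)) (im (ω ^ i)) (re (ω ^ k)) (im (ω ^ k)) ⟩
    ρ ℝ.* ρ′ ℝ.* im (ω ^ k) ℝ.* ∣ ω ^ i ∣²
      ≈⟨ *-congˡ (∣z^k∣²≈1 {ω} ∣ω∣≈1 i) ⟩
    ρ ℝ.* ρ′ ℝ.* im (ω ^ k) ℝ.* 1#
      ≈⟨ *-identityʳ _ ⟩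
    ρ ℝ.* ρ′ ℝ.* im (ω ^ k) ∎
    where
    open ≤-Reasoning
    open ℝ-Solver

  -- The determinant of ωⁱ and ωʲ is the imaginary part of ω^{j-i}, positive because 0 < j - i < N.
  -- Positive factors keep the sign.
  Ordered-powers : ∀ {g ω N} → IsHalfTurnRoot N ω → (∀ j → j ℕ.< N → ∃[ ρ ] (0# < ρ × g j ≈ ρ • ω ^ j)) → Ordered g N
  Ordered-powers {g} {ω} {N} root form i j i<j j<N =
    let ρ , 0<ρ , gi≈ = form i (ℕ.<-trans i<j j<N)
        ρ′ , 0<ρ′ , gj≈ = form j j<N
        k = j ℕ.∸ i
        i+k≡j = ℕ.m+[n∸m]≡n (ℕ.<⇒≤ i<j)
    in <-respʳ (sym (trans (cross-cong gi≈ (C.trans gj≈ (C.reflexive (≡.cong (λ l → ρ′ • ω ^ l) (≡.sym i+k≡j)))))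
           (cross-powers {ω} (IsHalfTurnRoot.∣ω∣²≈1 root) ρ ρ′ i k)))
         (*-pos (*-pos 0<ρ 0<ρ′) (IsHalfTurnRoot.im-pos root k (ℕ.m<n⇒0<n∸m i<j) (ℕ.≤-<-trans (ℕ.m∸n≤m j i) j<N)))

  module _ (n : ℕ) .{{_ : ℕ.NonZero n}} (q : ℂ) where
    v-even : ∀ a → v n q (2 ℕ.* suc a) ≈ arc q n a ⌈ n /2⌉
    v-even a = C.trans (C.reflexive (≡.cong (sumPowers q) select)) (residues-sum q n a ⌈ n /2⌉ (ℕ.⌈n/2⌉≤n n))
      where
      select : (if does (2 ∣? 2 ℕ.* suc a) then K̄ n ⌈ 2 ℕ.* suc a /2⌉ else K̲ n ⌈ 2 ℕ.* suc a /2⌉) ≡ K̄ n (suc a)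
      select rewrite dec-true (2 ∣? 2 ℕ.* suc a) (m∣m*n (suc a)) = ≡.cong (λ h → K̄ n h) (⌈2a/2⌉≡a (suc a))

    v-odd : ∀ a → v n q (suc (2 ℕ.* a)) ≈ arc q n a ⌊ n /2⌋
    v-odd a = C.trans (C.reflexive (≡.cong (sumPowers q) select)) (residues-sum q n a ⌊ n /2⌋ (ℕ.⌊n/2⌋≤n n))
      where
      select : (if does (2 ∣? suc (2 ℕ.* a)) then K̄ n ⌈ suc (2 ℕ.* a) /2⌉ else K̲ n ⌈ suc (2 ℕ.* a) /2⌉) ≡ K̲ n (suc a)
      select rewrite dec-false (2 ∣? suc (2 ℕ.* a)) (2∤1+2a a) = ≡.cong (λ h → K̲ n h) (⌈1+2a/2⌉≡1+a a)

    residues-subset-sum : ∀ b h → Σ[ χ ∈ (ℕ → Bool) ] sumPowers q (residues n b h) ≈ ∑ (λ k → if χ k then q ^ k else 0ℂ) n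
    residues-subset-sum b h = (λ k → does (within? k)) , sumPowers-filter within? q n
      where
      within? : Decidable (λ k → + ((+ k ℤ.- + h ℤ.+ 1ℤ) %ℕ n) ℤ.≤ + b ℤ.- 1ℤ)
      within? k = + ((+ k ℤ.- + h ℤ.+ 1ℤ) %ℕ n) ℤ.≤? + b ℤ.- 1ℤ

    -- This is what brings vₕ into Λ: the coefficients 0 and 1 turn into the digits min A and max A.
    v-subset-sum : ∀ h → Σ[ χ ∈ (ℕ → Bool) ] v n q h ≈ ∑ (λ k → if χ k then q ^ k else 0ℂ) n
    v-subset-sum h with does (2 ∣? h)
    ... | true  = residues-subset-sum ⌈ n /2⌉ ⌈ h /2⌉
    ... | false = residues-subset-sum ⌊ n /2⌋ ⌈ h /2⌉

    Vertices EvenVertices : Pred ℂ 0ℓ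
    Vertices z = ∃[ h ] (1 ℕ.≤ h × h ℕ.≤ 2 ℕ.* n × z ≈ v n q h)
    EvenVertices z = ∃[ h ] (1 ℕ.≤ h × h ℕ.≤ n × z ≈ v n q (2 ℕ.* h))

    EvenVertices⊆Vertices : ∀ {z} → z ∈ EvenVertices → z ∈ Vertices
    EvenVertices⊆Vertices (h , 1≤h , h≤n , z≈) = 2 ℕ.* h , ℕ.≤-trans 1≤h (ℕ.m≤m+n h _) , ℕ.*-monoʳ-≤ 2 h≤n , z≈

    -- The start of an arc matters only modulo n, and h - 1 runs through all residues.
    arc∈EvenVertices : ∀ a {z} → z ≈ arc q n a ⌈ n /2⌉ → z ∈ EvenVertices
    arc∈EvenVertices a z≈ = suc (a % n) , s≤s z≤n , m%n<n a n , C.trans z≈ (C.trans (arc-% q n a ⌈ n /2⌉) (C.sym (v-even (a % n))))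

    arc∈Vertices : ∀ a {z} → z ≈ arc q n a ⌊ n /2⌋ → z ∈ Vertices
    arc∈Vertices a z≈ = suc (2 ℕ.* (a % n)) , s≤s z≤n , ℕ.<-≤-trans (ℕ.n<1+n _) (ℕ.≤-trans (s≤s (ℕ.n≤1+n _))
        (ℕ.≤-trans (ℕ.≤-reflexive (≡.sym (ℕ.*-suc 2 (a % n)))) (ℕ.*-monoʳ-≤ 2 (m%n<n a n))))
      , C.trans z≈ (C.trans (arc-% q n a ⌊ n /2⌋) (C.sym (v-odd (a % n))))

  InUnit : (ℕ → Carrier) → Set
  InUnit t = ∀ i → 0# ≤ t i × t i ≤ 1#

  -- n = 2m: the generators q^i and q^{m+i} are antiparallel and combine to q^i - q^{m+i}.
  module Even {m p ζ ω} .{{_ : ℕ.NonZero (m ℕ.+ m)}} (1<p : 1# < p) (root : IsHalfTurnRoot m ω) (ζ≈ω : ζ ≈ ω) where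
    private
      n : ℕ
      n = m ℕ.+ m

      q : ℂ
      q = p • ζ

      -- From u j to u (j + 1) the arc drops the exponent m + j and gains 2m + j, that is j modulo
      -- n; the difference is `g j`. The start `u 0` is the sum of the powers that enter `g` with a
      -- minus sign, and so makes up for the signs.
      g u : ℕ → ℂ
      g j = power q n j - power q n (m ℕ.+ j)
      u j = arc q n (m ℕ.+ j) m

      0<p : 0# < p
      0<p = ≤-<-trans 0≤1 1<p

      P : Carrier
      P = p ℝ.^ m

      0<P : 0# < P
      0<P = ^-pos m 0<p

      power-m+m : ∀ j → power q n (m ℕ.+ (m ℕ.+ j)) ≈ power q n j
      power-m+m j = C.trans (C.reflexive (≡.cong (power q n) (≡.sym (ℕ.+-assoc m m j)))) (power-periodic q n j)

      step : ∀ j → u (suc j) ≈ u j + g j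
      step j = begin
        arc q n (m ℕ.+ suc j) m
          ≡⟨ ≡.cong (λ a → arc q n a m) (ℕ.+-suc m j) ⟩
        arc q n (suc (m ℕ.+ j)) m
          ≈⟨ solve 2 (λ x y → y := x :+ y :- x) C.refl (power q n (m ℕ.+ j)) (arc q n (suc (m ℕ.+ j)) m) ⟩
        power q n (m ℕ.+ j) + arc q n (suc (m ℕ.+ j)) m - power q n (m ℕ.+ j)
          ≈⟨ C.+-congʳ (arc-shift q n (m ℕ.+ j) m) ⟩
        u j + power q n (m ℕ.+ j ℕ.+ m) - power q n (m ℕ.+ j)
          ≈⟨ C.+-congʳ (C.+-congˡ (C.trans (C.reflexive (≡.cong (power q n) (ℕ.+-comm (m ℕ.+ j) m))) (power-m+m j))) ⟩
        u j + power q n j - power q n (m ℕ.+ j)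
          ≈⟨ C.+-assoc _ _ _ ⟩
        u j + g j ∎
        where
        open ≈-Reasoning
        open ℂ-Solver

      antiperiodic : ∀ j → g (m ℕ.+ j) ≈ - g j
      antiperiodic j = C.trans (C.+-congˡ (C.-‿cong (power-m+m j)))
        (solve 2 (λ x y → y :- x := :- (x :- y)) C.refl (power q n j) (power q n (m ℕ.+ j)))
        where open ℂ-Solver

      q^[m+j] : ∀ j → q ^ (m ℕ.+ j) ≈ - (P • q ^ j)
      q^[m+j] j = begin
        q ^ (m ℕ.+ j) ≈⟨ C^.^-homo-* q m j ⟩
        q ^ m * q ^ j ≈⟨ C.*-congʳ (C.trans (•-^ p ζ m) (•-cong (refl {P}) (C.trans (C^.^-congˡ m ζ≈ω) (IsHalfTurnRoot.ω^N≈-1 root)))) ⟩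
        (P • (- 1ℂ)) * q ^ j ≈⟨ C.*-congʳ (•≈ι* P (- 1ℂ)) ⟩
        ι P * - 1ℂ * q ^ j ≈⟨ solve 2 (λ x y → x :* :- con (+ 1) :* y := :- (x :* y)) C.refl (ι P) (q ^ j) ⟩
        - (ι P * q ^ j) ≈⟨ C.-‿cong (•≈ι* P (q ^ j)) ⟨
        - (P • q ^ j) ∎
        where
        open ≈-Reasoning
        open ℂ-Solver

      g≈ : ∀ j → j ℕ.< m → g j ≈ q ^ j - q ^ (m ℕ.+ j)
      g≈ j j<m = C.+-cong (power-< q n (ℕ.<-≤-trans j<m (ℕ.m≤m+n m m))) (C.-‿cong (power-< q n (ℕ.+-monoʳ-< m j<m)))

      form : ∀ j → j ℕ.< m → ∃[ ρ ] (0# < ρ × g j ≈ ρ • ω ^ j)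
      form j j<m = (1# ℝ.+ P) ℝ.* p ℝ.^ j , *-pos (+-pos-nonneg 0<1 (<⇒≤ 0<P)) (^-pos j 0<p) , (begin
        g j ≈⟨ C.trans (g≈ j j<m) (C.+-congˡ (C.-‿cong (q^[m+j] j))) ⟩
        q ^ j - - (P • q ^ j) ≈⟨ factor (re (q ^ j)) , factor (im (q ^ j)) ⟩
        (1# ℝ.+ P) • q ^ j ≈⟨ •-cong (refl {1# ℝ.+ P}) (C.trans (•-^ p ζ j) (•-cong (refl {p ℝ.^ j}) (C^.^-congˡ j ζ≈ω))) ⟩
        (1# ℝ.+ P) • (p ℝ.^ j • ω ^ j) ≈⟨ •-assoc _ _ _ ⟨
        ((1# ℝ.+ P) ℝ.* p ℝ.^ j) • ω ^ j ∎)
        where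
        open ≈-Reasoning
        open ℝ-Solver
        factor : ∀ x → x ℝ.- ℝ.- (P ℝ.* x) ℝ.≈ (1# ℝ.+ P) ℝ.* x
        factor x = solve 2 (λ P x → x :- :- (P :* x) := (con (+ 1) :+ P) :* x) refl P x

    zonotope⊆Hull-even : ∀ t → InUnit t → Hull (EvenVertices n q) 1# (∑ (λ k → t k • q ^ k) n)
    zonotope⊆Hull-even t 0≤t≤1 = Hull-resp refl combined (Hull-mono
      (zonotope⊆walk-Hull g {m} u step antiperiodic t′ (proj₁ ∘ unit) (proj₂ ∘ unit) (Ordered-powers {g} {ω} root form)))
      where
      Hull-mono : ∀ {z} → Hull (λ z → ∃[ j ] z ≈ u j) 1# z → Hull (EvenVertices n q) 1# z
      Hull-mono {z} h = Hull-resp refl (C.+-identityʳ z) (Hull-translate 0ℂ (λ y (j , y≈) →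
        Hull-point (arc∈EvenVertices n q (m ℕ.+ j) (C.trans (C.+-identityʳ y) (C.trans y≈
          (C.reflexive (≡.cong (arc q n (m ℕ.+ j)) (ℕ.n≡⌈n+n/2⌉ m))))))) h)

      S : Carrier
      S = (1# ℝ.+ P) ℝ.⁻¹

      0<1+P : 0# < 1# ℝ.+ P
      0<1+P = +-pos-nonneg 0<1 (<⇒≤ 0<P)

      -- With q^{m+i} = -P q^i the coefficients must satisfy t i - P t (m + i) = (1 + P) t′ i - P,
      -- where the last -P comes from `u 0`; solved for t′ i.
      t′ : ℕ → Carrier
      t′ i = S ℝ.* (t i ℝ.+ P ℝ.* (1# ℝ.- t (m ℕ.+ i)))

      [1+P]t′ : ∀ i → (1# ℝ.+ P) ℝ.* t′ i ℝ.≈ t i ℝ.+ P ℝ.* (1# ℝ.- t (m ℕ.+ i))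
      [1+P]t′ i = trans (sym (*-assoc _ _ _)) (trans (*-congʳ (⁻¹-inverse 0<1+P)) (*-identityˡ _))

      unit : InUnit t′
      unit i = *-nonNeg (<⇒≤ (⁻¹-pos 0<1+P)) (+-nonneg (proj₁ (0≤t≤1 i)) (*-nonNeg (<⇒≤ 0<P) (diff-nonneg (proj₂ (0≤t≤1 (m ℕ.+ i))))))
             , *-cancel-≤ 0<1+P (≤-by (+-nonneg (diff-nonneg (proj₂ (0≤t≤1 i))) (*-nonNeg (<⇒≤ 0<P) (proj₁ (0≤t≤1 (m ℕ.+ i)))))
                 (trans (solve 3 (λ P x y → (con (+ 1) :+ P) :* con (+ 1) := x :+ P :* (con (+ 1) :- y) :+ (con (+ 1) :- x :+ P :* y)) refl P (t i) (t (m ℕ.+ i)))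
                   (+-congʳ (sym ([1+P]t′ i)))))
        where open ℝ-Solver

      pair : ∀ i → i ℕ.< m → t′ i • g i + power q n (m ℕ.+ 0 ℕ.+ i) ≈ t i • q ^ i + t (m ℕ.+ i) • q ^ (m ℕ.+ i)
      pair i i<m = begin
        t′ i • g i + power q n (m ℕ.+ 0 ℕ.+ i)
          ≈⟨ C.+-cong (•-cong (refl {t′ i}) (C.trans (g≈ i i<m) (C.+-congˡ (C.-‿cong (q^[m+j] i)))))
               (C.trans (C.reflexive (≡.cong (λ a → power q n (a ℕ.+ i)) (ℕ.+-identityʳ m)))
                 (C.trans (power-< q n (ℕ.+-monoʳ-< m i<m)) (q^[m+j] i))) ⟩
        t′ i • (q ^ i - - (P • q ^ i)) + - (P • q ^ i)
          ≈⟨ part (re (q ^ i)) , part (im (q ^ i)) ⟩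
        t i • q ^ i + t (m ℕ.+ i) • - (P • q ^ i)
          ≈⟨ C.+-congˡ (•-cong (refl {t (m ℕ.+ i)}) (q^[m+j] i)) ⟨
        t i • q ^ i + t (m ℕ.+ i) • q ^ (m ℕ.+ i) ∎
        where
        open ≈-Reasoning
        open ℝ-Solver
        part : ∀ x → t′ i ℝ.* (x ℝ.- ℝ.- (P ℝ.* x)) ℝ.+ ℝ.- (P ℝ.* x) ℝ.≈ t i ℝ.* x ℝ.+ t (m ℕ.+ i) ℝ.* ℝ.- (P ℝ.* x)
        part x = trans (solve 3 (λ s P x → s :* (x :- :- (P :* x)) :+ :- (P :* x) := ((con (+ 1) :+ P) :* s :- P) :* x) refl (t′ i) P x)
          (trans (*-congʳ (+-congʳ ([1+P]t′ i)))
            (solve 4 (λ a b P x → (a :+ P :* (con (+ 1) :- b) :- P) :* x := a :* x :+ b :* :- (P :* x)) refl (t i) (t (m ℕ.+ i)) P x))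

      combined : ∑ (λ i → t′ i • g i) m + u 0 ≈ ∑ (λ k → t k • q ^ k) n
      combined = begin
        ∑ (λ i → t′ i • g i) m + ∑ (λ i → power q n (m ℕ.+ 0 ℕ.+ i)) m
          ≈⟨ ∑-+ (λ i → t′ i • g i) (λ i → power q n (m ℕ.+ 0 ℕ.+ i)) m ⟨
        ∑ (λ i → t′ i • g i + power q n (m ℕ.+ 0 ℕ.+ i)) m
          ≈⟨ ∑-cong {λ i → t′ i • g i + power q n (m ℕ.+ 0 ℕ.+ i)} {λ i → t i • q ^ i + t (m ℕ.+ i) • q ^ (m ℕ.+ i)} m pair ⟩
        ∑ (λ i → t i • q ^ i + t (m ℕ.+ i) • q ^ (m ℕ.+ i)) m
          ≈⟨ ∑-+ (λ i → t i • q ^ i) (λ i → t (m ℕ.+ i) • q ^ (m ℕ.+ i)) m ⟩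
        ∑ (λ i → t i • q ^ i) m + ∑ (λ i → t (m ℕ.+ i) • q ^ (m ℕ.+ i)) m
          ≈⟨ ∑-split (λ i → t i • q ^ i) m m ⟨
        ∑ (λ k → t k • q ^ k) (m ℕ.+ m) ∎
        where open ≈-Reasoning

  -- n = 2m + 1: with ω = e^{iπ/n} the generators q^0, -q^{m+1}, q^1, -q^{m+2}, … are positive multiples of ω^0, ω^1, ω^2, ….
  module Odd {m p ζ ω} (1<p : 1# < p) (root : IsHalfTurnRoot (suc (m ℕ.+ m)) ω) (ζ≈ω² : ζ ≈ ω * ω) where
    private
      n : ℕ
      n = suc (m ℕ.+ m)

      q : ℂ
      q = p • ζ

      -- Arcs of lengths m and m + 1 alternate: from `A i` to `B i` the exponent i (modulo n) is
      -- appended, from `B i` to `A (i + 1)` the first exponent m + 1 + i is removed. The walk thus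
      -- alternates between the two kinds of vₕ.
      A B a b g u : ℕ → ℂ
      A i = arc q n (suc m ℕ.+ i) m
      B i = arc q n (suc m ℕ.+ i) (suc m)
      a i = power q n i
      b i = - power q n (suc m ℕ.+ i)
      g = interleave a b
      u = interleave A B

      0<p : 0# < p
      0<p = ≤-<-trans 0≤1 1<p

      power-wrap : ∀ i → power q n (suc m ℕ.+ i ℕ.+ m) ≈ power q n i
      power-wrap i = C.trans (C.reflexive (≡.cong (power q n) (≡.cong suc (≡.trans (ℕ.+-assoc m i m)
        (≡.trans (≡.cong (m ℕ.+_) (ℕ.+-comm i m)) (≡.sym (ℕ.+-assoc m m i))))))) (power-periodic q n i)

      A→B : ∀ i → B i ≈ A i + a i
      A→B i = C.trans (∑-last (λ j → power q n (suc m ℕ.+ i ℕ.+ j)) m) (C.+-congˡ (power-wrap i))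

      B→A : ∀ i → A (suc i) ≈ B i + b i
      B→A i = begin
        arc q n (suc m ℕ.+ suc i) m
          ≡⟨ ≡.cong (λ k → arc q n k m) (ℕ.+-suc (suc m) i) ⟩
        arc q n (suc (suc m ℕ.+ i)) m
          ≈⟨ solve 2 (λ x y → y := x :+ y :- x) C.refl (power q n (suc m ℕ.+ i)) (arc q n (suc (suc m ℕ.+ i)) m) ⟩
        power q n (suc m ℕ.+ i) + arc q n (suc (suc m ℕ.+ i)) m + b i
          ≈⟨ C.+-congʳ (C.trans (arc-shift q n (suc m ℕ.+ i) m)
               (C.sym (∑-last (λ j → power q n (suc m ℕ.+ i ℕ.+ j)) m))) ⟩
        B i + b i ∎
        where
        open ≈-Reasoning
        open ℂ-Solver

      -- n is odd, so a shift by n exchanges the interleaved sequences. Modulo n, position 2i then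
      -- carries the exponent 2m + 1 + i = i with a minus sign, and position 2i + 1 the exponent m +
      -- 1 + i with a plus sign.
      antiperiodic : ∀ j → g (n ℕ.+ j) ≈ - g j
      antiperiodic j = C.trans (C.reflexive (interleave-shift b (a ∘ suc) m j))
        (interleave-opposite j)
        where
        open ℂ-Solver
        interleave-opposite : ∀ j → interleave (λ i → b (m ℕ.+ i)) (λ i → a (suc (m ℕ.+ i))) j ≈ - interleave a b j
        interleave-opposite = interleave-rel (λ x y → x ≈ - y)
          (λ i → C.-‿cong (C.trans (C.reflexive (≡.cong (power q n) (≡.cong suc (≡.sym (ℕ.+-assoc m m i))))) (power-periodic q n i)))
          (λ i → solve 1 (λ x → x := :- (:- x)) C.refl (power q n (suc m ℕ.+ i)))

      1+i+i<n⇒i<m : ∀ {i} → suc (i ℕ.+ i) ℕ.< n → i ℕ.< m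
      1+i+i<n⇒i<m {i} i+i<m+m with i ℕ.<? m
      ... | yes i<m = i<m
      ... | no  i≮m = contradiction (s<s⁻¹ i+i<m+m) (ℕ.≤⇒≯ (ℕ.+-mono-≤ (ℕ.≮⇒≥ i≮m) (ℕ.≮⇒≥ i≮m)))

      q^≈ : ∀ k → q ^ k ≈ p ℝ.^ k • ω ^ (k ℕ.+ k)
      q^≈ k = C.trans (•-^ p ζ k) (•-cong (refl {p ℝ.^ k}) (C.trans (C^.^-congˡ k ζ≈ω²)
        (C.trans (C^.^-distrib-* ω ω k) (C.sym (C^.^-homo-* ω k k)))))

      ω^[n+k] : ∀ k → ω ^ (n ℕ.+ k) ≈ - ω ^ k
      ω^[n+k] k = C.trans (C^.^-homo-* ω n k) (C.trans (C.*-congʳ (IsHalfTurnRoot.ω^N≈-1 root))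
        (solve 1 (λ x → :- con (+ 1) :* x := :- x) C.refl (ω ^ k)))
        where open ℂ-Solver

      -- As ζ = ω² and ωⁿ = -1, the negated generator has the direction -ω^{2(m+1+i)} = -ω^{n+2i+1}
      -- = ω^{2i+1}: negation fills the odd positions.
      form : ∀ j → j ℕ.< n → ∃[ ρ ] (0# < ρ × g j ≈ ρ • ω ^ j)
      form = interleave-elim (λ j z → j ℕ.< n → ∃[ ρ ] (0# < ρ × z ≈ ρ • ω ^ j))
        (λ i i+i<n → p ℝ.^ i , ^-pos i 0<p , C.trans (power-< q n (ℕ.≤-<-trans (ℕ.m≤m+n i i) i+i<n)) (q^≈ i))
        (λ i 1+i+i<n → p ℝ.^ (suc m ℕ.+ i) , ^-pos (suc m ℕ.+ i) 0<p , (begin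
          - power q n (suc m ℕ.+ i)
            ≈⟨ C.-‿cong (C.trans (power-< q n (s<s (ℕ.+-monoʳ-< m (1+i+i<n⇒i<m 1+i+i<n)))) (q^≈ (suc m ℕ.+ i))) ⟩
          - (p ℝ.^ (suc m ℕ.+ i) • ω ^ (suc m ℕ.+ i ℕ.+ (suc m ℕ.+ i)))
            ≡⟨ ≡.cong (λ k → - (p ℝ.^ (suc m ℕ.+ i) • ω ^ k)) (index i) ⟩
          - (p ℝ.^ (suc m ℕ.+ i) • ω ^ (n ℕ.+ suc (i ℕ.+ i)))
            ≈⟨ C.-‿cong (•-cong (refl {p ℝ.^ (suc m ℕ.+ i)}) (ω^[n+k] (suc (i ℕ.+ i)))) ⟩
          - (p ℝ.^ (suc m ℕ.+ i) • - ω ^ suc (i ℕ.+ i))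
            ≈⟨ double-neg (re (ω ^ suc (i ℕ.+ i))) , double-neg (im (ω ^ suc (i ℕ.+ i))) ⟩
          p ℝ.^ (suc m ℕ.+ i) • ω ^ suc (i ℕ.+ i) ∎))
        where
        open ≈-Reasoning
        double-neg : ∀ {c} x → ℝ.- (c ℝ.* ℝ.- x) ℝ.≈ c ℝ.* x
        double-neg {c} x = solve 2 (λ c x → :- (c :* :- x) := c :* x) refl c x
          where open ℝ-Solver
        index : ∀ i → suc m ℕ.+ i ℕ.+ (suc m ℕ.+ i) ≡ n ℕ.+ suc (i ℕ.+ i)
        index i = solve 2 (λ m i → con 1 :+ m :+ i :+ (con 1 :+ m :+ i) := con 1 :+ (m :+ m) :+ (con 1 :+ (i :+ i))) ≡.refl m i
          where open +-*-Solver

    zonotope⊆Hull-odd : ∀ t → InUnit t → Hull (Vertices n q) 1# (∑ (λ k → t k • q ^ k) n)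
    zonotope⊆Hull-odd t 0≤t≤1 = Hull-resp refl combined (to-vertices
      (zonotope⊆walk-Hull g {n} u (interleave-step A→B B→A) antiperiodic t′ (proj₁ ∘ unit) (proj₂ ∘ unit) (Ordered-powers {g} {ω} root form)))
      where
      u∈Vertices : ∀ j → u j ∈ Vertices n q
      u∈Vertices = interleave-elim (λ _ z → z ∈ Vertices n q)
        (λ i → arc∈Vertices n q (suc m ℕ.+ i) (C.reflexive (≡.cong (arc q n (suc m ℕ.+ i)) (ℕ.n≡⌈n+n/2⌉ m))))
        (λ i → EvenVertices⊆Vertices n q (arc∈EvenVertices n q (suc m ℕ.+ i)
          (C.reflexive (≡.cong (λ k → arc q n (suc m ℕ.+ i) (suc k)) (ℕ.n≡⌊n+n/2⌋ m)))))

      Vertices-resp : ∀ {z w} → z ≈ w → w ∈ Vertices n q → z ∈ Vertices n q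
      Vertices-resp z≈w (h , 1≤h , h≤2n , w≈) = h , 1≤h , h≤2n , C.trans z≈w w≈

      to-vertices : ∀ {z} → Hull (λ z → ∃[ j ] z ≈ u j) 1# z → Hull (Vertices n q) 1# z
      to-vertices {z} h = Hull-resp refl (C.+-identityʳ z) (Hull-translate 0ℂ
        (λ y (j , y≈) → Hull-point (Vertices-resp (C.trans (C.+-identityʳ y) y≈) (u∈Vertices j))) h)

      -- t x = (1 - t)(-x) + x: negating a generator turns its coefficient into 1 - t, and the
      -- summand x is supplied by `u 0`.
      s t′ : ℕ → Carrier
      s i = 1# ℝ.- t (suc m ℕ.+ i)
      t′ = interleave t s

      unit : InUnit t′
      unit = interleave-elim (λ _ x → 0# ≤ x × x ≤ 1#) 0≤t≤1
        (λ i → diff-nonneg (proj₂ (0≤t≤1 (suc m ℕ.+ i))) , ≤-by (proj₁ (0≤t≤1 (suc m ℕ.+ i)))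
          (solve 1 (λ x → con (+ 1) := con (+ 1) :- x :+ x) refl (t (suc m ℕ.+ i))))
        where open ℝ-Solver

      combined : ∑ (λ j → t′ j • g j) n + u 0 ≈ ∑ (λ k → t k • q ^ k) n
      combined = begin
        ∑ (λ j → t′ j • g j) n + u 0
          ≈⟨ C.+-congʳ (∑-cong {λ j → t′ j • g j} {interleave (λ i → t i • a i) (λ i → s i • b i)} n
               (λ j _ → C.reflexive (interleave-zip _•_ t s a b j))) ⟩
        ∑ (interleave (λ i → t i • a i) (λ i → s i • b i)) n + u 0
          ≈⟨ C.+-congʳ (∑-interleave (λ i → t i • a i) (λ i → s i • b i) m) ⟩
        ∑ (λ i → t i • a i) (suc m) + ∑ (λ i → s i • b i) m + ∑ (λ i → power q n (suc m ℕ.+ 0 ℕ.+ i)) m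
          ≈⟨ C.trans (C.+-assoc _ _ _) (C.+-congˡ (C.sym (∑-+ (λ i → s i • b i) (λ i → power q n (suc m ℕ.+ 0 ℕ.+ i)) m))) ⟩
        ∑ (λ i → t i • a i) (suc m) + ∑ (λ i → s i • b i + power q n (suc m ℕ.+ 0 ℕ.+ i)) m
          ≈⟨ C.+-cong (∑-cong {λ i → t i • a i} {λ i → t i • q ^ i} (suc m) (λ i i≤m → •-cong (refl {t i}) (power-< q n (ℕ.<-≤-trans i≤m (s≤s (ℕ.m≤m+n m m))))))
               (∑-cong {λ i → s i • b i + power q n (suc m ℕ.+ 0 ℕ.+ i)} {λ i → t (suc m ℕ.+ i) • q ^ (suc m ℕ.+ i)} m unflip) ⟩
        ∑ (λ i → t i • q ^ i) (suc m) + ∑ (λ i → t (suc m ℕ.+ i) • q ^ (suc m ℕ.+ i)) m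
          ≈⟨ ∑-split (λ k → t k • q ^ k) (suc m) m ⟨
        ∑ (λ k → t k • q ^ k) (suc m ℕ.+ m) ∎
        where
        open ≈-Reasoning
        cancel : ∀ t x → (1# ℝ.- t) ℝ.* ℝ.- x ℝ.+ x ℝ.≈ t ℝ.* x
        cancel t x = solve 2 (λ t x → (con (+ 1) :- t) :* :- x :+ x := t :* x) refl t x
          where open ℝ-Solver
        unflip : ∀ i → i ℕ.< m → s i • b i + power q n (suc m ℕ.+ 0 ℕ.+ i) ≈ t (suc m ℕ.+ i) • q ^ (suc m ℕ.+ i)
        unflip i i<m = C.trans (C.+-congˡ (C.reflexive (≡.cong (λ k → power q n (suc (k ℕ.+ i))) (ℕ.+-identityʳ m))))
          (C.trans (cancel (t (suc m ℕ.+ i)) (re (power q n (suc m ℕ.+ i))) , cancel (t (suc m ℕ.+ i)) (im (power q n (suc m ℕ.+ i))))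
            (•-cong (refl {t (suc m ℕ.+ i)}) (power-< q n (s<s (ℕ.+-monoʳ-< m i<m)))))

-- From digit sequences to the convex hull of Λ.

module DigitHull (ℝ : CompleteOrderedField) where
  open ComplexNumbers ℝ
  open RootsOfUnity ℝ
  open ConvexHulls ℝ
  open DigitExpansions ℝ
  open Zonotope ℝ
  open Data.List.Membership.Setoid ℝ.setoid using () renaming (_∈_ to _∈ˡ_)
  private module Extrema = Data.List.Extrema ℝ.totalOrder

  All-∈ : ∀ {P : Pred Carrier 0ℓ} → (∀ {x y} → x ℝ.≈ y → P x → P y) → ∀ {xs x} → All P xs → x ∈ˡ xs → P x
  All-∈ resp (px ∷ _)  (here x≈)   = resp (sym x≈) px
  All-∈ resp (_ ∷ pxs) (there x∈) = All-∈ resp pxs x∈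

  min≤ : ∀ A {x} → x ∈ˡ toList A → min A ≤ x
  min≤ A = All-∈ ≤-respʳ (Extrema.min≤⊤ (head A) (tail A) ∷ Extrema.min≤xs (head A) (tail A))

  ≤max : ∀ A {x} → x ∈ˡ toList A → x ≤ max A
  ≤max A = All-∈ (λ x≈y x≤ → ≤-trans (≤-reflexive (sym x≈y)) x≤) (Extrema.⊥≤max (head A) (tail A) ∷ Extrema.xs≤max (head A) (tail A))

  max∈ : ∀ A → max A ∈ˡ toList A
  max∈ A with Extrema.argmax-sel id (head A) (tail A)
  ... | inj₁ max≡ = here (ℝ.reflexive max≡)
  ... | inj₂ max∈ = there (Any.map ℝ.reflexive max∈)

  min∈ : ∀ A → min A ∈ˡ toList A
  min∈ A with Extrema.argmin-sel id (head A) (tail A)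
  ... | inj₁ min≡ = here (ℝ.reflexive min≡)
  ... | inj₂ min∈ = there (Any.map ℝ.reflexive min∈)

  -- The factor r is 0 when all digits agree, so the affine map need not be invertible. Instead a
  -- preimage is given for each point of Y, and these are combined with the same weights.
  Hull-affine-preimage : ∀ {Y Y′ r d} → (∀ z → z ∈ Y → ∃[ y ] (Hull Y′ 1# y × z ≈ r • y + d)) →
                         ∀ {s z} → Hull Y s z → ∃[ y ] (Hull Y′ s y × z ≈ r • y + s • d)
  Hull-affine-preimage {r = r} {d} f {s} {z} (empty s≈0 (p , q)) = 0ℂ , empty s≈0 C.refl
    , (vanish (re d) p , vanish (im d) q)
    where
    open ℝ-Solver
    vanish : ∀ {x} d → x ℝ.≈ 0# → x ℝ.≈ r ℝ.* 0# ℝ.+ s ℝ.* d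
    vanish d x≈0 = trans x≈0 (trans (solve 2 (λ r d → con (+ 0) := r :* con (+ 0) :+ con (+ 0) :* d) refl r d) (+-congˡ (*-congʳ (sym s≈0))))
  Hull-affine-preimage {r = r} {d} f (add {s} {z} {s′} {z′} t y 0≤t y∈Y h p (q , q′)) =
    let x , hx , y≈ = f y y∈Y
        w , hw , z≈ = Hull-affine-preimage f h
    in t • x + w
     , Hull-resp (trans (+-congʳ (*-identityʳ t)) (sym p)) C.refl (Hull-+ (Hull-scale 0≤t hx) hw)
     , (regroup (re d) q (proj₁ y≈) (proj₁ z≈) , regroup (im d) q′ (proj₂ y≈) (proj₂ z≈))
    where
    open ℝ-Solver
    regroup : ∀ {z′ y x z w} d → z′ ℝ.≈ t ℝ.* y ℝ.+ z → y ℝ.≈ r ℝ.* x ℝ.+ d → z ℝ.≈ r ℝ.* w ℝ.+ s ℝ.* d →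
              z′ ℝ.≈ r ℝ.* (t ℝ.* x ℝ.+ w) ℝ.+ s′ ℝ.* d
    regroup {x = x} {w = w} d z′≈ y≈ z≈ = trans z′≈ (trans (+-cong (*-congˡ y≈) z≈)
      (trans (solve 6 (λ t r x d w s → t :* (r :* x :+ d) :+ (r :* w :+ s :* d) := r :* (t :* x :+ w) :+ (t :+ s) :* d) refl t r x d w s)
        (+-congˡ (*-congʳ (sym p)))))

  -- For r ≤ 0 the two bounds force x = b and the coordinate 0 serves, which covers an alphabet with
  -- a single value; for r > 0 it is (x - b)/r.
  unit-coordinate : ∀ {r b x} → b ≤ x → x ≤ b ℝ.+ r → ∃[ t ] ((0# ≤ t × t ≤ 1#) × x ℝ.≈ r ℝ.* t ℝ.+ b)
  unit-coordinate {r} {b} {x} b≤x x≤b+r with ≤-or-> r 0#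
  ... | inj₁ r≤0 = 0# , (≤-refl , 0≤1) , antisym
          (≤-trans x≤b+r (≤-by (neg-nonneg r≤0) (solve 2 (λ r b → r :* con (+ 0) :+ b := b :+ r :+ :- r) refl r b)))
          (≤-trans (≤-reflexive (solve 2 (λ r b → r :* con (+ 0) :+ b := b) refl r b)) b≤x)
    where open ℝ-Solver
  ... | inj₂ 0<r = r ℝ.⁻¹ ℝ.* (x ℝ.- b)
        , (*-nonNeg (<⇒≤ (⁻¹-pos 0<r)) (diff-nonneg b≤x)
          , *-cancel-≤ 0<r (≤-by (diff-nonneg x≤b+r) (trans (solve 3 (λ r b x → r :* con (+ 1) := x :- b :+ (b :+ r :- x)) refl r b x)
              (+-congʳ (sym rt≈)))))
        , trans (solve 2 (λ b x → x := x :- b :+ b) refl b x) (+-congʳ (sym rt≈))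
    where
    open ℝ-Solver
    rt≈ : r ℝ.* (r ℝ.⁻¹ ℝ.* (x ℝ.- b)) ℝ.≈ x ℝ.- b
    rt≈ = trans (sym (*-assoc _ _ _)) (trans (*-congʳ (⁻¹-inverse 0<r)) (*-identityˡ _))

  module _ {p ζ} (1<p : 1# < p) (∣ζ∣²≈1 : ∣ ζ ∣² ℝ.≈ 1#) {n} .{{_ : ℕ.NonZero n}} (ζ^n≈1 : ζ ^ n ≈ 1ℂ)
           (A : List⁺ Carrier) where
    open Base {p} {ζ} 1<p ∣ζ∣²≈1 {n} ζ^n≈1

    private
      lo hi r : Carrier
      lo = min A
      hi = max A
      r = (hi ℝ.- lo) ℝ.* c

      d : ℂ
      d = c • ∑ (λ k → lo • q ^ k) n

    affine-sum : ∀ {X t : ℕ → Carrier} → (∀ k → X k ℝ.≈ r ℝ.* t k ℝ.+ c ℝ.* lo) →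
                 ∑ (λ k → X k • q ^ k) n ≈ r • ∑ (λ k → t k • q ^ k) n + d
    affine-sum {X} {t} X≈ = begin
      ∑ (λ k → X k • q ^ k) n
        ≈⟨ ∑-cong {λ k → X k • q ^ k} {λ k → ι r * (t k • q ^ k) + ι c * (lo • q ^ k)} n (λ k _ → termwise k) ⟩
      ∑ (λ k → ι r * (t k • q ^ k) + ι c * (lo • q ^ k)) n
        ≈⟨ ∑-+ (λ k → ι r * (t k • q ^ k)) (λ k → ι c * (lo • q ^ k)) n ⟩
      ∑ (λ k → ι r * (t k • q ^ k)) n + ∑ (λ k → ι c * (lo • q ^ k)) n
        ≈⟨ C.+-cong (∑-*ˡ (ι r) (λ k → t k • q ^ k) n) (∑-*ˡ (ι c) (λ k → lo • q ^ k) n) ⟩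
      ι r * ∑ (λ k → t k • q ^ k) n + ι c * ∑ (λ k → lo • q ^ k) n
        ≈⟨ C.+-cong (•≈ι* r (∑ (λ k → t k • q ^ k) n)) (•≈ι* c (∑ (λ k → lo • q ^ k) n)) ⟨
      r • ∑ (λ k → t k • q ^ k) n + d ∎
      where
      open ≈-Reasoning
      expand : ∀ k x → X k ℝ.* x ℝ.≈ r ℝ.* (t k ℝ.* x) ℝ.+ c ℝ.* (lo ℝ.* x)
      expand k x = trans (*-congʳ (X≈ k)) (solve 5 (λ r t c l x → (r :* t :+ c :* l) :* x := r :* (t :* x) :+ c :* (l :* x)) refl r (t k) c lo x)
        where open ℝ-Solver
      termwise : ∀ k → X k • q ^ k ≈ ι r * (t k • q ^ k) + ι c * (lo • q ^ k)
      termwise k = C.trans (expand k (re (q ^ k)) , expand k (im (q ^ k)))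
        (C.+-cong (•≈ι* r (t k • q ^ k)) (•≈ι* c (lo • q ^ k)))

    -- The regrouped coefficients lie between c min A and c max A; their coordinates in this
    -- interval are the `t k`.
    Λ⊆zonotope : ∀ {z} → z ∈ Λ q A → Σ[ t ∈ (ℕ → Carrier) ] (InUnit t × z ≈ r • ∑ (λ k → t k • q ^ k) n + d)
    Λ⊆zonotope {z} (x , x∈A , x→z) = t , (λ k → proj₁ (proj₂ (coordinate k)))
      , C.trans (⟶-unique {∑ (λ j → x j • Q ^ suc j)} {z} {∑ (λ k → X (n ℕ.∸ suc k) • q ^ k) n} (HasSum⇒⟶ {λ j → x j • Q ^ suc j} {z} x→z) regroup)
          (affine-sum {λ k → X (n ℕ.∸ suc k)} {t} (λ k → proj₂ (proj₂ (coordinate k))))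
      where
      open Regroup {x} {lo} {hi} (min≤ A ∘ x∈A) (≤max A ∘ x∈A)
      open ℝ-Solver
      coordinate : ∀ k → ∃[ t ] ((0# ≤ t × t ≤ 1#) × X (n ℕ.∸ suc k) ℝ.≈ r ℝ.* t ℝ.+ c ℝ.* lo)
      coordinate k = unit-coordinate (proj₁ (X-bounds (n ℕ.∸ suc k))) (≤-respʳ
        (solve 3 (λ c l h → c :* h := c :* l :+ (h :- l) :* c) refl c lo hi) (proj₂ (X-bounds (n ℕ.∸ suc k))))
      t : ℕ → Carrier
      t k = proj₁ (coordinate k)

    -- The digits are max A on the subset that defines vₕ and min A elsewhere, repeated with period
    -- n.
    vertex∈Λ : ∀ h {y} → y ≈ v n q h → (r • y + d) ∈ Λ q A
    vertex∈Λ h {y} y≈v = digit , (λ j → digit∈A _) , ⟶⇒HasSum {λ j → digit j • Q ^ suc j} {r • y + d}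
      (⟶-cong {∑ (λ j → digit j • Q ^ suc j)} 0 (λ _ _ → C.refl) vertex≈ (periodic-expansion bounded))
      where
      χ : ℕ → Bool
      χ = proj₁ (v-subset-sum n q h)
      digits : ℕ → Carrier
      digits k = if χ k then hi else lo
      open Periodic digits

      digit∈A : ∀ k → digits k ∈ˡ toList A
      digit∈A k with χ k
      ... | true  = max∈ A
      ... | false = min∈ A

      bounded : ∀ k → ∣ digits k ∣ ≤ ∣ lo ∣ ℝ.+ ∣ hi ∣
      bounded k = ∣∣-least
        (≤-trans (≤max A (digit∈A k)) (≤-trans (x≤∣x∣ hi) (≤-by (0≤∣x∣ lo) (+-comm _ _))))
        (≤-trans (neg-mono-≤ (min≤ A (digit∈A k))) (≤-trans (-x≤∣x∣ lo) (≤-by (0≤∣x∣ hi) refl)))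

      t : ℕ → Carrier
      t k = if χ k then 1# else 0#

      c*digits : ∀ k → c ℝ.* digits k ℝ.≈ r ℝ.* t k ℝ.+ c ℝ.* lo
      c*digits k with χ k
      ... | true  = solve 3 (λ c l h → c :* h := (h :- l) :* c :* con (+ 1) :+ c :* l) refl c lo hi
        where open ℝ-Solver
      ... | false = solve 3 (λ c l h → c :* l := (h :- l) :* c :* con (+ 0) :+ c :* l) refl c lo hi
        where open ℝ-Solver

      t•≈ : ∀ k → t k • q ^ k ≈ (if χ k then q ^ k else 0ℂ)
      t•≈ k with χ k
      ... | true  = *-identityˡ _ , *-identityˡ _
      ... | false = zeroˡ _ , zeroˡ _

      vertex≈ : c • ∑ (λ k → digits k • q ^ k) n ≈ r • y + d
      vertex≈ = begin
        c • ∑ (λ k → digits k • q ^ k) n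
          ≈⟨ •≈ι* c (∑ (λ k → digits k • q ^ k) n) ⟩
        ι c * ∑ (λ k → digits k • q ^ k) n
          ≈⟨ ∑-*ˡ (ι c) (λ k → digits k • q ^ k) n ⟨
        ∑ (λ k → ι c * (digits k • q ^ k)) n
          ≈⟨ ∑-cong {λ k → ι c * (digits k • q ^ k)} {λ k → (c ℝ.* digits k) • q ^ k} n
               (λ k _ → C.trans (C.sym (•≈ι* c (digits k • q ^ k))) (C.sym (•-assoc c (digits k) (q ^ k)))) ⟩
        ∑ (λ k → (c ℝ.* digits k) • q ^ k) n
          ≈⟨ affine-sum {λ k → c ℝ.* digits k} {t} c*digits ⟩
        r • ∑ (λ k → t k • q ^ k) n + d
          ≈⟨ C.+-congʳ (•-cong (refl {r}) (∑-cong {λ k → t k • q ^ k} {λ k → if χ k then q ^ k else 0ℂ} n (λ k _ → t•≈ k))) ⟩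
        r • ∑ (λ k → if χ k then q ^ k else 0ℂ) n + d
          ≈⟨ C.+-congʳ (•-cong (refl {r}) (C.trans y≈v (proj₂ (v-subset-sum n q h)))) ⟨
        r • y + d ∎
        where open ≈-Reasoning

    -- Any family of vₕ whose hull contains the zonotope will do; this serves both the full family
    -- and the one of even indices.
    conv-Λ : (V : Pred ℂ 0ℓ) → (∀ t → InUnit t → Hull V 1# (∑ (λ k → t k • q ^ k) n)) →
             (∀ y → y ∈ V → ∃[ h ] y ≈ v n q h) → conv (Λ q A) ≐ (r · conv V ⊕ d)
    conv-Λ V zonotope⊆ V⊆v =
      (λ z∈ → let y , hy , z≈ = Hull-affine-preimage {Λ q A} {V} {r} {d}
                      (λ z z∈Λ → let t , 0≤t≤1 , z≈ = Λ⊆zonotope z∈Λ in _ , zonotope⊆ t 0≤t≤1 , z≈) (conv⇒Hull {Λ q A} z∈)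
              in y , Hull⇒conv {V} hy , C.trans z≈ (C.+-congˡ (*-identityˡ _ , *-identityˡ _))) ,
      (λ (y , y∈ , z≈) → Hull⇒conv {Λ q A} (Hull-resp refl (C.sym z≈)
        (Hull-affine₁ {V} {Λ q A} r d (λ y y∈V → let h , y≈v = V⊆v y y∈V in Hull-point {Λ q A} (vertex∈Λ h y≈v)) (conv⇒Hull {V} y∈))))

    conv-Λ-vertices : (∀ t → InUnit t → Hull (Vertices n q) 1# (∑ (λ k → t k • q ^ k) n)) →
           (2 ∣ n → ∀ t → InUnit t → Hull (EvenVertices n q) 1# (∑ (λ k → t k • q ^ k) n)) →
           (conv (Λ q A) ≐ (r · conv (Vertices n q) ⊕ d)) ×
           (2 ∣ n → conv (Λ q A) ≐ (r · conv (EvenVertices n q) ⊕ d))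
    conv-Λ-vertices ⊆V ⊆E = conv-Λ (Vertices n q) ⊆V (λ y (h , _ , _ , y≈) → h , y≈)
               , λ 2∣n → conv-Λ (EvenVertices n q) (⊆E 2∣n) (λ y (h , _ , _ , y≈) → 2 ℕ.* h , y≈)

  module _ {n ζ} .{{_ : ℕ.NonZero n}} (isExp : IsExp2πi/ n ζ) where
    ∣ζ∣²≈1 : ∣ ζ ∣² ℝ.≈ 1#
    ∣ζ∣²≈1 =
      let ω , root , ζ≈ω² = root-any {n} {ζ} isExp
          open IsHalfTurnRoot root
      in trans (+-cong (*-cong (proj₁ ζ≈ω²) (proj₁ ζ≈ω²)) (*-cong (proj₂ ζ≈ω²) (proj₂ ζ≈ω²)))
           (trans (∣zw∣² ω ω) (trans (*-cong ∣ω∣²≈1 ∣ω∣²≈1) (*-identityˡ _)))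

    ζ^n≈1 : ζ ^ n ≈ 1ℂ
    ζ^n≈1 =
      let ω , root , ζ≈ω² = root-any {n} {ζ} isExp
          open IsHalfTurnRoot root
      in C.trans (C^.^-congˡ n ζ≈ω²) (C.trans (C^.^-distrib-* ω ω n) (C.trans (C.*-cong ω^N≈-1 ω^N≈-1)
           (ℂ-Solver.solve 0 (let open ℂ-Solver in :- con (+ 1) :* :- con (+ 1) := con (+ 1)) C.refl)))

  module _ {n p ζ} .{{_ : ℕ.NonZero n}} (1<p : 1# < p) (isExp : IsExp2πi/ n ζ) where
    zonotope⊆vertices : (∀ t → InUnit t → Hull (Vertices n (p • ζ)) 1# (∑ (λ k → t k • (p • ζ) ^ k) n)) ×
                    (2 ∣ n → ∀ t → InUnit t → Hull (EvenVertices n (p • ζ)) 1# (∑ (λ k → t k • (p • ζ) ^ k) n))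
    zonotope⊆vertices with parity n
    ... | m , inj₁ ≡.refl =
          let ω , root , ζ≈ω = root-even {m ℕ.+ m} {ζ} isExp m (≡.cong (m ℕ.+_) (≡.sym (ℕ.+-identityʳ m)))
              ⊆E = Even.zonotope⊆Hull-even {m} {p} {ζ} {ω} 1<p root ζ≈ω
          in (λ t 0≤t≤1 → Hull-resp refl (C.+-identityʳ _) (Hull-translate 0ℂ
               (λ y (h , 1≤h , h≤n , y≈) → Hull-point (EvenVertices⊆Vertices (m ℕ.+ m) (p • ζ) (h , 1≤h , h≤n , C.trans (C.+-identityʳ y) y≈))) (⊆E t 0≤t≤1)))
           , λ _ → ⊆E
    ... | m , inj₂ ≡.refl =
          let ω , root , ζ≈ω² = root-any {suc (m ℕ.+ m)} {ζ} isExp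
          in Odd.zonotope⊆Hull-odd {m} {p} {ζ} {ω} 1<p root ζ≈ω²
           , λ 2∣n → contradiction (≡.subst (λ k → 2 ∣ suc (m ℕ.+ k)) (≡.sym (ℕ.+-identityʳ m)) 2∣n) (2∤1+2a m)

theorem3p15 : (ℝ : CompleteOrderedField) → let open Analysis ℝ in
    (n : ℕ) .{{_ : ℕ.NonZero n}} (p : ℝ.Carrier) (ζ : ℂ) (A : List⁺ ℝ.Carrier) →
    ℝ.1# ℝ.< p → IsExp2πi/ n ζ →
    let q = p • ζ
        c = (p ℝ.^ n ℝ.- ℝ.1#) ℝ.⁻¹
        r = (max A ℝ.- min A) ℝ.* c
        d = c • sum {n} (λ k → min A • q ^ toℕ k)
    in
    (conv (Λ q A) ≐
      (r · conv (λ z → ∃[ h ] (1 ℕ.≤ h × h ℕ.≤ 2 ℕ.* n × z ≈ v n q h)) ⊕ d))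
    ×
    (2 ∣ n →
      conv (Λ q A) ≐
      (r · conv (λ z → ∃[ h ] (1 ℕ.≤ h × h ℕ.≤ n × z ≈ v n q (2 ℕ.* h))) ⊕ d))
theorem3p15 ℝ n p ζ A 1<p isExp =
  let ⊆V , ⊆E = zonotope⊆vertices {n} {p} {ζ} 1<p isExp
  in conv-Λ-vertices {p} {ζ} 1<p (∣ζ∣²≈1 {n} {ζ} isExp) {n} (ζ^n≈1 {n} {ζ} isExp) A ⊆V ⊆E
  where open DigitHull ℝ
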